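{- For all integers $n\ge 0$ the following congruences modulo 2 hold: $$b_{50}(875n - 26 + 25B) \equiv p_{23}(35n+B) \text{ for } B \in \{11, 18, 21, 26, 28, 33\};$$ $$b_{100}(875n - 26 + 25B) \equiv p_{21}(35n+B) \text{ for } B \in \{6, 12, 17, 26, 27, 31\};$$ $$b_{200}(6125n - 26 + 25B) \equiv p_{17}(245n+B) \text{ for } B \in \{22, 29, 92, 127, 169, 239\};$$ $$b_{400}(1125n - 26 + 25B) \equiv p_{9}(45n+B) \text{ for } B \in \{3, 9, 18, 39\};$$ $$b_{232}(841n - 35 + 29B) \equiv p_{21}(29n+B) \text{ for } B \in \{3, 6, 10, 12, 13, 14, 15, 18, 20, 23, 24, 25, 26, 28\}.$$
   Context: For a positive integer $m$, $b_m(n)$ denotes the number of partitions of $n$ none of whose parts is divisible by $m$; equivalently $\sum_{n\ge0} b_m(n)q^n = \prod_{i\ge1}(1-q^{mi})/(1-q^i)$. For a positive integer $t$, $p_t(n)$ denotes the number of $t$-multipartitions of $n$ (ordered $t$-tuples of partitions with total size $n$); equivalently $\sum_{n\ge0}p_t(n)q^n=\prod_{i\ge1}(1-q^i)^{ -t}$. -}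

module Defs where

open import Data.Nat using (ℕ; zero; suc; _+_; _*_; _∸_; _≤ᵇ_; _%_)
open import Data.Nat.Divisibility using (_∣?_)
open import Data.Bool using (Bool; true; false; if_then_else_; not)
open import Data.List using (List; map; upTo)
open import Data.Nat.ListAction using (sum)
open import Relation.Nullary.Decidable using (⌊_⌋)

-- restrictedCount allowed k n : number of partitions of n all of whose parts
-- lie in {1,…,k} and satisfy the predicate `allowed`.
-- Recursion on the largest admissible part size k: choose the multiplicity j
-- of the part (suc k) (j * suc k ≤ n), the rest is a partition with parts ≤ k.
restrictedCount : (ℕ → Bool) → ℕ → ℕ → ℕ
restrictedCount allowed zero zero = 1
restrictedCount allowed zero (suc n) = 0
restrictedCount allowed (suc k) n =
  if allowed (suc k)
  then sum (map (λ j → if j * suc k ≤ᵇ n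
                       then restrictedCount allowed k (n ∸ j * suc k)
                       else 0)
                (upTo (suc n)))
  else restrictedCount allowed k n

-- p(n): the ordinary partition function (parts ≤ n suffice)
p : ℕ → ℕ
p n = restrictedCount (λ _ → true) n n

b : ℕ → ℕ → ℕ
b m n = restrictedCount (λ i → not ⌊ m ∣? i ⌋) n n

-- pm t n : number of t-multipartitions of n (ordered t-tuples of partitions
-- with total size n); the t-fold convolution of p.
pm : ℕ → ℕ → ℕ
pm zero zero = 1
pm zero (suc n) = 0
pm (suc t) n = sum (map (λ i → p i * pm t (n ∸ i)) (upTo (suc n)))

{-# OPTIONS --safe #-}
-- Modulo 2 and up to fractional powers of q, write η = ∏ (1 + qⁱ) and P = 1/η.  Then
-- b_m and p_t have generating functions η(q^m) P and P^t, and η(q^ℓ) = η^ℓ when ℓ is a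
-- power of 2.  The congruences come from the two dissections
--   ∑ p(25m − 26) q^m = P²⁵ + q P + P(q⁵)⁵,   ∑ p(29m − 35) q^m = P²⁹ + q P⁵ + P(q²⁹):
-- after multiplication by η^ℓ the first term is the generating function of p_t, and the
-- exponents of the other two are confined by quadratic residues.
--
-- A modular equation between η and η(q^p) yields a monic polynomial whose roots are, up to
-- a common factor, 1/η(q^p) and the conjugates 1/η(ζ^i q^(1/p)); its second coefficient
-- gives the dissection.  The modular equations themselves are reduced to level 3:
-- Δ = q η²⁴ = ∑ q^(odd²) satisfies Δ⁴ + Δ(q³)⁴ = Δ Δ(q³), and this functional equation
-- determines its solutions by their leading terms.  Hence two series built from a
-- rational parametrisation of X₀(p)/⟨w_p⟩, with a parameter obtained as a fixed point of
-- the modular correspondence of level 3, are recognised as Δ and Δ(q^p) by checking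
-- polynomial identities.
module Submission where

open import Defs
open import Data.Nat using (ℕ; _+_; _*_; _∸_; _%_)
open import Data.List using (List; _∷_; [])
open import Data.List.Membership.Propositional using (_∈_)
open import Data.Product using (_×_)
open import Relation.Binary.PropositionalEquality using (_≡_)

open import Data.Bool using (Bool; true; false; _∧_; _xor_; not; if_then_else_) renaming (T to IsTrue)
open import Data.Bool.Properties
  using (xor-assoc; xor-comm; xor-same; xor-identityʳ; ∧-assoc; ∧-comm; ∧-zeroʳ; ∧-identityʳ;
         ∧-distribˡ-xor; ∧-distribʳ-xor; ∧-idem; not-involutive)
open import Data.Empty using (⊥; ⊥-elim)
open import Data.Fin using (Fin; zero; suc)
open import Data.List using (map; length; upTo; applyUpTo; _∷ʳ_)
open import Data.List.Properties using (map-++; map-applyUpTo; applyUpTo-∷ʳ; length-map)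
open import Data.List.Relation.Unary.All using (All; []; _∷_; all?)
import Data.List.Relation.Unary.All as All
open import Data.List.Relation.Unary.AllPairs using (AllPairs; []; _∷_)
open import Data.Maybe using (Maybe; just; nothing)
open import Data.Nat using (zero; suc; _≤_; _<_; z≤n; s≤s; _≡ᵇ_; _<ᵇ_; _≤ᵇ_; _/_; NonZero; _≟_)
open import Data.Nat.Coprimality using (Coprime; coprime?; coprime-Bézout; prime⇒coprime)
import Data.Nat.Coprimality as Coprimality
open import Data.Nat.DivMod using (m≡m%n+[m/n]*n; [m+kn]%n≡m%n; m%n<n; m*n%n≡0; m<n⇒m%n≡m)
open import Data.Nat.Divisibility using (_∣_; _∣?_; divides; ∣m+n∣m⇒∣n; ∣⇒≤; n∣m*n)
open import Data.Nat.GCD using (module Bézout)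
open import Data.Nat.Induction using (<-rec)
open import Data.Nat.ListAction using (sum)
open import Data.Nat.ListAction.Properties using (sum-++)
open import Data.Nat.Primality using (Prime; prime?; prime⇒irreducible)
open import Data.Nat.Properties hiding (_≟_)
open import Data.Nat.Tactic.RingSolver using (solve-∀)
open import Data.Product using (_,_; proj₁; proj₂; ∃)
open import Data.Sum using (_⊎_; inj₁; inj₂)
open import Data.Unit using (tt)
open import Data.Vec using (Vec; []; _∷_; lookup)
open import Function using (_∘_; id)
open import Relation.Binary.PropositionalEquality
  using (_≢_; refl; sym; trans; cong; cong₂; subst; module ≡-Reasoning)
open import Relation.Nullary using (Dec; yes; no; ¬_; does)
open import Relation.Nullary.Decidable using (⌊_⌋; isYes≗does; dec-true; dec-false; from-yes; ¬?; map′)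

-- The constants: 50, 100, 200, 400 are 25ℓ with ℓ = 2, 4, 8, 16, and 232 is 29 · 8; the shifts are
-- 26 = (25² - 1)/24 and 35 = (29² - 1)/24. After multiplication by η^ℓ the middle term is q
-- η^(ℓ-1), respectively q η³. The powers η and η³ are theta series, so one residue condition
-- suffices; η¹⁵ is a product of two of them; for η⁷ level 7 and a formula for T₇ η⁷ are used
-- instead. The last term is governed by residues modulo 5 or 29. The obstacle is the absence of
-- analysis over 𝔽₂: a modular form is only a series with a functional equation, so every identity
-- is reduced to uniqueness of solutions and to polynomial identities. Nor are the conjugates of a
-- root series with coefficients in 𝔽₂. The root of unity ζ is modelled by a shift of a second
-- index, modulo 1 + ζ + ... + ζ^(p-1). The resulting ring need not be a domain, so the differences
-- of the roots must be shown to be no zero divisors before the sum of the roots can be read off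
-- from the polynomial.

xor-interchange : ∀ a b c d → (a xor b) xor (c xor d) ≡ (a xor c) xor (b xor d)
xor-interchange a b c d =
  trans (xor-assoc a b (c xor d))
    (trans (cong (a xor_) (trans (sym (xor-assoc b c d))
                           (trans (cong (_xor d) (xor-comm b c)) (xor-assoc c b d))))
      (sym (xor-assoc a c (b xor d))))

xor-swap : ∀ a b c → a xor (b xor c) ≡ b xor (a xor c)
xor-swap a b c = trans (sym (xor-assoc a b c)) (trans (cong (_xor c) (xor-comm a b)) (xor-assoc b a c))

-- Formal power series over 𝔽₂

Series : Set
Series = ℕ → Bool

infix 4 _≈_ _≡[_]_
infixl 6 _⊕_
infixl 7 _⊗_
infixr 8 _•_

_≈_ : Series → Series → Set
f ≈ g = ∀ n → f n ≡ g n

_≡[_]_ : Series → ℕ → Series → Set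
f ≡[ n ] g = ∀ i → i < n → f i ≡ g i

hd : Series → Bool
hd f = f 0

tl : Series → Series
tl f n = f (suc n)

𝟘 𝟙 𝕢 : Series
𝟘 _ = false
𝟙 zero = true
𝟙 (suc _) = false
𝕢 zero = false
𝕢 (suc n) = 𝟙 n

_⊕_ : Series → Series → Series
(f ⊕ g) n = f n xor g n

_•_ : Bool → Series → Series
(b • f) n = b ∧ f n

_⊗_ : Series → Series → Series
(f ⊗ g) zero = f 0 ∧ g 0
(f ⊗ g) (suc n) = (f 0 ∧ g (suc n)) xor (tl f ⊗ g) n

pow : Series → ℕ → Series
pow f zero = 𝟙
pow f (suc n) = f ⊗ pow f n

≈-refl : ∀ {f} → f ≈ f
≈-refl n = refl

≈-sym : ∀ {f g} → f ≈ g → g ≈ f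
≈-sym p n = sym (p n)

≈-trans : ∀ {f g h} → f ≈ g → g ≈ h → f ≈ h
≈-trans p r n = trans (p n) (r n)

≈⇒≡[] : ∀ {f g} n → f ≈ g → f ≡[ n ] g
≈⇒≡[] n p i _ = p i

≡[]⇒≈ : ∀ {f g} → (∀ n → f ≡[ n ] g) → f ≈ g
≡[]⇒≈ p n = p (suc n) n ≤-refl

≡[]-sym : ∀ {n f g} → f ≡[ n ] g → g ≡[ n ] f
≡[]-sym p i l = sym (p i l)

≡[]-trans : ∀ {n f g h} → f ≡[ n ] g → g ≡[ n ] h → f ≡[ n ] h
≡[]-trans p r i l = trans (p i l) (r i l)

≡[]-weaken : ∀ {m n f g} → m ≤ n → f ≡[ n ] g → f ≡[ m ] g
≡[]-weaken m≤n p i l = p i (<-≤-trans l m≤n)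

⊕-cong[] : ∀ {n f f′ g g′} → f ≡[ n ] f′ → g ≡[ n ] g′ → f ⊕ g ≡[ n ] f′ ⊕ g′
⊕-cong[] p r i l = cong₂ _xor_ (p i l) (r i l)

⊕-congʳ[] : ∀ c {n g g′} → g ≡[ n ] g′ → c ⊕ g ≡[ n ] c ⊕ g′
⊕-congʳ[] c r i l = cong (c i xor_) (r i l)

⊗-cong-at : ∀ n {f f′ g g′} → f ≡[ suc n ] f′ → g ≡[ suc n ] g′ → (f ⊗ g) n ≡ (f′ ⊗ g′) n
⊗-cong-at zero p r = cong₂ _∧_ (p 0 ≤-refl) (r 0 ≤-refl)
⊗-cong-at (suc n) p r =
  cong₂ _xor_ (cong₂ _∧_ (p 0 (s≤s z≤n)) (r (suc n) ≤-refl))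
    (⊗-cong-at n (λ i l → p (suc i) (s≤s l)) (λ i l → r i (m≤n⇒m≤1+n l)))

⊗-cong[] : ∀ {n f f′ g g′} → f ≡[ n ] f′ → g ≡[ n ] g′ → f ⊗ g ≡[ n ] f′ ⊗ g′
⊗-cong[] p r i l = ⊗-cong-at i (≡[]-weaken l p) (≡[]-weaken l r)

⊕-cong : ∀ {f f′ g g′} → f ≈ f′ → g ≈ g′ → f ⊕ g ≈ f′ ⊕ g′
⊕-cong p r n = cong₂ _xor_ (p n) (r n)

⊕-congʳ : ∀ c {g g′} → g ≈ g′ → c ⊕ g ≈ c ⊕ g′
⊕-congʳ c r n = cong (c n xor_) (r n)

⊗-cong : ∀ {f f′ g g′} → f ≈ f′ → g ≈ g′ → f ⊗ g ≈ f′ ⊗ g′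
⊗-cong p r n = ⊗-cong-at n (≈⇒≡[] _ p) (≈⇒≡[] _ r)

⊗-congˡ : ∀ {f g g′} → g ≈ g′ → f ⊗ g ≈ f ⊗ g′
⊗-congˡ = ⊗-cong ≈-refl

⊗-congʳ : ∀ {f f′ g} → f ≈ f′ → f ⊗ g ≈ f′ ⊗ g
⊗-congʳ p = ⊗-cong p ≈-refl

pow-cong[] : ∀ {n f g} → f ≡[ n ] g → ∀ k → pow f k ≡[ n ] pow g k
pow-cong[] p zero i l = refl
pow-cong[] p (suc k) = ⊗-cong[] p (pow-cong[] p k)

pow-cong : ∀ {f g} → f ≈ g → ∀ k → pow f k ≈ pow g k
pow-cong p zero = ≈-refl
pow-cong p (suc k) = ⊗-cong p (pow-cong p k)

⊕-assoc : ∀ f g h → (f ⊕ g) ⊕ h ≈ f ⊕ (g ⊕ h)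
⊕-assoc f g h n = xor-assoc (f n) (g n) (h n)

⊕≈𝟘⇒≈ : ∀ {f g} → f ⊕ g ≈ 𝟘 → f ≈ g
⊕≈𝟘⇒≈ {f} {g} p n with f n | g n | p n
... | false | false | _ = refl
... | true  | true  | _ = refl

≈⇒⊕≈𝟘 : ∀ {f g} → f ≈ g → f ⊕ g ≈ 𝟘
≈⇒⊕≈𝟘 {f} {g} p n = trans (cong (_xor g n) (p n)) (xor-same (g n))

⊗-zeroˡ : ∀ f → 𝟘 ⊗ f ≈ 𝟘
⊗-zeroˡ f zero = refl
⊗-zeroˡ f (suc n) = ⊗-zeroˡ f n

⊗-identityˡ : ∀ f → 𝟙 ⊗ f ≈ f
⊗-identityˡ f zero = refl
⊗-identityˡ f (suc n) = trans (cong (f (suc n) xor_) (⊗-zeroˡ f n)) (xor-identityʳ _)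

⊗-distribʳ : ∀ h f g → (f ⊕ g) ⊗ h ≈ f ⊗ h ⊕ g ⊗ h
⊗-distribʳ h f g zero = ∧-distribʳ-xor (h 0) (f 0) (g 0)
⊗-distribʳ h f g (suc n) =
  trans (cong₂ _xor_ (∧-distribʳ-xor (h (suc n)) (f 0) (g 0)) (⊗-distribʳ h (tl f) (tl g) n))
    (xor-interchange (f 0 ∧ h (suc n)) _ _ _)

•-⊗ : ∀ b f g → (b • f) ⊗ g ≈ b • (f ⊗ g)
•-⊗ b f g zero = ∧-assoc b (f 0) (g 0)
•-⊗ b f g (suc n) =
  trans (cong₂ _xor_ (∧-assoc b (f 0) (g (suc n))) (•-⊗ b (tl f) g n))
    (sym (∧-distribˡ-xor b (f 0 ∧ g (suc n)) _))

-- The product is defined by peeling its first factor. This peels the second, and the two recursions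
-- together give commutativity.
⊗-suc : ∀ f g n → (f ⊗ g) (suc n) ≡ (f (suc n) ∧ g 0) xor (f ⊗ tl g) n
⊗-suc f g zero = xor-comm (f 0 ∧ g 1) (f 1 ∧ g 0)
⊗-suc f g (suc n) =
  trans (cong ((f 0 ∧ g (suc (suc n))) xor_) (⊗-suc (tl f) g n))
    (xor-swap (f 0 ∧ g (suc (suc n))) (f (suc (suc n)) ∧ g 0) ((tl f ⊗ tl g) n))

⊗-comm : ∀ f g → f ⊗ g ≈ g ⊗ f
⊗-comm f g zero = ∧-comm (f 0) (g 0)
⊗-comm f g (suc n) =
  trans (cong₂ _xor_ (∧-comm (f 0) (g (suc n))) (⊗-comm (tl f) g n)) (sym (⊗-suc g f n))

⊗-assoc : ∀ f g h → (f ⊗ g) ⊗ h ≈ f ⊗ (g ⊗ h)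
⊗-assoc f g h zero = ∧-assoc (f 0) (g 0) (h 0)
⊗-assoc f g h (suc n) = begin
  ((f 0 ∧ g 0) ∧ h (suc n)) xor ((f 0 • tl g ⊕ tl f ⊗ g) ⊗ h) n
    ≡⟨ cong₂ _xor_ (∧-assoc (f 0) (g 0) (h (suc n)))
         (trans (⊗-distribʳ h (f 0 • tl g) (tl f ⊗ g) n)
           (cong₂ _xor_ (•-⊗ (f 0) (tl g) h n) (⊗-assoc (tl f) g h n))) ⟩
  (f 0 ∧ (g 0 ∧ h (suc n))) xor ((f 0 ∧ (tl g ⊗ h) n) xor (tl f ⊗ (g ⊗ h)) n)
    ≡⟨ xor-assoc (f 0 ∧ (g 0 ∧ h (suc n))) _ _ ⟨
  ((f 0 ∧ (g 0 ∧ h (suc n))) xor (f 0 ∧ (tl g ⊗ h) n)) xor (tl f ⊗ (g ⊗ h)) n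
    ≡⟨ cong (_xor (tl f ⊗ (g ⊗ h)) n) (∧-distribˡ-xor (f 0) (g 0 ∧ h (suc n)) ((tl g ⊗ h) n)) ⟨
  (f 0 ∧ (g ⊗ h) (suc n)) xor (tl f ⊗ (g ⊗ h)) n ∎
  where open ≡-Reasoning

⊗-identityʳ : ∀ f → f ⊗ 𝟙 ≈ f
⊗-identityʳ f = ≈-trans (⊗-comm f 𝟙) (⊗-identityˡ f)

⊗-zeroʳ : ∀ f → f ⊗ 𝟘 ≈ 𝟘
⊗-zeroʳ f = ≈-trans (⊗-comm f 𝟘) (⊗-zeroˡ f)

⊗-distribˡ : ∀ h f g → h ⊗ (f ⊕ g) ≈ h ⊗ f ⊕ h ⊗ g
⊗-distribˡ h f g =
  ≈-trans (⊗-comm h (f ⊕ g)) (≈-trans (⊗-distribʳ h f g) (⊕-cong (⊗-comm f h) (⊗-comm g h)))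

⊗-interchange : ∀ a b c d → (a ⊗ b) ⊗ (c ⊗ d) ≈ (a ⊗ c) ⊗ (b ⊗ d)
⊗-interchange a b c d =
  ≈-trans (⊗-assoc a b (c ⊗ d))
    (≈-trans (⊗-congˡ (≈-trans (≈-sym (⊗-assoc b c d))
                        (≈-trans (⊗-congʳ (⊗-comm b c)) (⊗-assoc c b d))))
      (≈-sym (⊗-assoc a c (b ⊗ d))))

pow-+ : ∀ f m n → pow f (m + n) ≈ pow f m ⊗ pow f n
pow-+ f zero n = ≈-sym (⊗-identityˡ _)
pow-+ f (suc m) n = ≈-trans (⊗-congˡ (pow-+ f m n)) (≈-sym (⊗-assoc f (pow f m) (pow f n)))

pow-* : ∀ f m n → pow f (m * n) ≈ pow (pow f n) m
pow-* f zero n = ≈-refl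
pow-* f (suc m) n = ≈-trans (pow-+ f n (m * n)) (⊗-congˡ (pow-* f m n))

-- Normal forms of polynomials over 𝔽₂: strictly decreasing lists of exponent vectors

data Expr (n : ℕ) : Set where
  var : Fin n → Expr n
  `0 `1 : Expr n
  _:+_ _:*_ : Expr n → Expr n → Expr n
  _:^_ : Expr n → ℕ → Expr n

infixl 6 _:+_
infixl 7 _:*_
infixr 8 _:^_

⟦_⟧ : ∀ {n} → Expr n → Vec Series n → Series
⟦ var i ⟧ ρ = lookup ρ i
⟦ `0 ⟧ ρ = 𝟘
⟦ `1 ⟧ ρ = 𝟙
⟦ a :+ b ⟧ ρ = ⟦ a ⟧ ρ ⊕ ⟦ b ⟧ ρ
⟦ a :* b ⟧ ρ = ⟦ a ⟧ ρ ⊗ ⟦ b ⟧ ρ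
⟦ a :^ k ⟧ ρ = pow (⟦ a ⟧ ρ) k

Mono : ℕ → Set
Mono = Vec ℕ

Poly : ℕ → Set
Poly n = List (Mono n)

data Cmp : Set where
  LT EQ GT : Cmp

cmpℕ : ℕ → ℕ → Cmp
cmpℕ a b = if a ≡ᵇ b then EQ else (if a <ᵇ b then LT else GT)

_then_ : Cmp → Cmp → Cmp
LT then _ = LT
GT then _ = GT
EQ then c = c

cmp : ∀ {n} → Mono n → Mono n → Cmp
cmp [] [] = EQ
cmp (a ∷ as) (b ∷ bs) = cmpℕ a b then cmp as bs

cmpℕ-EQ : ∀ a b → cmpℕ a b ≡ EQ → a ≡ b
cmpℕ-EQ a b p with a ≡ᵇ b in e
... | true = ≡ᵇ⇒≡ a b (subst IsTrue (sym e) tt)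
... | false with a <ᵇ b
cmpℕ-EQ a b () | false | true
cmpℕ-EQ a b () | false | false

cmp-EQ : ∀ {n} (x y : Mono n) → cmp x y ≡ EQ → x ≡ y
cmp-EQ [] [] _ = refl
cmp-EQ (a ∷ as) (b ∷ bs) p with cmpℕ a b in e
... | EQ = cong₂ _∷_ (cmpℕ-EQ a b e) (cmp-EQ as bs p)

-- All three recursive results are arguments, so termination of `addP` does not depend on the
-- comparison, and lazy evaluation computes only the chosen branch. Equal monomials cancel because 1
-- + 1 = 0.
pick : ∀ {n} → Cmp → Mono n → Mono n → Poly n → Poly n → Poly n → Poly n
pick LT x y _ r _ = y ∷ r
pick EQ x y _ _ b = b
pick GT x y l _ _ = x ∷ l

addP : ∀ {n} → Poly n → Poly n → Poly n
addP [] ys = ys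
addP (x ∷ xs) [] = x ∷ xs
addP (x ∷ xs) (y ∷ ys) = pick (cmp x y) x y (addP xs (y ∷ ys)) (addP (x ∷ xs) ys) (addP xs ys)

mulM : ∀ {n} → Mono n → Mono n → Mono n
mulM [] [] = []
mulM (a ∷ as) (b ∷ bs) = (a + b) ∷ mulM as bs

shiftP : ∀ {n} → Mono n → Poly n → Poly n
shiftP m [] = []
shiftP m (x ∷ xs) = mulM m x ∷ shiftP m xs

mulP : ∀ {n} → Poly n → Poly n → Poly n
mulP [] ys = []
mulP (x ∷ xs) ys = addP (shiftP x ys) (mulP xs ys)

oneM : ∀ {n} → Mono n
oneM {zero} = []
oneM {suc n} = 0 ∷ oneM

varM : ∀ {n} → Fin n → Mono n
varM zero = 1 ∷ oneM
varM (suc i) = 0 ∷ varM i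

powP : ∀ {n} → Poly n → ℕ → Poly n
powP p zero = oneM ∷ []
powP p (suc k) = mulP p (powP p k)

scaleM : ∀ {n} → ℕ → Mono n → Mono n
scaleM k [] = []
scaleM k (a ∷ as) = (k * a) ∷ scaleM k as

squareP : ∀ {n} → Poly n → Poly n
squareP [] = []
squareP (x ∷ xs) = scaleM 2 x ∷ squareP xs

-- Two shortcuts keep the large checks feasible: a monomial is scaled directly, and a fourth power
-- is two Frobenius squarings without cross terms.
powP′ : ∀ {n} → Poly n → ℕ → Poly n
powP′ (x ∷ []) k = scaleM k x ∷ []
powP′ p k = if k ≡ᵇ 4 then squareP (squareP p) else powP p k

norm : ∀ {n} → Expr n → Poly n
norm (var i) = varM i ∷ []
norm `0 = []
norm `1 = oneM ∷ []
norm (a :+ b) = addP (norm a) (norm b)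
norm (a :* b) = mulP (norm a) (norm b)
norm (a :^ k) = powP′ (norm a) k

⟦_⟧M : ∀ {n} → Mono n → Vec Series n → Series
⟦ [] ⟧M [] = 𝟙
⟦ a ∷ as ⟧M (f ∷ ρ) = pow f a ⊗ ⟦ as ⟧M ρ

⟦_⟧P : ∀ {n} → Poly n → Vec Series n → Series
⟦ [] ⟧P ρ = 𝟘
⟦ x ∷ xs ⟧P ρ = ⟦ x ⟧M ρ ⊕ ⟦ xs ⟧P ρ

mulM-sound : ∀ {n} (x y : Mono n) ρ → ⟦ mulM x y ⟧M ρ ≈ ⟦ x ⟧M ρ ⊗ ⟦ y ⟧M ρ
mulM-sound [] [] [] = ≈-sym (⊗-identityˡ 𝟙)
mulM-sound (a ∷ as) (b ∷ bs) (f ∷ ρ) =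
  ≈-trans (⊗-cong (pow-+ f a b) (mulM-sound as bs ρ)) (⊗-interchange (pow f a) (pow f b) _ _)

oneM-sound : ∀ {n} (ρ : Vec Series n) → ⟦ oneM ⟧M ρ ≈ 𝟙
oneM-sound [] = ≈-refl
oneM-sound (f ∷ ρ) = ≈-trans (⊗-identityˡ _) (oneM-sound ρ)

varM-sound : ∀ {n} (i : Fin n) ρ → ⟦ varM i ⟧M ρ ≈ lookup ρ i
varM-sound zero (f ∷ ρ) = ≈-trans (⊗-cong (⊗-identityʳ f) (oneM-sound ρ)) (⊗-identityʳ f)
varM-sound (suc i) (f ∷ ρ) = ≈-trans (⊗-identityˡ _) (varM-sound i ρ)

pow-𝟙 : ∀ k → pow 𝟙 k ≈ 𝟙
pow-𝟙 zero = ≈-refl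
pow-𝟙 (suc k) = ≈-trans (⊗-identityˡ _) (pow-𝟙 k)

pow-⊗ : ∀ f g k → pow (f ⊗ g) k ≈ pow f k ⊗ pow g k
pow-⊗ f g zero = ≈-sym (⊗-identityˡ 𝟙)
pow-⊗ f g (suc k) = ≈-trans (⊗-congˡ (pow-⊗ f g k)) (⊗-interchange f g _ _)

scaleM-sound : ∀ {n} k (x : Mono n) ρ → ⟦ scaleM k x ⟧M ρ ≈ pow (⟦ x ⟧M ρ) k
scaleM-sound k [] [] = ≈-sym (pow-𝟙 k)
scaleM-sound k (a ∷ as) (f ∷ ρ) =
  ≈-trans (⊗-cong (pow-* f k a) (scaleM-sound k as ρ)) (≈-sym (pow-⊗ (pow f a) _ k))

addP-sound : ∀ {n} (xs ys : Poly n) ρ → ⟦ addP xs ys ⟧P ρ ≈ ⟦ xs ⟧P ρ ⊕ ⟦ ys ⟧P ρ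
addP-sound [] ys ρ = ≈-refl
addP-sound (x ∷ xs) [] ρ n = sym (xor-identityʳ _)
addP-sound (x ∷ xs) (y ∷ ys) ρ =
  pick-sound (cmp x y) (cmp-EQ x y)
    (addP-sound xs (y ∷ ys) ρ) (addP-sound (x ∷ xs) ys ρ) (addP-sound xs ys ρ)
  where
  m = ⟦ x ⟧M ρ
  m′ = ⟦ y ⟧M ρ
  s = ⟦ xs ⟧P ρ
  t = ⟦ ys ⟧P ρ
  pick-sound : ∀ c {l r b} → (c ≡ EQ → x ≡ y) →
    ⟦ l ⟧P ρ ≈ s ⊕ (m′ ⊕ t) → ⟦ r ⟧P ρ ≈ (m ⊕ s) ⊕ t → ⟦ b ⟧P ρ ≈ s ⊕ t →
    ⟦ pick c x y l r b ⟧P ρ ≈ (m ⊕ s) ⊕ (m′ ⊕ t)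
  pick-sound LT _ _ pr _ n = trans (cong (m′ n xor_) (pr n)) (xor-swap (m′ n) ((m ⊕ s) n) (t n))
  pick-sound GT _ pl _ _ n = trans (cong (m n xor_) (pl n)) (sym (xor-assoc (m n) (s n) ((m′ ⊕ t) n)))
  pick-sound EQ e _ _ pb n with e refl
  ... | refl = trans (pb n)
        (trans (cong (_xor (s n xor t n)) (sym (xor-same (m n)))) (xor-interchange (m n) (m n) (s n) (t n)))

shiftP-sound : ∀ {n} m (xs : Poly n) ρ → ⟦ shiftP m xs ⟧P ρ ≈ ⟦ m ⟧M ρ ⊗ ⟦ xs ⟧P ρ
shiftP-sound m [] ρ = ≈-sym (⊗-zeroʳ _)
shiftP-sound m (x ∷ xs) ρ =
  ≈-trans (⊕-cong (mulM-sound m x ρ) (shiftP-sound m xs ρ)) (≈-sym (⊗-distribˡ _ _ _))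

mulP-sound : ∀ {n} (xs ys : Poly n) ρ → ⟦ mulP xs ys ⟧P ρ ≈ ⟦ xs ⟧P ρ ⊗ ⟦ ys ⟧P ρ
mulP-sound [] ys ρ = ≈-sym (⊗-zeroˡ _)
mulP-sound (x ∷ xs) ys ρ =
  ≈-trans (addP-sound (shiftP x ys) (mulP xs ys) ρ)
    (≈-trans (⊕-cong (shiftP-sound x ys ρ) (mulP-sound xs ys ρ)) (≈-sym (⊗-distribʳ _ _ _)))

⊕-identityʳ : ∀ f → f ⊕ 𝟘 ≈ f
⊕-identityʳ f n = xor-identityʳ (f n)

powP-sound : ∀ {n} (p : Poly n) k ρ → ⟦ powP p k ⟧P ρ ≈ pow (⟦ p ⟧P ρ) k
powP-sound p zero ρ = ≈-trans (⊕-identityʳ _) (oneM-sound ρ)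
powP-sound p (suc k) ρ = ≈-trans (mulP-sound p (powP p k) ρ) (⊗-congˡ (powP-sound p k ρ))

pow-⊕-2 : ∀ f g → pow (f ⊕ g) 2 ≈ pow f 2 ⊕ pow g 2
pow-⊕-2 f g =
  ≈-trans (sq (f ⊕ g))
    (≈-trans (⊗-distribʳ (f ⊕ g) f g)
      (≈-trans (⊕-cong (⊗-distribˡ f f g) (≈-trans (⊗-distribˡ g f g) (⊕-cong (⊗-comm g f) (≈-refl {g ⊗ g}))))
        (≈-trans cancel (⊕-cong (≈-sym (sq f)) (≈-sym (sq g))))))
  where
  sq : ∀ x → pow x 2 ≈ x ⊗ x
  sq x = ⊗-congˡ (⊗-identityʳ x)
  cancel : f ⊗ f ⊕ f ⊗ g ⊕ (f ⊗ g ⊕ g ⊗ g) ≈ f ⊗ f ⊕ g ⊗ g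
  cancel n = trans (xor-assoc x z (z xor y))
    (cong (x xor_) (trans (sym (xor-assoc z z y)) (cong (_xor y) (xor-same z))))
    where
    x = (f ⊗ f) n
    y = (g ⊗ g) n
    z = (f ⊗ g) n

squareP-sound : ∀ {n} (p : Poly n) ρ → ⟦ squareP p ⟧P ρ ≈ pow (⟦ p ⟧P ρ) 2
squareP-sound [] ρ = ≈-sym (⊗-zeroˡ _)
squareP-sound (x ∷ xs) ρ =
  ≈-trans (⊕-cong (scaleM-sound 2 x ρ) (squareP-sound xs ρ)) (≈-sym (pow-⊕-2 (⟦ x ⟧M ρ) (⟦ xs ⟧P ρ)))

fourth-sound : ∀ {n} (p : Poly n) k ρ →
  ⟦ if k ≡ᵇ 4 then squareP (squareP p) else powP p k ⟧P ρ ≈ pow (⟦ p ⟧P ρ) k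
fourth-sound p k ρ with k ≡ᵇ 4 in e
... | false = powP-sound p k ρ
... | true with ≡ᵇ⇒≡ k 4 (subst IsTrue (sym e) tt)
...   | refl =
  ≈-trans (squareP-sound (squareP p) ρ)
    (≈-trans (pow-cong (squareP-sound p ρ) 2) (≈-sym (pow-* (⟦ p ⟧P ρ) 2 2)))

powP′-sound : ∀ {n} (p : Poly n) k ρ → ⟦ powP′ p k ⟧P ρ ≈ pow (⟦ p ⟧P ρ) k
powP′-sound (x ∷ []) k ρ =
  ≈-trans (⊕-identityʳ _) (≈-trans (scaleM-sound k x ρ) (pow-cong (≈-sym (⊕-identityʳ _)) k))
powP′-sound [] k ρ = fourth-sound [] k ρ
powP′-sound p@(_ ∷ _ ∷ _) k ρ = fourth-sound p k ρ

norm-sound : ∀ {n} (a : Expr n) ρ → ⟦ norm a ⟧P ρ ≈ ⟦ a ⟧ ρ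
norm-sound (var i) ρ = ≈-trans (⊕-identityʳ _) (varM-sound i ρ)
norm-sound `0 ρ = ≈-refl
norm-sound `1 ρ = ≈-trans (⊕-identityʳ _) (oneM-sound ρ)
norm-sound (a :+ b) ρ =
  ≈-trans (addP-sound (norm a) (norm b) ρ) (⊕-cong (norm-sound a ρ) (norm-sound b ρ))
norm-sound (a :* b) ρ =
  ≈-trans (mulP-sound (norm a) (norm b) ρ) (⊗-cong (norm-sound a ρ) (norm-sound b ρ))
norm-sound (a :^ k) ρ = ≈-trans (powP′-sound (norm a) k ρ) (pow-cong (norm-sound a ρ) k)

solve : ∀ {n} (l r : Expr n) ρ → norm (l :+ r) ≡ [] → ⟦ l ⟧ ρ ≈ ⟦ r ⟧ ρ
solve l r ρ p = ⊕≈𝟘⇒≈ (≈-trans (≈-sym (norm-sound (l :+ r) ρ)) (λ n → cong (λ x → ⟦ x ⟧P ρ n) p))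

-- An equation c·(l + r) = 0, used as a hypothesis with multiplier c.
record Hyp {n} (ρ : Vec Series n) : Set where
  constructor [_]*_≋_by_
  field
    cof lhs rhs : Expr n
    holds : ⟦ lhs ⟧ ρ ≈ ⟦ rhs ⟧ ρ

infix 3 [_]*_≋_by_

total : ∀ {n} {ρ : Vec Series n} → List (Hyp ρ) → Expr n
total [] = `0
total (([ c ]* l ≋ r by _) ∷ hs) = c :* (l :+ r) :+ total hs

total≈𝟘 : ∀ {n} {ρ : Vec Series n} (hs : List (Hyp ρ)) → ⟦ total hs ⟧ ρ ≈ 𝟘
total≈𝟘 [] = ≈-refl
total≈𝟘 {ρ = ρ} (([ c ]* l ≋ r by p) ∷ hs) =
  ⊕-cong {⟦ c ⟧ ρ ⊗ (⟦ l ⟧ ρ ⊕ ⟦ r ⟧ ρ)} {𝟘} (≈-trans (⊗-congˡ (≈⇒⊕≈𝟘 p)) (⊗-zeroʳ _)) (total≈𝟘 hs)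

-- A certificate of ideal membership: with the cofactors supplied in `hs`, one identity of
-- polynomials over 𝔽₂ remains, decided by normalisation.
solveBy : ∀ {n} (l r : Expr n) ρ (hs : List (Hyp ρ)) →
  norm (l :+ r :+ total hs) ≡ [] → ⟦ l ⟧ ρ ≈ ⟦ r ⟧ ρ
solveBy l r ρ hs p =
  ⊕≈𝟘⇒≈ (≈-trans (≈-sym (≈-trans (⊕-cong (≈-refl {⟦ l ⟧ ρ ⊕ ⟦ r ⟧ ρ}) (total≈𝟘 hs)) (⊕-identityʳ _)))
          (≈-trans (≈-sym (norm-sound (l :+ r :+ total hs) ρ)) (λ n → cong (λ x → ⟦ x ⟧P ρ n) p)))

⟦⟧-cong[] : ∀ {n m} (a : Expr n) {ρ σ : Vec Series n} →
  (∀ i → lookup ρ i ≡[ m ] lookup σ i) → ⟦ a ⟧ ρ ≡[ m ] ⟦ a ⟧ σ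
⟦⟧-cong[] (var i) p = p i
⟦⟧-cong[] `0 p i l = refl
⟦⟧-cong[] `1 p i l = refl
⟦⟧-cong[] (a :+ b) p = ⊕-cong[] (⟦⟧-cong[] a p) (⟦⟧-cong[] b p)
⟦⟧-cong[] (a :* b) p = ⊗-cong[] (⟦⟧-cong[] a p) (⟦⟧-cong[] b p)
⟦⟧-cong[] (a :^ k) p = pow-cong[] (⟦⟧-cong[] a p) k

v0 : ∀ {n} → Expr (1 + n)
v0 = var zero
v1 : ∀ {n} → Expr (2 + n)
v1 = var (suc zero)
v2 : ∀ {n} → Expr (3 + n)
v2 = var (suc (suc zero))
v3 : ∀ {n} → Expr (4 + n)
v3 = var (suc (suc (suc zero)))
v4 : ∀ {n} → Expr (5 + n)
v4 = var (suc (suc (suc (suc zero))))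
v5 : ∀ {n} → Expr (6 + n)
v5 = var (suc (suc (suc (suc (suc zero)))))
v6 : ∀ {n} → Expr (7 + n)
v6 = var (suc (suc (suc (suc (suc (suc zero))))))
v7 : ∀ {n} → Expr (8 + n)
v7 = var (suc (suc (suc (suc (suc (suc (suc zero)))))))
v8 : ∀ {n} → Expr (9 + n)
v8 = var (suc (suc (suc (suc (suc (suc (suc (suc zero))))))))
v9 : ∀ {n} → Expr (10 + n)
v9 = var (suc (suc (suc (suc (suc (suc (suc (suc (suc zero)))))))))
v10 : ∀ {n} → Expr (11 + n)
v10 = var (suc (suc (suc (suc (suc (suc (suc (suc (suc (suc zero))))))))))
v11 : ∀ {n} → Expr (12 + n)
v11 = var (suc (suc (suc (suc (suc (suc (suc (suc (suc (suc (suc zero)))))))))))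

divM : ∀ {n} → Mono n → Mono n → Maybe (Mono n)
divM [] [] = just []
divM (a ∷ as) (b ∷ bs) = if b ≤ᵇ a then (cons (a ∸ b) (divM as bs)) else nothing
  where
  cons : ∀ {n} → ℕ → Maybe (Mono n) → Maybe (Mono (suc n))
  cons c (just m) = just (c ∷ m)
  cons c nothing = nothing

-- Division with fuel `k`. Polynomials are sorted with the largest monomial first, so a suitable
-- multiple of `rel` cancels the head. An element of the ideal of `rel` shrinks to `[]`, and the
-- cofactor, too long to write down, is found during the check.
reduce : ∀ {n} → ℕ → Mono n → Poly n → Poly n → Poly n
reduceStep : ∀ {n} → ℕ → Mono n → Poly n → Poly n → Maybe (Mono n) → Poly n
reduce zero lead rel p = p
reduce (suc k) lead rel [] = []
reduce (suc k) lead rel (x ∷ xs) = reduceStep k lead rel (x ∷ xs) (divM x lead)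
reduceStep k lead rel p nothing = p
reduceStep k lead rel p (just m) = reduce k lead rel (addP p (shiftP m rel))

reduce-sound : ∀ {n} k lead (rel p : Poly n) ρ → ⟦ rel ⟧P ρ ≈ 𝟘 → ⟦ reduce k lead rel p ⟧P ρ ≈ ⟦ p ⟧P ρ
reduceStep-sound : ∀ {n} k lead (rel p : Poly n) m ρ → ⟦ rel ⟧P ρ ≈ 𝟘 →
  ⟦ reduceStep k lead rel p m ⟧P ρ ≈ ⟦ p ⟧P ρ
reduce-sound zero lead rel p ρ z = ≈-refl
reduce-sound (suc k) lead rel [] ρ z = ≈-refl
reduce-sound (suc k) lead rel (x ∷ xs) ρ z = reduceStep-sound k lead rel (x ∷ xs) (divM x lead) ρ z
reduceStep-sound k lead rel p nothing ρ z = ≈-refl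
reduceStep-sound k lead rel p (just m) ρ z =
  ≈-trans (reduce-sound k lead rel (addP p (shiftP m rel)) ρ z)
    (≈-trans (addP-sound p (shiftP m rel) ρ)
      (≈-trans (⊕-cong (≈-refl {⟦ p ⟧P ρ})
                 (≈-trans (shiftP-sound m rel ρ) (≈-trans (⊗-congˡ z) (⊗-zeroʳ _))))
        (⊕-identityʳ _)))

solveMod : ∀ {n} k lead (a b l r : Expr n) ρ → ⟦ a ⟧ ρ ≈ ⟦ b ⟧ ρ →
  reduce k lead (norm (a :+ b)) (norm (l :+ r)) ≡ [] → ⟦ l ⟧ ρ ≈ ⟦ r ⟧ ρ
solveMod k lead a b l r ρ h p =
  ⊕≈𝟘⇒≈ (≈-trans (≈-sym (≈-trans (reduce-sound k lead (norm (a :+ b)) (norm (l :+ r)) ρ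
                                   (≈-trans (norm-sound (a :+ b) ρ) (≈⇒⊕≈𝟘 h)))
                                 (norm-sound (l :+ r) ρ)))
          (λ n → cong (λ x → ⟦ x ⟧P ρ n) p))

-- Powers of q, units and cancellation

𝕢⊗-suc : ∀ f n → (𝕢 ⊗ f) (suc n) ≡ f n
𝕢⊗-suc f = ⊗-identityˡ f

𝕢-cancel : ∀ {f g} → 𝕢 ⊗ f ≈ 𝕢 ⊗ g → f ≈ g
𝕢-cancel {f} {g} p n = trans (sym (𝕢⊗-suc f n)) (trans (p (suc n)) (𝕢⊗-suc g n))

𝕢^-cancel : ∀ k {f g} → pow 𝕢 k ⊗ f ≈ pow 𝕢 k ⊗ g → f ≈ g
𝕢^-cancel zero p = ≈-trans (≈-sym (⊗-identityˡ _)) (≈-trans p (⊗-identityˡ _))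
𝕢^-cancel (suc k) p =
  𝕢^-cancel k (𝕢-cancel (≈-trans (≈-sym (⊗-assoc 𝕢 _ _)) (≈-trans p (⊗-assoc 𝕢 _ _))))

pow𝕢-shift : ∀ k f n → (pow 𝕢 k ⊗ f) (k + n) ≡ f n
pow𝕢-shift zero f n = ⊗-identityˡ f n
pow𝕢-shift (suc k) f n =
  trans (⊗-assoc 𝕢 (pow 𝕢 k) f (suc (k + n))) (trans (𝕢⊗-suc _ (k + n)) (pow𝕢-shift k f n))

pow𝕢-low : ∀ k f n → n < k → (pow 𝕢 k ⊗ f) n ≡ false
pow𝕢-low (suc k) f zero _ = refl
pow𝕢-low (suc k) f (suc n) (s≤s l) =
  trans (⊗-assoc 𝕢 (pow 𝕢 k) f (suc n)) (trans (𝕢⊗-suc _ n) (pow𝕢-low k f n l))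

𝕢⊗-cong[] : ∀ {n f g} → f ≡[ n ] g → 𝕢 ⊗ f ≡[ suc n ] 𝕢 ⊗ g
𝕢⊗-cong[] p zero _ = refl
𝕢⊗-cong[] {f = f} {g} p (suc i) (s≤s l) = trans (𝕢⊗-suc f i) (trans (p i l) (sym (𝕢⊗-suc g i)))

pow𝕢⊗-cong[] : ∀ k {n f g} → f ≡[ n ] g → pow 𝕢 k ⊗ f ≡[ k + n ] pow 𝕢 k ⊗ g
pow𝕢⊗-cong[] zero p = ⊗-cong[] (λ _ _ → refl) p
pow𝕢⊗-cong[] (suc k) {f = f} {g} p i l =
  trans (⊗-assoc 𝕢 (pow 𝕢 k) f i)
    (trans (𝕢⊗-cong[] (pow𝕢⊗-cong[] k p) i l) (sym (⊗-assoc 𝕢 (pow 𝕢 k) g i)))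

const : Bool → Series
const b = b • 𝟙

decompose : ∀ f → f ≈ const (hd f) ⊕ 𝕢 ⊗ tl f
decompose f zero = sym (trans (xor-identityʳ _) (∧-identityʳ _))
decompose f (suc n) = sym (trans (cong₂ _xor_ (∧-zeroʳ (f 0)) (𝕢⊗-suc (tl f) n)) refl)

unit-decompose : ∀ {f} → f 0 ≡ true → f ≈ 𝟙 ⊕ 𝕢 ⊗ tl f
unit-decompose {f} p zero = p
unit-decompose {f} p (suc n) = sym (𝕢⊗-suc (tl f) n)

-- Because u starts with 1, the lowest coefficient of f is that of the product; once it is known to
-- vanish, the same argument applies to the tail.
unit-regular : ∀ n f u → u 0 ≡ true → f ⊗ u ≈ 𝟘 → f n ≡ false
unit-regular zero f u pu p = trans (sym (∧-identityʳ _)) (trans (cong (f 0 ∧_) (sym pu)) (p 0))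
unit-regular (suc n) f u pu p =
  unit-regular n (tl f) u pu
    (λ m → trans (sym (cong (λ b → (b ∧ u (suc m)) xor (tl f ⊗ u) m) (unit-regular zero f u pu p)))
             (p (suc m)))

unit-cancel : ∀ {f u} → u 0 ≡ true → f ⊗ u ≈ 𝟘 → f ≈ 𝟘
unit-cancel {f} {u} pu p n = unit-regular n f u pu p

pow-unit : ∀ {f} → f 0 ≡ true → ∀ k → pow f k 0 ≡ true
pow-unit p zero = refl
pow-unit p (suc k) rewrite p = pow-unit p k

-- Contractive equations

iter : (Series → Series) → ℕ → Series
iter G zero = 𝟙
iter G (suc n) = 𝟙 ⊕ 𝕢 ⊗ G (iter G n)

-- Multiplication by q gains one coefficient, so f ↦ 1 + q G(f) is a q-adic contraction whenever G
-- loses none.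
Nonexpansive : (Series → Series) → Set
Nonexpansive G = ∀ n {f g} → f ≡[ n ] g → G f ≡[ n ] G g

𝟙⊕𝕢-cong[] : ∀ {n f g} → f ≡[ n ] g → 𝟙 ⊕ 𝕢 ⊗ f ≡[ suc n ] 𝟙 ⊕ 𝕢 ⊗ g
𝟙⊕𝕢-cong[] p = ⊕-congʳ[] 𝟙 (𝕢⊗-cong[] p)

module _ (G : Series → Series) (ne : Nonexpansive G) where

  iter-step : ∀ n → iter G n ≡[ n ] iter G (suc n)
  iter-step zero i ()
  iter-step (suc n) = 𝟙⊕𝕢-cong[] (ne n (iter-step n))

  iter-≤ : ∀ m n → iter G n ≡[ n ] iter G (m + n)
  iter-≤ zero n i l = refl
  iter-≤ (suc m) n =
    ≡[]-trans (iter-≤ m n) (≡[]-weaken (m≤n+m n m) (iter-step (m + n)))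

  fix : Series
  fix n = iter G (suc n) n

  fix≡iter : ∀ n → fix ≡[ n ] iter G n
  fix≡iter n i l =
    subst (λ k → iter G (suc i) i ≡ iter G k i) (m∸n+n≡m l) (iter-≤ (n ∸ suc i) (suc i) i ≤-refl)

  fix-eq : fix ≈ 𝟙 ⊕ 𝕢 ⊗ G fix
  fix-eq = ≡[]⇒≈ λ where
    zero i ()
    (suc n) → ≡[]-trans (fix≡iter (suc n)) (𝟙⊕𝕢-cong[] (ne n (≡[]-sym (fix≡iter n))))

  fix-unique : ∀ {f g} → f ≈ 𝟙 ⊕ 𝕢 ⊗ G f → g ≈ 𝟙 ⊕ 𝕢 ⊗ G g → f ≈ g
  fix-unique {f} {g} p r = ≡[]⇒≈ agree
    where
    agree : ∀ n → f ≡[ n ] g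
    agree zero i ()
    agree (suc n) =
      ≡[]-trans (≈⇒≡[] _ p) (≡[]-trans (𝟙⊕𝕢-cong[] (ne n (agree n))) (≡[]-sym (≈⇒≡[] _ r)))

invert : ∀ u → u 0 ≡ true → ∃ λ j → u ⊗ j ≈ 𝟙
invert u pu = j , ≈-trans (⊗-congʳ (unit-decompose pu)) eq
  where
  G : Series → Series
  G j = tl u ⊗ j
  ne : Nonexpansive G
  ne n = ⊗-cong[] (λ _ _ → refl)
  j = fix G ne
  eq : (𝟙 ⊕ 𝕢 ⊗ tl u) ⊗ j ≈ 𝟙
  eq = solveBy ((`1 :+ v1 :* v2) :* v0) `1 (j ∷ 𝕢 ∷ tl u ∷ [])
         (([ `1 ]* v0 ≋ `1 :+ v1 :* (v2 :* v0) by fix-eq G ne) ∷ []) refl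

-- The substitution of a power of q, and Frobenius

-- stretch k c f = q^c f(q^(k+1)).  All indices of stretch, 𝕍 and 𝕌 are one less than
-- the factor by which exponents are scaled.
stretch : ℕ → ℕ → Series → Series
stretch k zero f zero = f 0
stretch k zero f (suc n) = stretch k k (tl f) n
stretch k (suc c) f zero = false
stretch k (suc c) f (suc n) = stretch k c f n

𝕍 : ℕ → Series → Series
𝕍 k = stretch k zero

stretch≈ : ∀ k c f → stretch k c f ≈ pow 𝕢 c ⊗ 𝕍 k f
stretch≈ k zero f = ≈-sym (⊗-identityˡ _)
stretch≈ k (suc c) f zero = refl
stretch≈ k (suc c) f (suc n) =
  trans (stretch≈ k c f n) (sym (trans (⊗-assoc 𝕢 (pow 𝕢 c) _ (suc n)) (𝕢⊗-suc _ n)))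

𝕍-eq : ∀ k f → 𝕍 k f ≈ const (hd f) ⊕ pow 𝕢 (suc k) ⊗ 𝕍 k (tl f)
𝕍-eq k f = ≈-trans (decompose (𝕍 k f))
  (⊕-cong (≈-refl {const (hd f)})
    (≈-trans (⊗-congˡ (stretch≈ k k (tl f))) (≈-sym (⊗-assoc 𝕢 (pow 𝕢 k) _))))

stretch-cong : ∀ k c {f g} → f ≈ g → stretch k c f ≈ stretch k c g
stretch-cong k zero p zero = p 0
stretch-cong k zero p (suc n) = stretch-cong k k (p ∘ suc) n
stretch-cong k (suc c) p zero = refl
stretch-cong k (suc c) p (suc n) = stretch-cong k c p n

𝕍-cong : ∀ k {f g} → f ≈ g → 𝕍 k f ≈ 𝕍 k g
𝕍-cong k = stretch-cong k zero

stretch-⊕ : ∀ k c f g → stretch k c (f ⊕ g) ≈ stretch k c f ⊕ stretch k c g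
stretch-⊕ k zero f g zero = refl
stretch-⊕ k zero f g (suc n) = stretch-⊕ k k (tl f) (tl g) n
stretch-⊕ k (suc c) f g zero = refl
stretch-⊕ k (suc c) f g (suc n) = stretch-⊕ k c f g n

𝕍-⊕ : ∀ k f g → 𝕍 k (f ⊕ g) ≈ 𝕍 k f ⊕ 𝕍 k g
𝕍-⊕ k = stretch-⊕ k zero

stretch-• : ∀ k c b f → stretch k c (b • f) ≈ b • stretch k c f
stretch-• k zero b f zero = refl
stretch-• k zero b f (suc n) = stretch-• k k b (tl f) n
stretch-• k (suc c) b f zero = sym (∧-zeroʳ b)
stretch-• k (suc c) b f (suc n) = stretch-• k c b f n

stretch-𝟘 : ∀ k c → stretch k c 𝟘 ≈ 𝟘
stretch-𝟘 k zero zero = refl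
stretch-𝟘 k zero (suc n) = stretch-𝟘 k k n
stretch-𝟘 k (suc c) zero = refl
stretch-𝟘 k (suc c) (suc n) = stretch-𝟘 k c n

𝕍-𝟙 : ∀ k → 𝕍 k 𝟙 ≈ 𝟙
𝕍-𝟙 k zero = refl
𝕍-𝟙 k (suc n) = stretch-𝟘 k k n

•-as-⊗ : ∀ b f → b • f ≈ const b ⊗ f
•-as-⊗ b f = ≈-sym (≈-trans (•-⊗ b 𝟙 f) (λ n → cong (b ∧_) (⊗-identityˡ f n)))

const-∧ : ∀ a b → const (a ∧ b) ≈ const a ⊗ const b
const-∧ a b = ≈-trans (λ n → ∧-assoc a b (𝟙 n)) (•-as-⊗ a (const b))

𝕍-⊗-step : ∀ k n f g → 𝕍 k (tl f ⊗ g) ≡[ n ] 𝕍 k (tl f) ⊗ 𝕍 k g →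
  𝕍 k (f ⊗ g) ≡[ suc n ] 𝕍 k f ⊗ 𝕍 k g
𝕍-⊗-step k n f g ih =
  ≡[]-trans (≈⇒≡[] _ lhs)
    (≡[]-trans (⊕-congʳ[] (c ⊗ d ⊕ Q ⊗ (c ⊗ 𝕍 k (tl g))) (≡[]-weaken (s≤s (m≤n+m n k)) (pow𝕢⊗-cong[] (suc k) ih)))
      (≈⇒≡[] _ rhs))
  where
  Q = pow 𝕢 (suc k)
  c = const (hd f)
  d = const (hd g)
  lhs : 𝕍 k (f ⊗ g) ≈ (c ⊗ d ⊕ Q ⊗ (c ⊗ 𝕍 k (tl g))) ⊕ Q ⊗ 𝕍 k (tl f ⊗ g)
  lhs = ≈-trans (𝕍-eq k (f ⊗ g))
    (≈-trans (⊕-cong (const-∧ (hd f) (hd g))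
               (⊗-congˡ {Q} (≈-trans (𝕍-⊕ k (hd f • tl g) (tl f ⊗ g))
                 (⊕-cong (≈-trans (stretch-• k 0 (hd f) (tl g)) (•-as-⊗ (hd f) _)) ≈-refl))))
      (solve (v0 :* v1 :+ v2 :* (v0 :* v3 :+ v4)) ((v0 :* v1 :+ v2 :* (v0 :* v3)) :+ v2 :* v4)
        (c ∷ d ∷ Q ∷ 𝕍 k (tl g) ∷ 𝕍 k (tl f ⊗ g) ∷ []) refl))
  rhs : (c ⊗ d ⊕ Q ⊗ (c ⊗ 𝕍 k (tl g))) ⊕ Q ⊗ (𝕍 k (tl f) ⊗ 𝕍 k g) ≈ 𝕍 k f ⊗ 𝕍 k g
  rhs = solveBy ((v0 :* v1 :+ v2 :* (v0 :* v3)) :+ v2 :* (v4 :* v5)) (v6 :* v5)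
          (c ∷ d ∷ Q ∷ 𝕍 k (tl g) ∷ 𝕍 k (tl f) ∷ 𝕍 k g ∷ 𝕍 k f ∷ [])
          (([ v0 ]* v5 ≋ v1 :+ v2 :* v3 by 𝕍-eq k g) ∷ ([ v5 ]* v6 ≋ v0 :+ v2 :* v4 by 𝕍-eq k f) ∷ [])
          refl

𝕍-⊗[] : ∀ k n f g → 𝕍 k (f ⊗ g) ≡[ n ] 𝕍 k f ⊗ 𝕍 k g
𝕍-⊗[] k zero f g i ()
𝕍-⊗[] k (suc n) f g = 𝕍-⊗-step k n f g (𝕍-⊗[] k n (tl f) g)

𝕍-⊗ : ∀ k f g → 𝕍 k (f ⊗ g) ≈ 𝕍 k f ⊗ 𝕍 k g
𝕍-⊗ k f g = ≡[]⇒≈ (λ n → 𝕍-⊗[] k n f g)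

𝕍-pow : ∀ k f n → 𝕍 k (pow f n) ≈ pow (𝕍 k f) n
𝕍-pow k f zero = 𝕍-𝟙 k
𝕍-pow k f (suc n) = ≈-trans (𝕍-⊗ k f (pow f n)) (⊗-congˡ (𝕍-pow k f n))

𝕍-𝕢 : ∀ k → 𝕍 k 𝕢 ≈ pow 𝕢 (suc k)
𝕍-𝕢 k = ≈-trans (𝕍-eq k 𝕢) (≈-trans (λ n → refl) (≈-trans (⊗-congˡ (𝕍-𝟙 k)) (⊗-identityʳ _)))

𝕍-∘[] : ∀ j k n f → 𝕍 j (𝕍 k f) ≡[ n ] 𝕍 (k + j * suc k) f
𝕍-∘[] j k zero f i ()
𝕍-∘[] j k (suc n) f =
  ≡[]-trans (≈⇒≡[] _ lhs)
    (≡[]-trans (⊕-congʳ[] (const (hd f))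
                 (≡[]-weaken (s≤s (m≤n+m n (k + j * suc k))) (pow𝕢⊗-cong[] (suc j * suc k) (𝕍-∘[] j k n (tl f)))))
      (≡[]-sym (≈⇒≡[] _ (𝕍-eq (k + j * suc k) f))))
  where
  lhs : 𝕍 j (𝕍 k f) ≈ const (hd f) ⊕ pow 𝕢 (suc j * suc k) ⊗ 𝕍 j (𝕍 k (tl f))
  lhs = ≈-trans (𝕍-cong j (𝕍-eq k f))
    (≈-trans (𝕍-⊕ j (const (hd f)) (pow 𝕢 (suc k) ⊗ 𝕍 k (tl f)))
      (⊕-cong (≈-trans (stretch-• j 0 (hd f) 𝟙) (λ m → cong (hd f ∧_) (𝕍-𝟙 j m)))
        (≈-trans (𝕍-⊗ j (pow 𝕢 (suc k)) (𝕍 k (tl f)))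
          (⊗-congʳ (≈-trans (𝕍-pow j 𝕢 (suc k))
            (≈-trans (pow-cong (𝕍-𝕢 j) (suc k))
              (≈-trans (≈-sym (pow-* 𝕢 (suc k) (suc j)))
                (λ m → cong (λ e → pow 𝕢 e m) (*-comm (suc k) (suc j))))))))))

𝕍-∘ : ∀ j k f → 𝕍 j (𝕍 k f) ≈ 𝕍 (k + j * suc k) f
𝕍-∘ j k f = ≡[]⇒≈ (λ n → 𝕍-∘[] j k n f)

𝕍-expr : ∀ {n} k (e : Expr n) ρ σ → (∀ i → 𝕍 k (lookup ρ i) ≈ lookup σ i) → 𝕍 k (⟦ e ⟧ ρ) ≈ ⟦ e ⟧ σ
𝕍-expr k (var i) ρ σ p = p i
𝕍-expr k `0 ρ σ p = stretch-𝟘 k 0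
𝕍-expr k `1 ρ σ p = 𝕍-𝟙 k
𝕍-expr k (a :+ b) ρ σ p =
  ≈-trans (𝕍-⊕ k (⟦ a ⟧ ρ) (⟦ b ⟧ ρ)) (⊕-cong (𝕍-expr k a ρ σ p) (𝕍-expr k b ρ σ p))
𝕍-expr k (a :* b) ρ σ p =
  ≈-trans (𝕍-⊗ k (⟦ a ⟧ ρ) (⟦ b ⟧ ρ)) (⊗-cong (𝕍-expr k a ρ σ p) (𝕍-expr k b ρ σ p))
𝕍-expr k (a :^ m) ρ σ p =
  ≈-trans (𝕍-pow k (⟦ a ⟧ ρ) m) (pow-cong (𝕍-expr k a ρ σ p) m)

stretch-at : ∀ k c f n → stretch k c f (c + n) ≡ 𝕍 k f n
stretch-at k zero f n = refl
stretch-at k (suc c) f n = stretch-at k c f n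

𝕍-at : ∀ k f n → 𝕍 k f (n * suc k) ≡ f n
𝕍-at k f zero = refl
𝕍-at k f (suc n) = trans (stretch-at k k (tl f) (n * suc k)) (𝕍-at k (tl f) n)

stretch-supp : ∀ k c f n → stretch k c f n ≡ true → ∃ λ m → n ≡ c + m * suc k × f m ≡ true
stretch-supp k zero f zero p = 0 , refl , p
stretch-supp k zero f (suc n) p with stretch-supp k k (tl f) n p
... | m , e , t = suc m , cong suc e , t
stretch-supp k (suc c) f (suc n) p with stretch-supp k c f n p
... | m , e , t = m , cong suc e , t

𝕍-supp : ∀ k f n → 𝕍 k f n ≡ true → ∃ λ m → n ≡ m * suc k × f m ≡ true
𝕍-supp k = stretch-supp k 0

stretch-cong[] : ∀ k c {n f g} → f ≡[ n ] g → stretch k c f ≡[ c + n * suc k ] stretch k c g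
stretch-cong[] k zero {zero} p i ()
stretch-cong[] k zero {suc n} p zero l = p 0 (s≤s z≤n)
stretch-cong[] k zero {suc n} p (suc i) (s≤s l) =
  stretch-cong[] k k {n} (λ j lj → p (suc j) (s≤s lj)) i l
stretch-cong[] k (suc c) p zero l = refl
stretch-cong[] k (suc c) p (suc i) (s≤s l) = stretch-cong[] k c p i l

𝕍-cong[] : ∀ k {n f g} → f ≡[ n ] g → 𝕍 k f ≡[ n ] 𝕍 k g
𝕍-cong[] k {n} p = ≡[]-weaken (m≤m*n n (suc k)) (stretch-cong[] k 0 p)

-- With f = c + q g the cross term vanishes and c² = c, which leaves the square of the tail to the
-- induction.
frobenius[] : ∀ n f → pow f 2 ≡[ n ] 𝕍 1 f
frobenius[] zero f i ()
frobenius[] (suc n) f =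
  ≡[]-trans (≈⇒≡[] _ sq)
    (≡[]-trans (⊕-congʳ[] c
                 (≡[]-weaken (s≤s (m≤n+m n 1)) (pow𝕢⊗-cong[] 2 (frobenius[] n (tl f)))))
      (≡[]-sym (≈⇒≡[] _ (𝕍-eq 1 f))))
  where
  c = const (hd f)
  sq : pow f 2 ≈ c ⊕ pow 𝕢 2 ⊗ pow (tl f) 2
  sq = solveBy (v0 :^ 2) (v1 :+ v2 :^ 2 :* v3 :^ 2) (f ∷ c ∷ 𝕢 ∷ tl f ∷ [])
         (([ v0 :+ v1 :+ v2 :* v3 ]* v0 ≋ v1 :+ v2 :* v3 by decompose f)
         ∷ ([ `1 ]* v1 ≋ v1 :* v1 by
              ≈-trans (λ m → cong (_∧ 𝟙 m) (sym (∧-idem (hd f)))) (const-∧ (hd f) (hd f))) ∷ []) refl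

frobenius : ∀ f → pow f 2 ≈ 𝕍 1 f
frobenius f = ≡[]⇒≈ (λ n → frobenius[] n f)

-- The coefficients of f sit unchanged at the even places of f² = f(q²).
square-injective : ∀ {f g} → pow f 2 ≈ pow g 2 → f ≈ g
square-injective {f} {g} p n =
  trans (sym (𝕍-at 1 f n))
    (trans (sym (frobenius f (n * 2))) (trans (p (n * 2)) (trans (frobenius g (n * 2)) (𝕍-at 1 g n))))

fourth-injective : ∀ {f g} → pow f 4 ≈ pow g 4 → f ≈ g
fourth-injective {f} {g} p =
  square-injective (square-injective (≈-trans (≈-sym (pow-* f 2 2)) (≈-trans p (pow-* g 2 2))))

-- f³ + g³ = (f + g)(f² + fg + g²), and the second factor has constant term 1 + 1 + 1 = 1.
cube-injective : ∀ {f g} → f 0 ≡ true → g 0 ≡ true → pow f 3 ≈ pow g 3 → f ≈ g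
cube-injective {f} {g} pf pg p =
  ⊕≈𝟘⇒≈ (unit-cancel {f ⊕ g} {f ⊗ f ⊕ f ⊗ g ⊕ g ⊗ g} unit
    (≈-trans (solve ((v0 :+ v1) :* (v0 :* v0 :+ v0 :* v1 :+ v1 :* v1)) (v0 :^ 3 :+ v1 :^ 3)
               (f ∷ g ∷ []) refl) (≈⇒⊕≈𝟘 p)))
  where
  unit : (f ⊗ f ⊕ f ⊗ g ⊕ g ⊗ g) 0 ≡ true
  unit rewrite pf | pg = refl

-- Equations N(q) N(q³) = N(q)⁴ + q T(N)

tl-cong[] : ∀ {n f g} → f ≡[ suc n ] g → tl f ≡[ n ] tl g
tl-cong[] p i l = p (suc i) (s≤s l)

tl𝕍-cong[] : ∀ k {n f g} → f ≡[ n ] g → tl (𝕍 (suc k) f) ≡[ n ] tl (𝕍 (suc k) g)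
tl𝕍-cong[] k {zero} p i ()
tl𝕍-cong[] k {suc n} p =
  tl-cong[] (≡[]-weaken (s≤s (s≤s (≤-trans (m≤m*n n (2 + k)) (m≤n+m _ k)))) (stretch-cong[] (suc k) 0 p))

module Functional (T : Series → Series) (ne : Nonexpansive T) where

  -- N(q³) and N⁴ = N(q⁴) both begin with 1, so what follows carries a factor q. Isolating N in N
  -- N(q³) = N⁴ + q T(N) leaves N = 1 + q `step` N.
  step : Series → Series
  step f = f ⊗ tl (𝕍 2 f) ⊕ tl (𝕍 3 f) ⊕ T f

  step-ne : Nonexpansive step
  step-ne n p =
    ⊕-cong[] (⊕-cong[] (⊗-cong[] p (tl𝕍-cong[] 1 p)) (tl𝕍-cong[] 2 p)) (ne n p)

  Solves : Series → Set
  Solves f = f ⊗ 𝕍 2 f ≈ pow f 4 ⊕ 𝕢 ⊗ T f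

  fourth : ∀ {f} → f 0 ≡ true → pow f 4 ≈ 𝟙 ⊕ 𝕢 ⊗ tl (𝕍 3 f)
  fourth {f} u = ≈-trans eq (unit-decompose u)
    where
    eq : pow f 4 ≈ 𝕍 3 f
    eq = ≈-trans (pow-* f 2 2)
           (≈-trans (frobenius (pow f 2)) (≈-trans (𝕍-cong 1 (frobenius f)) (𝕍-∘ 1 1 f)))

  solves⇔fixed : ∀ {f} → f 0 ≡ true → f ⊗ 𝕍 2 f ⊕ pow f 4 ⊕ 𝕢 ⊗ T f ≈ f ⊕ (𝟙 ⊕ 𝕢 ⊗ step f)
  solves⇔fixed {f} u =
    solveBy (v0 :* v1 :+ v2 :+ v3 :* v4) (v0 :+ (`1 :+ v3 :* (v0 :* v5 :+ v6 :+ v4)))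
      (f ∷ 𝕍 2 f ∷ pow f 4 ∷ 𝕢 ∷ T f ∷ tl (𝕍 2 f) ∷ tl (𝕍 3 f) ∷ [])
      (([ v0 ]* v1 ≋ `1 :+ v3 :* v5 by unit-decompose u)
      ∷ ([ `1 ]* v2 ≋ `1 :+ v3 :* v6 by fourth u) ∷ []) refl

  unique : ∀ {f g} → f 0 ≡ true → g 0 ≡ true → Solves f → Solves g → f ≈ g
  unique uf ug sf sg = fix-unique step step-ne (to uf sf) (to ug sg)
    where
    to : ∀ {f} → f 0 ≡ true → Solves f → f ≈ 𝟙 ⊕ 𝕢 ⊗ step f
    to {f} u s =
      ⊕≈𝟘⇒≈ (≈-trans (≈-sym (solves⇔fixed u))
              (≈-trans (⊕-assoc (f ⊗ 𝕍 2 f) (pow f 4) (𝕢 ⊗ T f)) (≈⇒⊕≈𝟘 s)))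

  exists : ∃ λ f → f 0 ≡ true × Solves f
  exists = f , refl , ⊕≈𝟘⇒≈ (≈-trans (≈-sym (⊕-assoc (f ⊗ 𝕍 2 f) (pow f 4) (𝕢 ⊗ T f)))
             (≈-trans (solves⇔fixed {f} refl) (≈⇒⊕≈𝟘 (fix-eq step step-ne))))
    where f = fix step step-ne

-- Level 3, and the recognition of Δ(q) and Δ(qᵖ)

𝕢^-regular : ∀ k {f} → pow 𝕢 k ⊗ f ≈ 𝟘 → f ≈ 𝟘
𝕢^-regular k p = 𝕢^-cancel k (≈-trans p (≈-sym (⊗-zeroʳ _)))

-- A nonzero e of order v would give v = 1 + 3v.
self-similar-zero : ∀ {e} → e ≈ 𝕢 ⊗ 𝕍 2 e → e ≈ 𝟘
self-similar-zero {e} p = ≡[]⇒≈ go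
  where
  go : ∀ n → e ≡[ n ] 𝟘
  go zero i ()
  go (suc n) =
    ≡[]-trans (≈⇒≡[] _ p)
      (≡[]-trans (𝕢⊗-cong[] (𝕍-cong[] 2 (go n)))
        (≈⇒≡[] _ (≈-trans (⊗-congˡ (stretch-𝟘 2 0)) (⊗-zeroʳ 𝕢))))

-- Here `f` is η. Beyond its constant term, the level 3 theory rests on the 3-dissection η³ = η(q³)
-- + q η(q⁹)³.
module Eta (f : Series) (f₀ : f 0 ≡ true)
  (cubes : pow f 3 ≈ 𝕍 2 f ⊕ 𝕢 ⊗ 𝕍 8 (pow f 3)) where

  ψ : Series
  ψ = pow f 3

  ψ₀ : ψ 0 ≡ true
  ψ₀ = pow-unit {f} f₀ 3

  -- With ψ = F + S, F = f(q³), S = qψ(q⁹) and F³ = ψ(q³), the defect e of the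
  -- equation satisfies e(q) = q e(q³).
  modular₃ : pow ψ 4 ⊕ 𝕢 ⊗ pow (𝕍 2 ψ) 4 ≈ ψ ⊗ 𝕍 2 ψ
  modular₃ = ⊕≈𝟘⇒≈ (self-similar-zero step)
    where
    F = 𝕍 2 f
    P = 𝕍 8 ψ
    e = pow ψ 4 ⊕ 𝕢 ⊗ pow (𝕍 2 ψ) 4 ⊕ ψ ⊗ 𝕍 2 ψ
    E : Expr 3
    E = v1 :^ 4 :+ v0 :* v2 :^ 4 :+ v1 :* v2
    σ : Vec Series 3
    σ = pow 𝕢 3 ∷ 𝕍 2 ψ ∷ P ∷ []
    e₃ : 𝕍 2 e ≈ ⟦ E ⟧ σ
    e₃ = 𝕍-expr 2 E (𝕢 ∷ ψ ∷ 𝕍 2 ψ ∷ []) σ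
      λ where zero → 𝕍-𝕢 2
              (suc zero) → ≈-refl
              (suc (suc zero)) → 𝕍-∘ 2 2 ψ
    step : e ≈ 𝕢 ⊗ 𝕍 2 e
    step = solveBy (v1 :^ 4 :+ v0 :* v2 :^ 4 :+ v1 :* v2) (v0 :* v5)
      (𝕢 ∷ ψ ∷ 𝕍 2 ψ ∷ F ∷ P ∷ 𝕍 2 e ∷ [])
      (([ (v1 :+ v3 :+ v0 :* v4) :^ 3 :+ v2 ]* v1 ≋ v3 :+ v0 :* v4 by cubes)
      ∷ ([ v3 :+ v0 :* v4 :+ v0 :* v4 :+ v3 ]* v2 ≋ v3 :^ 3 by 𝕍-pow 2 f 3)
      ∷ ([ v3 ]* v2 ≋ v3 :^ 3 by 𝕍-pow 2 f 3)
      ∷ ([ v0 ]* v5 ≋ v2 :^ 4 :+ v0 :^ 3 :* v4 :^ 4 :+ v2 :* v4 by e₃) ∷ []) refl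

  -- Substituting q^(d+1) for q changes only the explicit factor q of `modular₃`. The equation
  -- therefore remembers d and singles out one stretched copy of ψ.
  module _ (d : ℕ) where
    rhs₃ : Series → Series
    rhs₃ N = pow 𝕢 d ⊗ pow (𝕍 2 N) 4

    rhs₃-ne : Nonexpansive rhs₃
    rhs₃-ne n p = ⊗-cong[] (λ _ _ → refl) (pow-cong[] (𝕍-cong[] 2 p) 4)

    open Functional rhs₃ rhs₃-ne

    modular₃-stretched : Solves (𝕍 d ψ)
    modular₃-stretched =
      ≈-trans (⊗-congˡ (≈-trans (𝕍-∘ 2 d ψ)
                 (≈-trans (λ n → cong (λ k → 𝕍 k ψ n) (index d)) (≈-sym (𝕍-∘ d 2 ψ)))))
        (≈-trans (≈-sym (𝕍-⊗ d ψ (𝕍 2 ψ)))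
          (≈-trans (𝕍-cong d (≈-sym modular₃))
            (≈-trans (𝕍-⊕ d (pow ψ 4) (𝕢 ⊗ pow (𝕍 2 ψ) 4))
              (⊕-cong (𝕍-pow d ψ 4)
                (≈-trans (𝕍-⊗ d 𝕢 (pow (𝕍 2 ψ) 4))
                  (≈-trans (⊗-cong (𝕍-𝕢 d) (≈-trans (𝕍-pow d (𝕍 2 ψ) 4)
                      (pow-cong (≈-trans (𝕍-∘ d 2 ψ) (≈-trans (λ n → cong (λ k → 𝕍 k ψ n) (sym (index d))) (≈-sym (𝕍-∘ 2 d ψ)))) 4)))
                    (⊗-assoc 𝕢 (pow 𝕢 d) _)))))))
      where
      index : ∀ d → d + 2 * suc d ≡ 2 + d * 3
      index d = trans (cong (d +_) (*-suc 2 d)) (trans (+-comm d (2 + 2 * d))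
                  (cong (2 +_) (trans (+-comm (2 * d) d) (*-comm 3 d))))

    stretched-unique : ∀ {N} → N 0 ≡ true →
      N ⊗ 𝕍 2 N ≈ pow N 4 ⊕ 𝕢 ⊗ (pow 𝕢 d ⊗ pow (𝕍 2 N) 4) → N ≈ 𝕍 d ψ
    stretched-unique N₀ s = unique N₀ ψ₀ s modular₃-stretched

  -- Let p = c + 5 and Δ(q) = q ψ(q⁸).  Here A and σ stand for (Δ(q) + Δ(qᵖ))/q and
  -- Δ(q) Δ(qᵖ)/q^(p+1).  The hypotheses sum-eq and product-eq of Roots are what the
  -- equations U⁴ + U(q³)⁴ = U U(q³) for U = Δ(q) and U = Δ(qᵖ) say about A and σ;
  -- cross and quartic recover these equations for the roots of x² + qA x + q^(p+1) σ.
  module Pair (c : ℕ) (A σ : Series) (A₀ : A 0 ≡ true) (σ₀ : σ 0 ≡ true) where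
    B = 𝕍 2 A
    τ = 𝕍 2 σ
    E = pow 𝕢 c

    E₃ : 𝕍 2 E ≈ pow E 3
    E₃ = ≈-trans (𝕍-pow 2 𝕢 c) (≈-trans (pow-cong (𝕍-𝕢 2) c)
           (≈-trans (≈-sym (pow-* 𝕢 c 3))
             (≈-trans (λ n → cong (λ k → pow 𝕢 k n) (*-comm c 3)) (pow-* 𝕢 3 c))))

    module Roots
      (sum-eq : (pow A 4 ⊕ pow 𝕢 8 ⊗ pow B 4) ⊗ (A ⊗ B ⊕ pow A 4 ⊕ pow 𝕢 8 ⊗ pow B 4)
         ≈ pow E 3 ⊗ pow 𝕢 12 ⊗ pow A 2 ⊗ τ ⊕ E ⊗ pow 𝕢 4 ⊗ pow B 2 ⊗ σ)
      (product-eq : pow E 4 ⊗ pow 𝕢 8 ⊗ pow σ 4 ⊕ pow E 12 ⊗ pow 𝕢 56 ⊗ pow τ 4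
         ⊕ pow (A ⊗ B ⊕ pow A 4 ⊕ pow 𝕢 8 ⊗ pow B 4) 4
         ≈ pow E 4 ⊗ pow 𝕢 8 ⊗ σ ⊗ τ) where

      -- The quadratic A W + E q⁴ W² = σ is solved by contraction, since A and σ have constant term
      -- 1 and the square carries a factor q⁴.
      G : Series → Series
      G N = tl σ ⊕ tl A ⊗ N ⊕ E ⊗ pow 𝕢 3 ⊗ (N ⊗ N)

      G-ne : Nonexpansive G
      G-ne n p = ⊕-cong[] (⊕-congʳ[] (tl σ) (⊗-cong[] (λ _ _ → refl) p))
                          (⊗-cong[] (λ _ _ → refl) (⊗-cong[] p p))

      W W3 : Series
      W = fix G G-ne
      W3 = 𝕍 2 W

      root : σ ≈ A ⊗ W ⊕ E ⊗ pow 𝕢 4 ⊗ pow W 2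
      root = solveBy v1 (v2 :* v3 :+ v4 :* v0 :^ 4 :* v3 :^ 2)
        (𝕢 ∷ σ ∷ A ∷ W ∷ E ∷ tl σ ∷ tl A ∷ [])
        (([ `1 ]* v1 ≋ `1 :+ v0 :* v5 by unit-decompose σ₀)
        ∷ ([ v3 ]* v2 ≋ `1 :+ v0 :* v6 by unit-decompose A₀)
        ∷ ([ `1 ]* v3 ≋ `1 :+ v0 :* (v5 :+ v6 :* v3 :+ v4 :* v0 :^ 3 :* (v3 :* v3)) by fix-eq G G-ne) ∷ [])
        refl

      root₃ : τ ≈ B ⊗ W3 ⊕ pow E 3 ⊗ pow 𝕢 12 ⊗ pow W3 2
      root₃ = ≈-trans (𝕍-cong 2 root)
        (≈-trans (𝕍-expr 2 (v1 :* v2 :+ v3 :* v0 :^ 4 :* v2 :^ 2) (𝕢 ∷ A ∷ W ∷ E ∷ [])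
                   (pow 𝕢 3 ∷ B ∷ W3 ∷ pow E 3 ∷ [])
                   λ where zero → 𝕍-𝕢 2
                           (suc zero) → ≈-refl
                           (suc (suc zero)) → ≈-refl
                           (suc (suc (suc zero))) → E₃)
          (⊕-congʳ (B ⊗ W3) (⊗-congʳ (⊗-congˡ (≈-sym (pow-* 𝕢 4 3))))))

      ρ : Vec Series 8
      ρ = 𝕢 ∷ E ∷ A ∷ B ∷ W ∷ W3 ∷ σ ∷ τ ∷ []

      -- Let V = E q⁴ W and U = A + V be the two roots, U₃ and V₃ their images under q ↦ q³. Then X
      -- is U V₃ + V U₃, and X + A B is U U₃ + V V₃. The sum of the level 3 equations for U and V
      -- would say Λ = X, so D measures its failure. Ω is the defect of the level 3 equation for W.
      Λ D X AB′ Xσ Xτ S₄ Ω : Expr 8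
      S₄ = v2 :^ 4 :+ v0 :^ 8 :* v3 :^ 4
      Λ = v2 :* v3 :+ v2 :^ 4 :+ v0 :^ 8 :* v3 :^ 4
      X = v0 :^ 12 :* v1 :^ 3 :* v2 :* v5 :+ v0 :^ 4 :* v1 :* v3 :* v4
      D = X :+ Λ
      AB′ = v2 :* v3
      Xσ = v2 :* v4 :+ v1 :* v0 :^ 4 :* v4 :^ 2
      Xτ = v3 :* v5 :+ v1 :^ 3 :* v0 :^ 12 :* v5 :^ 2
      Ω = v4 :^ 4 :+ v0 :^ 40 :* v1 :^ 8 :* v5 :^ 4 :+ v4 :* v5

      I₁l I₁r I₂l I₂r : Expr 8
      I₁l = S₄ :* Λ
      I₁r = v1 :^ 3 :* v0 :^ 12 :* v2 :^ 2 :* v7 :+ v1 :* v0 :^ 4 :* v3 :^ 2 :* v6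
      I₂l = v1 :^ 4 :* v0 :^ 8 :* v6 :^ 4 :+ v1 :^ 12 :* v0 :^ 56 :* v7 :^ 4 :+ Λ :^ 4
      I₂r = v1 :^ 4 :* v0 :^ 8 :* v6 :* v7

      cross : ⟦ D ⟧ ρ ≈ 𝟘
      -- X (X + A B) is the right side of `sum-eq`, and S₄ = Λ + A B, so `sum-eq` says D (D + A B) =
      -- 0. The second factor has constant term 1.
      cross = unit-cancel {u = ⟦ D :+ AB′ ⟧ ρ} unit
        (solveBy (D :* (D :+ AB′)) `0 ρ
          (([ v1 :^ 3 :* v0 :^ 12 :* v2 :^ 2 ]* v7 ≋ Xτ by root₃)
          ∷ ([ v1 :* v0 :^ 4 :* v3 :^ 2 ]* v6 ≋ Xσ by root)
          ∷ ([ `1 ]* I₁l ≋ I₁r by sum-eq) ∷ []) refl)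
        where
        unit : ⟦ D :+ AB′ ⟧ ρ 0 ≡ true
        unit rewrite A₀ = refl

      quartic : ⟦ Ω ⟧ ρ ≈ 𝟘
      -- By `cross` both roots have the same level 3 defect ω = E⁴ q¹⁶ Ω. The product equation (U U₃
      -- + ω)(V V₃ + ω) = U U₃ V V₃ becomes ω (ω + U U₃ + V V₃) = 0, where U U₃ + V V₃ = S₄ has
      -- constant term 1.
      quartic = unit-cancel {u = ⟦ v1 :^ 4 :* v0 :^ 16 :* Ω :+ S₄ ⟧ ρ} unit
        (𝕢^-regular (4 * c + 8)
          (≈-trans (⊗-congʳ (≈-trans (pow-+ 𝕢 (4 * c) 8) (⊗-congʳ (pow-* 𝕢 4 c))))
            (solveBy (v1 :^ 4 :* v0 :^ 8 :* (Ω :* (v1 :^ 4 :* v0 :^ 16 :* Ω :+ S₄))) `0 ρ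
              (([ `1 ]* I₂l ≋ I₂r by product-eq)
              ∷ ([ v1 :^ 4 :* v0 :^ 8 :* (v6 :+ Xσ) :^ 3 :+ v1 :^ 4 :* v0 :^ 8 :* v7 ]* v6 ≋ Xσ by root)
              ∷ ([ v1 :^ 12 :* v0 :^ 56 :* (v7 :+ Xτ) :^ 3 :+ v1 :^ 4 :* v0 :^ 8 :* Xσ ]* v7 ≋ Xτ by root₃)
              ∷ ([ D :^ 3 :+ v1 :^ 4 :* v0 :^ 8 :* v4 :* v5 ]* D ≋ `0 by cross) ∷ []) refl)))
        where
        unit : ⟦ v1 :^ 4 :* v0 :^ 16 :* Ω :+ S₄ ⟧ ρ 0 ≡ true
        unit rewrite A₀ | ∧-zeroʳ (pow E 4 0) = refl

      E₈ : ∀ n → pow 𝕢 (8 * c + n) ≈ pow E 8 ⊗ pow 𝕢 n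
      E₈ n = ≈-trans (pow-+ 𝕢 (8 * c) n) (⊗-congʳ (pow-* 𝕢 8 c))

      -- With p = c + 5, the index 8c + 39 is one less than 8p.
      W≈ : W ≈ 𝕍 (8 * c + 39) ψ
      W≈ = stretched-unique (8 * c + 39) refl
        (solveBy (v4 :* v5) (v4 :^ 4 :+ v0 :* (v6 :* v5 :^ 4))
          (𝕢 ∷ E ∷ A ∷ B ∷ W ∷ W3 ∷ pow 𝕢 (8 * c + 39) ∷ [])
          (([ `1 ]* v4 :^ 4 :+ v0 :^ 40 :* v1 :^ 8 :* v5 :^ 4 :+ v4 :* v5 ≋ `0 by quartic)
          ∷ ([ v0 :* v5 :^ 4 ]* v6 ≋ v1 :^ 8 :* v0 :^ 39 by E₈ 39) ∷ []) refl)

      U : Series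
      U = A ⊕ E ⊗ pow 𝕢 4 ⊗ W

      U₃≈ : 𝕍 2 U ≈ B ⊕ pow E 3 ⊗ pow 𝕢 12 ⊗ W3
      U₃≈ = ≈-trans (𝕍-⊕ 2 A (E ⊗ pow 𝕢 4 ⊗ W)) (⊕-congʳ B
        (≈-trans (𝕍-⊗ 2 (E ⊗ pow 𝕢 4) W) (⊗-congʳ
          (≈-trans (𝕍-⊗ 2 E (pow 𝕢 4)) (⊗-cong E₃
            (≈-trans (𝕍-pow 2 𝕢 4) (≈-trans (pow-cong (𝕍-𝕢 2) 4) (≈-sym (pow-* 𝕢 4 3)))))))))

      U≈ : U ≈ 𝕍 7 ψ
      U≈ = stretched-unique 7 unit
        (solveBy (v6 :* v7) (v6 :^ 4 :+ v0 :* (v0 :^ 7 :* v7 :^ 4))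
          (𝕢 ∷ E ∷ A ∷ B ∷ W ∷ W3 ∷ U ∷ 𝕍 2 U ∷ [])
          (([ v7 :+ (v6 :+ U′) :^ 3 ]* v6 ≋ U′ by ≈-refl)
          ∷ ([ U′ :+ v0 :^ 8 :* (v7 :+ U₃′) :^ 3 ]* v7 ≋ U₃′ by U₃≈)
          ∷ ([ v1 :^ 4 :* v0 :^ 16 ]* Ω ≋ `0 by quartic)
          ∷ ([ `1 ]* D ≋ `0 by cross) ∷ []) refl)
        where
        U′ U₃′ : Expr 8
        U′ = v2 :+ v1 :* v0 :^ 4 :* v4
        U₃′ = v3 :+ v1 :^ 3 :* v0 :^ 12 :* v5
        unit : U 0 ≡ true
        unit rewrite A₀ | ∧-zeroʳ (E 0) = refl

-- Modular equations of levels 5, 29 and 7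

⟦⟧-cong : ∀ {n} (a : Expr n) {ρ σ : Vec Series n} →
  (∀ i → lookup ρ i ≈ lookup σ i) → ⟦ a ⟧ ρ ≈ ⟦ a ⟧ σ
⟦⟧-cong a p = ≡[]⇒≈ (λ n → ⟦⟧-cong[] a (λ i → ≈⇒≡[] n (p i)))

expr-ne : ∀ (e : Expr 3) → Nonexpansive (λ N → ⟦ e ⟧ (𝕢 ∷ N ∷ 𝕍 2 N ∷ []))
expr-ne e n {f} {g} p = ⟦⟧-cong[] e {𝕢 ∷ f ∷ 𝕍 2 f ∷ []} {𝕢 ∷ g ∷ 𝕍 2 g ∷ []}
  λ where zero i l → refl
          (suc zero) → p
          (suc (suc zero)) → 𝕍-cong[] 2 p

-- sum-eq, product-eq and the equation of level 29, homogenised by g and h (which will be 1)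
-- so that denominators cancel.
module Equations29 {n : ℕ} (a b s t g h : Expr n) where
  Λ sumˡ sumʳ prodˡ prodʳ lev : Expr n
  Λ = a :* b :* g :^ 3 :* h :^ 3 :+ ((a :^ 2) :^ 2 :* h :^ 4 :+ (b :^ 2) :^ 2 :* g :^ 4)
  sumˡ = (a :^ 4 :* h :^ 4 :+ b :^ 4 :* g :^ 4) :* Λ
  sumʳ = a :^ 2 :* t :^ 6 :* g :^ 6 :* h :^ 2 :+ b :^ 2 :* s :^ 6 :* g :^ 2 :* h :^ 6
  prodˡ = s :^ 12 :* h :^ 12 :+ t :^ 12 :* g :^ 12 :+ s :^ 3 :* t :^ 3 :* g :^ 9 :* h :^ 9
  prodʳ = Λ :^ 2 :* g :^ 4 :* h :^ 4
  lev = a :^ 6 :+ s :^ 6 :+ a :* s :* g :^ 4 :+ s :^ 2 :* g :^ 4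

-- X₀(29)/⟨w₂₉⟩ is rational modulo 2: with a suitable parameter ν and G = 1 + ν² + ν⁴,
-- Δ(q) + Δ(q²⁹) = (ν + ν⁵)/G and Δ(q) Δ(q²⁹) = (ν⁵/G)⁶.  The relation Φˡ = Φʳ between
-- ν and μ = ν(q³) makes j = 1/G and k = 1/H satisfy the equations above.
module Param where
  ν μ j k G H α β σ τ g h Φˡ Φʳ : Expr 4
  ν = v0
  μ = v1
  j = v2
  k = v3
  G = `1 :+ ν :^ 2 :+ ν :^ 4
  H = `1 :+ μ :^ 2 :+ μ :^ 4
  α = (ν :+ ν :^ 5) :* j
  β = (μ :+ μ :^ 5) :* k
  σ = ν :^ 5 :* j
  τ = μ :^ 5 :* k
  g = G :* j
  h = H :* k
  Φˡ = ν :* μ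
  Φʳ = μ :^ 4 :+ ν :^ 4 :+ ν :* μ :^ 3 :+ ν :^ 2 :* μ :^ 2 :+ ν :^ 2 :* μ :^ 4 :+ ν :^ 3 :* μ
       :+ ν :^ 4 :* μ :^ 2 :+ ν :^ 4 :* μ :^ 4

  open Equations29 α β σ τ g h public

  module _ (ρ : Vec Series 4) (Φ : ⟦ Φˡ ⟧ ρ ≈ ⟦ Φʳ ⟧ ρ) where
    lead : Mono 4
    lead = 4 ∷ 4 ∷ 0 ∷ 0 ∷ []

    sum-holds : ⟦ sumˡ ⟧ ρ ≈ ⟦ sumʳ ⟧ ρ
    sum-holds = solveMod 400 lead Φˡ Φʳ sumˡ sumʳ ρ Φ refl

    prod-holds : ⟦ prodˡ ⟧ ρ ≈ ⟦ prodʳ ⟧ ρ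
    prod-holds = solveMod 900 lead Φˡ Φʳ prodˡ prodʳ ρ Φ refl

  lev-holds : ∀ ρ → ⟦ lev ⟧ ρ ≈ 𝟘
  lev-holds ρ = solve lev `0 ρ refl

module Modular (f : Series) (f₀ : f 0 ≡ true)
  (cubes : pow f 3 ≈ 𝕍 2 f ⊕ 𝕢 ⊗ 𝕍 8 (pow f 3)) where
  open Eta f f₀ cubes

  sixth-injective : ∀ {x y} → x 0 ≡ true → y 0 ≡ true → pow x 6 ≈ pow y 6 → x ≈ y
  sixth-injective {x} {y} x₀ y₀ p =
    cube-injective x₀ y₀
      (square-injective (≈-trans (≈-sym (pow-* x 2 3)) (≈-trans p (pow-* y 2 3))))

  𝕍₇ψ : 𝕍 7 ψ ≈ pow f 24
  𝕍₇ψ = ≈-trans (≈-sym (≈-trans (pow-* ψ 2 4)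
          (≈-trans (frobenius (pow ψ 4)) (≈-trans (𝕍-cong 1 (fourth-power ψ)) (𝕍-∘ 1 3 ψ)))))
          (≈-sym (pow-* f 8 3))
    where
    fourth-power : ∀ x → pow x 4 ≈ 𝕍 3 x
    fourth-power x = ≈-trans (pow-* x 2 2)
      (≈-trans (frobenius (pow x 2)) (≈-trans (𝕍-cong 1 (frobenius x)) (𝕍-∘ 1 1 x)))

  𝕍₇ψ′ : ∀ k → 𝕍 (7 + k * 8) ψ ≈ pow (𝕍 k f) 24
  𝕍₇ψ′ k = ≈-trans (≈-sym (𝕍-∘ k 7 ψ)) (≈-trans (𝕍-cong k 𝕍₇ψ) (𝕍-pow k f 24))

  -- The parameter is ν = q N, where N will be (f f₅)⁴: Δ(q) + Δ(q⁵) = ν and Δ(q) Δ(q⁵) = ν⁶. Its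
  -- correspondence of level 3 with μ = ν(q³) is νμ = ν⁴ + ν²μ² + μ⁴, which divided by q⁴ is the
  -- equation that defines N.
  module Level5 where
    T : Series → Series
    T N = ⟦ v0 :^ 3 :* v1 :^ 2 :* v2 :^ 2 :+ v0 :^ 7 :* v2 :^ 4 ⟧ (𝕢 ∷ N ∷ 𝕍 2 N ∷ [])

    T-ne : Nonexpansive T
    T-ne = expr-ne (v0 :^ 3 :* v1 :^ 2 :* v2 :^ 2 :+ v0 :^ 7 :* v2 :^ 4)

    open Functional T T-ne

    N M : Series
    N = proj₁ exists
    M = 𝕍 2 N

    N₀ : N 0 ≡ true
    N₀ = proj₁ (proj₂ exists)

    open Pair 0 N (pow N 6) N₀ (pow-unit {N} N₀ 6)

    ρ : Vec Series 3
    ρ = 𝕢 ∷ N ∷ M ∷ []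

    Φˡ Φʳ Λ : Expr 3
    Φˡ = v1 :* v2
    Φʳ = v1 :^ 4 :+ v0 :* (v0 :^ 3 :* v1 :^ 2 :* v2 :^ 2 :+ v0 :^ 7 :* v2 :^ 4)
    Λ = v1 :* v2 :+ v1 :^ 4 :+ v0 :^ 8 :* v2 :^ 4

    Φ : ⟦ Φˡ ⟧ ρ ≈ ⟦ Φʳ ⟧ ρ
    Φ = proj₂ (proj₂ exists)

    τ≈ : 𝕍 2 (pow N 6) ≈ pow M 6
    τ≈ = 𝕍-pow 2 N 6

    -- Level 5 means c = 0, so the powers of E = `pow 𝕢 0` appear as powers of 1.
    open Roots
      (≈-trans
        (solveMod 100 (8 ∷ 0 ∷ 4 ∷ []) Φˡ Φʳ ((v1 :^ 4 :+ v0 :^ 8 :* v2 :^ 4) :* Λ)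
          (`1 :^ 3 :* v0 :^ 12 :* v1 :^ 2 :* v2 :^ 6 :+ `1 :* v0 :^ 4 :* v2 :^ 2 :* v1 :^ 6) ρ Φ refl)
        (⊕-cong (⊗-congˡ (≈-sym τ≈)) (≈-refl {𝟙 ⊗ pow 𝕢 4 ⊗ pow M 2 ⊗ pow N 6})))
      (≈-trans
        (⊕-cong (⊕-congʳ (pow 𝟙 4 ⊗ pow 𝕢 8 ⊗ pow (pow N 6) 4) (⊗-congˡ (pow-cong τ≈ 4)))
                (≈-refl {pow (⟦ Λ ⟧ ρ) 4}))
        (≈-trans
          (solveMod 1000 (8 ∷ 0 ∷ 4 ∷ []) Φˡ Φʳ
            (`1 :^ 4 :* v0 :^ 8 :* (v1 :^ 6) :^ 4 :+ `1 :^ 12 :* v0 :^ 56 :* (v2 :^ 6) :^ 4 :+ Λ :^ 4)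
            (`1 :^ 4 :* v0 :^ 8 :* v1 :^ 6 :* v2 :^ 6) ρ Φ refl)
          (⊗-congˡ (≈-sym τ≈))))

    f₅ : Series
    f₅ = 𝕍 4 f

    modular₅ : pow f 6 ⊕ 𝕢 ⊗ pow f₅ 6 ≈ f ⊗ f₅
    -- The sum of the roots, f²⁴ + q⁴ f₅²⁴ = (f f₅)⁴, is the fourth power of the claim.
    modular₅ = fourth-injective
      (solveBy ((v1 :^ 6 :+ v0 :* v2 :^ 6) :^ 4) ((v1 :* v2) :^ 4) (𝕢 ∷ f ∷ f₅ ∷ W ∷ U ∷ N ∷ [])
        (([ `1 ]* v4 ≋ v1 :^ 24 by ≈-trans U≈ 𝕍₇ψ)
        ∷ ([ v0 :^ 4 ]* v3 ≋ v2 :^ 24 by W₂₄)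
        ∷ ([ `1 ]* v4 ≋ v5 :+ `1 :* v0 :^ 4 :* v3 by ≈-refl)
        ∷ ([ `1 ]* v5 ≋ (v1 :* v2) :^ 4 by N≈) ∷ []) refl)
      where
      W₂₄ : W ≈ pow f₅ 24
      W₂₄ = ≈-trans W≈ (𝕍₇ψ′ 4)
      unit : pow (f ⊗ f₅) 4 0 ≡ true
      unit = pow-unit {f ⊗ f₅} (trans (cong (_∧ f 0) f₀) f₀) 4
      N≈ : N ≈ pow (f ⊗ f₅) 4
      -- The product of the two roots is N⁶ by construction and (f f₅)²⁴ by their identification.
      N≈ = sixth-injective N₀ unit
        (solveBy (v5 :^ 6) (((v1 :* v2) :^ 4) :^ 6) (𝕢 ∷ f ∷ f₅ ∷ W ∷ U ∷ N ∷ [])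
          (([ `1 ]* v5 :^ 6 ≋ v5 :* v3 :+ `1 :* v0 :^ 4 :* v3 :^ 2 by root)
          ∷ ([ v3 ]* v4 ≋ v5 :+ `1 :* v0 :^ 4 :* v3 by ≈-refl)
          ∷ ([ v3 ]* v4 ≋ v1 :^ 24 by ≈-trans U≈ 𝕍₇ψ)
          ∷ ([ v1 :^ 24 ]* v3 ≋ v2 :^ 24 by W₂₄) ∷ []) refl)

  module Level29 where
    -- Putting ν = q N and μ = q³ M into the relation of `Param` and dividing by q⁴ gives N M = N⁴ +
    -- q `Tᵉ`, the shape that determines N.
    Tᵉ : Expr 3
    Tᵉ = v0 :^ 7 :* v2 :^ 4 :+ v0 :^ 5 :* v1 :* v2 :^ 3 :+ v0 :^ 3 :* v1 :^ 2 :* v2 :^ 2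
         :+ v0 :^ 9 :* v1 :^ 2 :* v2 :^ 4 :+ v0 :* v1 :^ 3 :* v2 :+ v0 :^ 5 :* v1 :^ 4 :* v2 :^ 2
         :+ v0 :^ 11 :* v1 :^ 4 :* v2 :^ 4

    T : Series → Series
    T N = ⟦ Tᵉ ⟧ (𝕢 ∷ N ∷ 𝕍 2 N ∷ [])

    T-ne : Nonexpansive T
    T-ne = expr-ne Tᵉ

    open Functional T T-ne

    N M ν μ γ J K : Series
    N = proj₁ exists
    M = 𝕍 2 N
    ν = 𝕢 ⊗ N
    μ = pow 𝕢 3 ⊗ M
    γ = 𝟙 ⊕ pow ν 2 ⊕ pow ν 4
    J = proj₁ (invert γ refl)
    K = 𝕍 2 J

    N₀ : N 0 ≡ true
    N₀ = proj₁ (proj₂ exists)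

    ν₃ : 𝕍 2 ν ≈ μ
    ν₃ = ≈-trans (𝕍-⊗ 2 𝕢 N) (⊗-congʳ (𝕍-𝕢 2))

    ρ : Vec Series 4
    ρ = ν ∷ μ ∷ J ∷ K ∷ []

    g≈ : ⟦ Param.g ⟧ ρ ≈ 𝟙
    g≈ = proj₂ (invert γ refl)

    h≈ : ⟦ Param.h ⟧ ρ ≈ 𝟙
    h≈ = ≈-trans (≈-sym (𝕍-expr 2 ((`1 :+ v0 :^ 2 :+ v0 :^ 4) :* v1) (ν ∷ J ∷ []) (μ ∷ K ∷ [])
           λ where zero → ν₃
                   (suc zero) → ≈-refl))
           (≈-trans (𝕍-cong 2 g≈) (𝕍-𝟙 2))

    Φ : ⟦ Param.Φˡ ⟧ ρ ≈ ⟦ Param.Φʳ ⟧ ρ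
    Φ = solveBy (nu :* mu)
          (mu :^ 4 :+ nu :^ 4 :+ nu :* mu :^ 3 :+ nu :^ 2 :* mu :^ 2 :+ nu :^ 2 :* mu :^ 4 :+ nu :^ 3 :* mu
            :+ nu :^ 4 :* mu :^ 2 :+ nu :^ 4 :* mu :^ 4)
          (𝕢 ∷ N ∷ M ∷ [])
          (([ v0 :^ 4 ]* v1 :* v2 ≋ v1 :^ 4 :+ v0 :* Tᵉ by proj₂ (proj₂ exists)) ∷ []) refl
      where
      nu mu : Expr 3
      nu = v0 :* v1
      mu = v0 :^ 3 :* v2

    A B S S₃ : Series
    A = N ⊗ (𝟙 ⊕ pow ν 4) ⊗ J
    B = 𝕍 2 A
    S = pow N 5 ⊗ J
    S₃ = 𝕍 2 S

    A₀ : A 0 ≡ true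
    A₀ = refl

    S₀ : S 0 ≡ true
    S₀ = refl

    B≈ : B ≈ M ⊗ (𝟙 ⊕ pow μ 4) ⊗ K
    B≈ = 𝕍-expr 2 (v0 :* (`1 :+ v1 :^ 4) :* v2) (N ∷ ν ∷ J ∷ []) (M ∷ μ ∷ K ∷ [])
      λ where zero → ≈-refl
              (suc zero) → ν₃
              (suc (suc zero)) → ≈-refl

    S₃≈ : S₃ ≈ pow M 5 ⊗ K
    S₃≈ = 𝕍-expr 2 (v0 :^ 5 :* v1) (N ∷ J ∷ []) (M ∷ K ∷ [])
      λ where zero → ≈-refl
              (suc zero) → ≈-refl

    -- `Param` works with ν, μ and formal inverses j, k. For the actual inverses, g = G j and h = H
    -- k become 1, and the powers of q can be extracted.
    values normalised : Vec Series 6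
    values = ⟦ Param.α ⟧ ρ ∷ ⟦ Param.β ⟧ ρ ∷ ⟦ Param.σ ⟧ ρ ∷ ⟦ Param.τ ⟧ ρ ∷ ⟦ Param.g ⟧ ρ ∷ ⟦ Param.h ⟧ ρ ∷ []
    normalised = 𝕢 ⊗ A ∷ pow 𝕢 3 ⊗ B ∷ pow 𝕢 5 ⊗ S ∷ pow 𝕢 15 ⊗ S₃ ∷ 𝟙 ∷ 𝟙 ∷ []

    values≈ : ∀ i → lookup values i ≈ lookup normalised i
    values≈ zero =
      solve ((v0 :* v1 :+ (v0 :* v1) :^ 5) :* v2) (v0 :* (v1 :* (`1 :+ (v0 :* v1) :^ 4) :* v2))
        (𝕢 ∷ N ∷ J ∷ []) refl
    values≈ (suc zero) =
      solveBy ((v0 :^ 3 :* v1 :+ (v0 :^ 3 :* v1) :^ 5) :* v2) (v0 :^ 3 :* v3) (𝕢 ∷ M ∷ K ∷ B ∷ [])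
        (([ v0 :^ 3 ]* v3 ≋ v1 :* (`1 :+ (v0 :^ 3 :* v1) :^ 4) :* v2 by B≈) ∷ []) refl
    values≈ (suc (suc zero)) =
      solve ((v0 :* v1) :^ 5 :* v2) (v0 :^ 5 :* (v1 :^ 5 :* v2)) (𝕢 ∷ N ∷ J ∷ []) refl
    values≈ (suc (suc (suc zero))) =
      solveBy ((v0 :^ 3 :* v1) :^ 5 :* v2) (v0 :^ 15 :* v3) (𝕢 ∷ M ∷ K ∷ S₃ ∷ [])
        (([ v0 :^ 15 ]* v3 ≋ v1 :^ 5 :* v2 by S₃≈) ∷ []) refl
    values≈ (suc (suc (suc (suc zero)))) = g≈
    values≈ (suc (suc (suc (suc (suc zero))))) = h≈

    normalise : ∀ l r → ⟦ l ⟧ values ≈ ⟦ r ⟧ values → ⟦ l ⟧ normalised ≈ ⟦ r ⟧ normalised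
    normalise l r p =
      ≈-trans (≈-sym (⟦⟧-cong l {values} {normalised} values≈))
        (≈-trans p (⟦⟧-cong r {values} {normalised} values≈))

    module G = Equations29 {6} v0 v1 v2 v3 v4 v5
    module R = Equations29 {5} (v0 :* v1) (v0 :^ 3 :* v2) (v0 :^ 5 :* v3) (v0 :^ 15 :* v4) `1 `1

    R-env : Vec Series 5
    R-env = 𝕢 ∷ A ∷ B ∷ S ∷ S₃ ∷ []

    sumᴿ : ⟦ R.sumˡ ⟧ R-env ≈ ⟦ R.sumʳ ⟧ R-env
    sumᴿ = normalise G.sumˡ G.sumʳ (Param.sum-holds ρ Φ)

    prodᴿ : ⟦ R.prodˡ ⟧ R-env ≈ ⟦ R.prodʳ ⟧ R-env
    prodᴿ = normalise G.prodˡ G.prodʳ (Param.prod-holds ρ Φ)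

    levᴿ : ⟦ R.lev ⟧ R-env ≈ 𝟘
    levᴿ = normalise G.lev `0 (Param.lev-holds ρ)

    open Pair 24 A (pow S 6) A₀ (pow-unit {S} S₀ 6) hiding (B)

    Λ : Expr 5
    Λ = v1 :* v2 :+ v1 :^ 4 :+ v0 :^ 8 :* v2 :^ 4

    e : Expr 5
    e = v0 :^ 24

    τ≈ : 𝕍 2 (pow S 6) ≈ pow S₃ 6
    τ≈ = 𝕍-pow 2 S 6

    open Roots
      (≈-trans
        (𝕢^-cancel 8 (solveBy (v0 :^ 8 :* ((v1 :^ 4 :+ v0 :^ 8 :* v2 :^ 4) :* Λ))
          (v0 :^ 8 :* (e :^ 3 :* v0 :^ 12 :* v1 :^ 2 :* v4 :^ 6 :+ e :* v0 :^ 4 :* v2 :^ 2 :* v3 :^ 6)) R-env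
          (([ `1 ]* R.sumˡ ≋ R.sumʳ by sumᴿ) ∷ []) refl))
        (⊕-cong (⊗-congˡ (≈-sym τ≈)) (≈-refl {E ⊗ pow 𝕢 4 ⊗ pow B 2 ⊗ pow S 6})))
      (≈-trans
        (⊕-cong (⊕-congʳ (pow E 4 ⊗ pow 𝕢 8 ⊗ pow (pow S 6) 4) (⊗-congˡ (pow-cong τ≈ 4)))
                (≈-refl {pow (⟦ Λ ⟧ R-env) 4}))
        (≈-trans
          -- Since σ = S⁶, every term of the product equation is a square, and `prodᴿ` is its square
          -- root. Taken with itself as multiplier it yields the square.
          (𝕢^-cancel 16 (solveBy
            (v0 :^ 16 :* (e :^ 4 :* v0 :^ 8 :* (v3 :^ 6) :^ 4 :+ e :^ 12 :* v0 :^ 56 :* (v4 :^ 6) :^ 4 :+ Λ :^ 4))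
            (v0 :^ 16 :* (e :^ 4 :* v0 :^ 8 :* v3 :^ 6 :* v4 :^ 6)) R-env
            (([ R.prodˡ :+ R.prodʳ ]* R.prodˡ ≋ R.prodʳ by prodᴿ) ∷ []) refl))
          (⊗-congˡ (≈-sym τ≈))))

    f₂₉ : Series
    f₂₉ = 𝕍 28 f

    modular₂₉ : pow (pow f 6 ⊕ pow 𝕢 7 ⊗ pow f₂₉ 6) 6 ⊕ pow 𝕢 6 ⊗ pow (f ⊗ f₂₉) 6
      ⊕ (pow f 6 ⊕ pow 𝕢 7 ⊗ pow f₂₉ 6) ⊗ (f ⊗ f₂₉) ⊕ 𝕢 ⊗ pow (f ⊗ f₂₉) 2 ≈ 𝟘
    -- A and S are fourth powers, so the relation `lev` between q A and q⁵ S is q⁶ times the fourth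
    -- power of the claim.
    modular₂₉ = fourth-injective (𝕢^-cancel 6
      (≈-trans (solve (v0 :^ 6 :* target :^ 4) (lev (v0 :* a) (v0 :^ 5 :* s)) (𝕢 ∷ f ∷ f₂₉ ∷ []) refl)
        (≈-trans (⟦⟧-cong (lev (v0 :* v1) (v0 :^ 5 :* v2))
                    {𝕢 ∷ ⟦ a ⟧ (𝕢 ∷ f ∷ f₂₉ ∷ []) ∷ ⟦ s ⟧ (𝕢 ∷ f ∷ f₂₉ ∷ []) ∷ []} {𝕢 ∷ A ∷ S ∷ []}
                    λ where zero → ≈-refl
                            (suc zero) → ≈-sym A≈
                            (suc (suc zero)) → ≈-sym S≈)
          (solveBy (lev (v0 :* v1) (v0 :^ 5 :* v2)) (v0 :^ 6 :* `0 :^ 4) (𝕢 ∷ A ∷ S ∷ [])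
            (([ `1 ]* (v0 :* v1) :^ 6 :+ (v0 :^ 5 :* v2) :^ 6 :+ v0 :* v1 :* (v0 :^ 5 :* v2) :* `1 :^ 4
                      :+ (v0 :^ 5 :* v2) :^ 2 :* `1 :^ 4 ≋ `0 by levᴿ) ∷ []) refl))))
      where
      W₂₄ : W ≈ pow f₂₉ 24
      W₂₄ = ≈-trans W≈ (𝕍₇ψ′ 28)
      a s target : Expr 3
      a = v1 :^ 24 :+ v0 :^ 28 :* v2 :^ 24
      s = (v1 :* v2) :^ 4
      target = (v1 :^ 6 :+ v0 :^ 7 :* v2 :^ 6) :^ 6 :+ v0 :^ 6 :* (v1 :* v2) :^ 6
        :+ (v1 :^ 6 :+ v0 :^ 7 :* v2 :^ 6) :* (v1 :* v2) :+ v0 :* (v1 :* v2) :^ 2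
      lev : Expr 3 → Expr 3 → Expr 3
      lev x y = x :^ 6 :+ y :^ 6 :+ x :* y :+ y :^ 2
      A≈ : A ≈ pow f 24 ⊕ pow 𝕢 28 ⊗ pow f₂₉ 24
      A≈ = solveBy v3 (v1 :^ 24 :+ v0 :^ 28 :* v2 :^ 24) (𝕢 ∷ f ∷ f₂₉ ∷ A ∷ W ∷ U ∷ [])
        (([ `1 ]* v5 ≋ v1 :^ 24 by ≈-trans U≈ 𝕍₇ψ)
        ∷ ([ v0 :^ 28 ]* v4 ≋ v2 :^ 24 by W₂₄)
        ∷ ([ `1 ]* v5 ≋ v3 :+ v0 :^ 24 :* v0 :^ 4 :* v4 by ≈-refl) ∷ []) refl
      unit : pow (f ⊗ f₂₉) 4 0 ≡ true
      unit = pow-unit {f ⊗ f₂₉} (trans (cong (_∧ f 0) f₀) f₀) 4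
      S≈ : S ≈ pow (f ⊗ f₂₉) 4
      S≈ = sixth-injective S₀ unit
        (solveBy (v6 :^ 6) (((v1 :* v2) :^ 4) :^ 6) (𝕢 ∷ f ∷ f₂₉ ∷ A ∷ W ∷ U ∷ S ∷ [])
          (([ `1 ]* v6 :^ 6 ≋ v3 :* v4 :+ v0 :^ 24 :* v0 :^ 4 :* v4 :^ 2 by root)
          ∷ ([ v4 ]* v5 ≋ v3 :+ v0 :^ 24 :* v0 :^ 4 :* v4 by ≈-refl)
          ∷ ([ v4 ]* v5 ≋ v1 :^ 24 by ≈-trans U≈ 𝕍₇ψ)
          ∷ ([ v1 :^ 24 ]* v4 ≋ v2 :^ 24 by W₂₄) ∷ []) refl)

module Modular7 (f : Series) (f₀ : f 0 ≡ true)
  (cubes : pow f 3 ≈ 𝕍 2 f ⊕ 𝕢 ⊗ 𝕍 8 (pow f 3)) where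
  open Eta f f₀ cubes
  open Modular f f₀ cubes using (𝕍₇ψ; 𝕍₇ψ′)

  -- Here N = ψ(q)ψ(q⁷) and q⁸N⁸ = Δ(q)Δ(q⁷).
  module Level7 where
    -- In terms of ν = q N and μ = ν(q³) the equation is νμ = ν⁴ + ν²μ + νμ² + μ⁴, and the sum Δ(q)
    -- + Δ(q⁷) is ν + ν².
    Tᵉ : Expr 3
    Tᵉ = v1 :^ 2 :* v2 :+ v0 :^ 2 :* v1 :* v2 :^ 2 :+ v0 :^ 7 :* v2 :^ 4

    T : Series → Series
    T N = ⟦ Tᵉ ⟧ (𝕢 ∷ N ∷ 𝕍 2 N ∷ [])

    open Functional T (expr-ne Tᵉ)

    N M A : Series
    N = proj₁ exists
    M = 𝕍 2 N
    A = N ⊗ (𝟙 ⊕ 𝕢 ⊗ N)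

    N₀ : N 0 ≡ true
    N₀ = proj₁ (proj₂ exists)

    open Pair 2 A (pow N 8) refl (pow-unit {N} N₀ 8)

    ρ : Vec Series 3
    ρ = 𝕢 ∷ N ∷ M ∷ []

    Φˡ Φʳ : Expr 3
    Φˡ = v1 :* v2
    Φʳ = v1 :^ 4 :+ v0 :* Tᵉ

    Φ : ⟦ Φˡ ⟧ ρ ≈ ⟦ Φʳ ⟧ ρ
    Φ = proj₂ (proj₂ exists)

    module _ {n} (q a b σ τ : Expr n) where
      Λ sumˡ sumʳ prodˡ prodʳ : Expr n
      Λ = a :* b :+ a :^ 4 :+ q :^ 8 :* b :^ 4
      sumˡ = (a :^ 4 :+ q :^ 8 :* b :^ 4) :* Λ
      sumʳ = (q :^ 2) :^ 3 :* q :^ 12 :* a :^ 2 :* τ :+ q :^ 2 :* q :^ 4 :* b :^ 2 :* σ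
      prodˡ = (q :^ 2) :^ 4 :* q :^ 8 :* σ :^ 4 :+ (q :^ 2) :^ 12 :* q :^ 56 :* τ :^ 4 :+ Λ :^ 4
      prodʳ = (q :^ 2) :^ 4 :* q :^ 8 :* σ :* τ

    α β σ′ τ′ : Expr 3
    α = v1 :* (`1 :+ v0 :* v1)
    β = v2 :* (`1 :+ v0 :^ 3 :* v2)
    σ′ = v1 :^ 8
    τ′ = v2 :^ 8

    values true-values : Vec Series 5
    values = 𝕢 ∷ A ∷ ⟦ β ⟧ ρ ∷ pow N 8 ∷ pow M 8 ∷ []
    true-values = 𝕢 ∷ A ∷ B ∷ pow N 8 ∷ τ ∷ []

    values≈ : ∀ i → lookup values i ≈ lookup true-values i
    values≈ zero = ≈-refl
    values≈ (suc zero) = ≈-refl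
    values≈ (suc (suc zero)) = ≈-sym (𝕍-expr 2 (v1 :* (`1 :+ v0 :* v1)) (𝕢 ∷ N ∷ []) (pow 𝕢 3 ∷ M ∷ [])
      λ where zero → 𝕍-𝕢 2
              (suc zero) → ≈-refl)
    values≈ (suc (suc (suc zero))) = ≈-refl
    values≈ (suc (suc (suc (suc zero)))) = ≈-sym (𝕍-pow 2 N 8)

    transport : ∀ l r → ⟦ l ⟧ values ≈ ⟦ r ⟧ values → ⟦ l ⟧ true-values ≈ ⟦ r ⟧ true-values
    transport l r p =
      ≈-trans (≈-sym (⟦⟧-cong l {values} {true-values} values≈))
        (≈-trans p (⟦⟧-cong r {values} {true-values} values≈))

    open Roots
      (transport (sumˡ v0 v1 v2 v3 v4) (sumʳ v0 v1 v2 v3 v4)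
        (solveMod 1000 (8 ∷ 0 ∷ 4 ∷ []) Φˡ Φʳ (sumˡ v0 α β σ′ τ′) (sumʳ v0 α β σ′ τ′) ρ Φ refl))
      (transport (prodˡ v0 v1 v2 v3 v4) (prodʳ v0 v1 v2 v3 v4)
        (solveMod 1000 (8 ∷ 0 ∷ 4 ∷ []) Φˡ Φʳ (prodˡ v0 α β σ′ τ′) (prodʳ v0 α β σ′ τ′) ρ Φ refl))

    f₇ : Series
    f₇ = 𝕍 6 f

    W₂₄ : W ≈ pow f₇ 24
    W₂₄ = ≈-trans W≈ (𝕍₇ψ′ 6)

    N≈ : N ≈ pow (f ⊗ f₇) 3
    N≈ = square-injective (fourth-injective
      (≈-trans (≈-sym (pow-* N 4 2)) (≈-trans
        (solveBy (v5 :^ 8) (((v1 :* v2) :^ 3) :^ 8) (𝕢 ∷ f ∷ f₇ ∷ W ∷ U ∷ N ∷ A ∷ [])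
          (([ `1 ]* v5 :^ 8 ≋ v6 :* v3 :+ v0 :^ 2 :* v0 :^ 4 :* v3 :^ 2 by root)
          ∷ ([ v3 ]* v4 ≋ v6 :+ v0 :^ 2 :* v0 :^ 4 :* v3 by ≈-refl)
          ∷ ([ v3 ]* v4 ≋ v1 :^ 24 by ≈-trans U≈ 𝕍₇ψ)
          ∷ ([ v1 :^ 24 ]* v3 ≋ v2 :^ 24 by W₂₄) ∷ []) refl)
        (pow-* (pow (f ⊗ f₇) 3) 4 2))))

    modular₇ : pow f 8 ⊕ pow 𝕢 2 ⊗ pow f₇ 8 ≈ f ⊗ f₇ ⊕ 𝕢 ⊗ pow (f ⊗ f₇) 4
    -- With w = f f₇, both x = f⁸ + q² f₇⁸ and y = w + q w⁴ satisfy z³ + q² w⁸ z = w³ + q w⁶. The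
    -- difference of the two cubics is x + y times the cofactor, whose constant term is 1 + 1 + 1.
    modular₇ = ⊕≈𝟘⇒≈ (unit-cancel {u = ⟦ cofactor ⟧ env} unit
      (solveBy ((x :+ y) :* cofactor) `0 (𝕢 ∷ f ∷ f₇ ∷ W ∷ U ∷ N ∷ [])
        (([ `1 ]* v4 ≋ v1 :^ 24 by ≈-trans U≈ 𝕍₇ψ)
        ∷ ([ v0 :^ 6 ]* v3 ≋ v2 :^ 24 by W₂₄)
        ∷ ([ `1 ]* v4 ≋ v5 :* (`1 :+ v0 :* v5) :+ v0 :^ 2 :* v0 :^ 4 :* v3 by ≈-refl)
        ∷ ([ `1 :+ v0 :* v5 :+ v0 :* (v1 :* v2) :^ 3 ]* v5 ≋ (v1 :* v2) :^ 3 by N≈) ∷ []) refl))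
      where
      env : Vec Series 6
      env = 𝕢 ∷ f ∷ f₇ ∷ W ∷ U ∷ N ∷ []
      x y cofactor : Expr 6
      x = v1 :^ 8 :+ v0 :^ 2 :* v2 :^ 8
      y = v1 :* v2 :+ v0 :* (v1 :* v2) :^ 4
      cofactor = x :^ 2 :+ x :* y :+ y :^ 2 :+ v0 :^ 2 :* (v1 :* v2) :^ 8
      unit : ⟦ cofactor ⟧ env 0 ≡ true
      unit rewrite f₀ = refl

-- The Euler product and its theta series

suc-∸ : ∀ {j m} → j < m → suc (m ∸ suc j) ≡ m ∸ j
suc-∸ j<m = sym (+-∸-assoc 1 j<m)

∑ : ℕ → (ℕ → Series) → Series
∑ zero F = 𝟘
∑ (suc n) F = ∑ n F ⊕ F n

∑-cong[] : ∀ n {m F G} → (∀ s → s < n → F s ≡[ m ] G s) → ∑ n F ≡[ m ] ∑ n G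
∑-cong[] zero p i l = refl
∑-cong[] (suc n) p = ⊕-cong[] (∑-cong[] n (λ s l → p s (m≤n⇒m≤1+n l))) (p n ≤-refl)

⊗-drop[] : ∀ {k n f} → n ≤ k → pow 𝕢 k ⊗ f ≡[ n ] 𝟘
⊗-drop[] {k} {f = f} n≤k i l = pow𝕢-low k f i (<-≤-trans l n≤k)

tri : ℕ → ℕ
tri zero = 0
tri (suc n) = tri n + suc n

euler : ℕ → Series
euler zero = 𝟙
euler (suc n) = euler n ⊗ (𝟙 ⊕ pow 𝕢 (suc n))

-- ∏ (1 + q^i), i > 0: the i-th coefficient of the partial products stabilises at euler i.
η : Series
η n = euler n n

1+pow-≡𝟙 : ∀ n f → f ⊗ (𝟙 ⊕ pow 𝕢 n) ≡[ n ] f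
1+pow-≡𝟙 n f =
  ≡[]-trans (≈⇒≡[] n (≈-trans (⊗-distribˡ f 𝟙 (pow 𝕢 n)) (⊕-cong (⊗-identityʳ f) (⊗-comm f (pow 𝕢 n)))))
    (≡[]-trans (⊕-congʳ[] f (⊗-drop[] ≤-refl)) (≈⇒≡[] n (⊕-identityʳ f)))

euler-≤ : ∀ m n → euler (m + n) ≡[ suc n ] euler n
euler-≤ zero n i l = refl
euler-≤ (suc m) n =
  ≡[]-trans (≡[]-weaken (s≤s (m≤n+m n m)) (1+pow-≡𝟙 (suc (m + n)) (euler (m + n)))) (euler-≤ m n)

η≡euler : ∀ n → η ≡[ suc n ] euler n
η≡euler n i (s≤s l) =
  trans (sym (euler-≤ (n ∸ i) i i ≤-refl)) (cong (λ k → euler k i) (m∸n+n≡m l))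

-- Shanks' finite form of the pentagonal number theorem:
-- ∑_{s≤n} ∏_{s<i≤n}(1+q^i) q^{sn+tri s} = 1 + ∑_{0<k≤n} (q^{k²+tri(k-1)} + q^{k²+tri k}).
module Pentagonal where

  prod : ℕ → ℕ → Series
  prod s zero = 𝟙
  prod s (suc d) = (𝟙 ⊕ pow 𝕢 (suc s)) ⊗ prod (suc s) d

  prod-snoc : ∀ s d → prod s (suc d) ≈ prod s d ⊗ (𝟙 ⊕ pow 𝕢 (suc (s + d)))
  prod-snoc s zero rewrite +-identityʳ s = ⊗-comm _ 𝟙
  prod-snoc s (suc d) rewrite +-suc s d =
    ≈-trans (⊗-congˡ (prod-snoc (suc s) d)) (≈-sym (⊗-assoc _ _ _))

  prod₀ : ∀ n → prod 0 n ≈ euler n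
  prod₀ zero = ≈-refl
  prod₀ (suc n) = ≈-trans (prod-snoc 0 n) (⊗-congʳ (prod₀ n))

  term : ℕ → ℕ → Series
  term n s = prod s (n ∸ s) ⊗ pow (pow 𝕢 n) s ⊗ pow 𝕢 (tri s)

  -- Passing from m to m + 1 changes a partial sum by one product only. For j = m its finite product
  -- is empty, and it becomes one of the two new pentagonal powers; the other is the term s = m + 1.
  telescope : ∀ m j → j ≤ m →
    ∑ (suc j) (term (suc m)) ⊕ ∑ (suc j) (term m)
      ≈ prod j (m ∸ j) ⊗ pow (pow 𝕢 (suc m)) (suc j) ⊗ pow 𝕢 (tri j)
  telescope m zero _ =
    solveBy (`0 :+ v0 :* `1 :* `1 :+ (`0 :+ v1 :* `1 :* `1)) (v1 :* (v2 :* `1) :* `1)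
      (prod 0 (suc m) ∷ prod 0 m ∷ pow 𝕢 (suc m) ∷ [])
      (([ `1 ]* v0 ≋ v1 :* (`1 :+ v2) by prod-snoc 0 m) ∷ []) refl
  telescope m (suc j) j<m =
    solveBy (v0 :+ v1 :* v2 :* v3 :+ (v4 :+ v5 :* v6 :* v3)) (v5 :* (v7 :* v2) :* v3)
      (∑ (suc j) (term (suc m)) ∷ prod (suc j) (m ∸ j) ∷ pow X (suc j) ∷ pow 𝕢 (tri (suc j))
        ∷ ∑ (suc j) (term m) ∷ prod (suc j) (m ∸ suc j) ∷ pow (pow 𝕢 m) (suc j) ∷ X
        ∷ prod j (m ∸ j) ∷ pow 𝕢 (tri j) ∷ pow 𝕢 (suc j) ∷ [])
      (([ `1 ]* v0 :+ v4 ≋ v8 :* v2 :* v9 by telescope m j (<⇒≤ j<m))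
      ∷ ([ v2 :* v9 ]* v8 ≋ (`1 :+ v10) :* v5 by first)
      ∷ ([ v2 :* v3 ]* v1 ≋ v5 :* (`1 :+ v7) by last)
      ∷ ([ v5 :* v2 :* v7 :+ v5 :* v2 :* (`1 :+ v7) :+ v5 :* v6 ]* v3 ≋ v9 :* v10 by pow-+ 𝕢 (tri j) (suc j))
      ∷ ([ v5 :* v9 ]* v2 ≋ v10 :* v6 by pow-⊗ 𝕢 (pow 𝕢 m) (suc j)) ∷ []) refl
    where
    X = pow 𝕢 (suc m)
    first : prod j (m ∸ j) ≈ (𝟙 ⊕ pow 𝕢 (suc j)) ⊗ prod (suc j) (m ∸ suc j)
    first rewrite sym (suc-∸ j<m) = ≈-refl
    last : prod (suc j) (m ∸ j) ≈ prod (suc j) (m ∸ suc j) ⊗ (𝟙 ⊕ X)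
    last = subst₂′ (suc-∸ j<m) (m+[n∸m]≡n j<m) (prod-snoc (suc j) (m ∸ suc j))
      where
      subst₂′ : ∀ {a b c d} → a ≡ b → c ≡ d →
        prod (suc j) a ≈ prod (suc j) (m ∸ suc j) ⊗ (𝟙 ⊕ pow 𝕢 (suc c)) →
        prod (suc j) b ≈ prod (suc j) (m ∸ suc j) ⊗ (𝟙 ⊕ pow 𝕢 (suc d))
      subst₂′ refl refl p = p

  shanks : ℕ → Series
  shanks n = ∑ (suc n) (term n)

  term-top : ∀ n → term n n ≈ pow (pow 𝕢 n) n ⊗ pow 𝕢 (tri n)
  term-top n rewrite n∸n≡0 n = ⊗-congʳ (⊗-identityˡ _)

  shanks-step : ∀ m → shanks (suc m) ≈
    shanks m ⊕ (pow (pow 𝕢 (suc m)) (suc m) ⊗ pow 𝕢 (tri m) ⊕ pow (pow 𝕢 (suc m)) (suc m) ⊗ pow 𝕢 (tri (suc m)))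
  shanks-step m =
    solveBy (v0 :+ v1) (v2 :+ (v3 :+ v4))
      (∑ (suc m) (term (suc m)) ∷ term (suc m) (suc m) ∷ shanks m
        ∷ pow (pow 𝕢 (suc m)) (suc m) ⊗ pow 𝕢 (tri m) ∷ pow (pow 𝕢 (suc m)) (suc m) ⊗ pow 𝕢 (tri (suc m)) ∷ [])
      (([ `1 ]* v0 :+ v2 ≋ v3 by ≈-trans (telescope m m ≤-refl) top)
      ∷ ([ `1 ]* v1 ≋ v4 by term-top (suc m)) ∷ []) refl
    where
    top : prod m (m ∸ m) ⊗ pow (pow 𝕢 (suc m)) (suc m) ⊗ pow 𝕢 (tri m)
      ≈ pow (pow 𝕢 (suc m)) (suc m) ⊗ pow 𝕢 (tri m)
    top rewrite n∸n≡0 m = ⊗-congʳ (⊗-identityˡ _)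

  -- The generalised pentagonal numbers k(3k + 1)/2 and (k + 1)(3k + 2)/2.
  lo hi : ℕ → ℕ
  lo k = k * k + tri k
  hi k = suc k * suc k + tri k

  partial : ℕ → Series
  partial m = ∑ m λ k → pow 𝕢 (lo k) ⊕ pow 𝕢 (hi k)

  pow-square : ∀ n e → pow (pow 𝕢 n) n ⊗ pow 𝕢 e ≈ pow 𝕢 (n * n + e)
  pow-square n e = ≈-sym (≈-trans (pow-+ 𝕢 (n * n) e) (⊗-congʳ (pow-* 𝕢 n n)))

  shanks≈ : ∀ m → shanks m ≈ partial m ⊕ pow 𝕢 (lo m)
  shanks≈ zero = solve (`0 :+ `1 :* `1 :* `1) (`0 :+ `1) [] refl
  shanks≈ (suc m) =
    ≈-trans (shanks-step m)
      (≈-trans (⊕-cong (shanks≈ m) (⊕-cong (pow-square (suc m) (tri m)) (pow-square (suc m) (tri (suc m)))))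
        (solve (v0 :+ v1 :+ (v2 :+ v3)) (v0 :+ (v1 :+ v2) :+ v3)
          (partial m ∷ pow 𝕢 (lo m) ∷ pow 𝕢 (hi m) ∷ pow 𝕢 (lo (suc m)) ∷ []) refl))

  term-small : ∀ n s → term n (suc s) ≡[ suc n ] 𝟘
  term-small n s =
    ≡[]-trans (≈⇒≡[] _ eq) (⊗-drop[] ≤-refl)
    where
    eq : term n (suc s) ≈ pow 𝕢 (suc n) ⊗ (prod (suc s) (n ∸ suc s) ⊗ pow (pow 𝕢 n) s ⊗ pow 𝕢 (tri s + s))
    eq = solveBy (v0 :* (v1 :* v2) :* v3) (v4 :* v1 :* (v0 :* v2 :* v5))
      (prod (suc s) (n ∸ suc s) ∷ pow 𝕢 n ∷ pow (pow 𝕢 n) s ∷ pow 𝕢 (tri s + suc s) ∷ 𝕢 ∷ pow 𝕢 (tri s + s) ∷ [])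
      (([ v0 :* v1 :* v2 ]* v3 ≋ v4 :* v5 by
         (λ n → cong (λ e → pow 𝕢 e n) (+-suc (tri s) s))) ∷ []) refl

  shanks≡euler : ∀ n k → ∑ (suc k) (term n) ≡[ suc n ] euler n
  shanks≡euler n zero = ≈⇒≡[] _ (≈-trans (solve (`0 :+ v0 :* `1 :* `1) v0 (prod 0 n ∷ []) refl) (prod₀ n))
  shanks≡euler n (suc k) =
    ≡[]-trans (⊕-congʳ[] (∑ (suc k) (term n)) (term-small n k))
      (≡[]-trans (≈⇒≡[] _ (⊕-identityʳ _)) (shanks≡euler n k))

  η≡partial′ : ∀ m → η ≡[ suc m ] partial m ⊕ pow 𝕢 (lo m)
  η≡partial′ m =
    ≡[]-trans (η≡euler m) (≡[]-trans (≡[]-sym (shanks≡euler m m)) (≈⇒≡[] _ (shanks≈ m)))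

  tri-≥ : ∀ m → m ≤ tri m
  tri-≥ zero = z≤n
  tri-≥ (suc m) = m≤n+m (suc m) (tri m)

  η≡partial : ∀ m → η ≡[ m ] partial m
  η≡partial m =
    ≡[]-trans (≡[]-weaken (n≤1+n m) (η≡partial′ m))
      (≡[]-trans (⊕-congʳ[] (partial m) (≡[]-trans (≈⇒≡[] m (≈-sym (⊗-identityʳ (pow 𝕢 (lo m)))))
                    (⊗-drop[] (≤-trans (tri-≥ m) (m≤n+m (tri m) (m * m))))))
        (≈⇒≡[] m (⊕-identityʳ _)))

-- Shanks' finite form of Gauss' identity for triangular numbers.
module Triangular where

  odd : ℕ → Series
  odd zero = 𝟙
  odd (suc n) = odd n ⊗ (𝟙 ⊕ pow 𝕢 (suc (n + n)))

  evens : ℕ → ℕ → Series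
  evens s zero = 𝟙
  evens s (suc d) = (𝟙 ⊕ pow (pow 𝕢 (suc s)) 2) ⊗ evens (suc s) d

  evens-snoc : ∀ s d → evens s (suc d) ≈ evens s d ⊗ (𝟙 ⊕ pow (pow 𝕢 (suc (s + d))) 2)
  evens-snoc s zero rewrite +-identityʳ s = ⊗-comm _ 𝟙
  evens-snoc s (suc d) rewrite +-suc s d =
    ≈-trans (⊗-congˡ (evens-snoc (suc s) d)) (≈-sym (⊗-assoc _ _ _))

  evens₀ : ∀ n → evens 0 n ≈ pow (euler n) 2
  evens₀ zero = solve `1 (`1 :^ 2) [] refl
  evens₀ (suc n) =
    ≈-trans (evens-snoc 0 n) (≈-trans (⊗-congʳ (evens₀ n))
      (solve (v0 :^ 2 :* (`1 :+ v1 :^ 2)) ((v0 :* (`1 :+ v1)) :^ 2) (euler n ∷ pow 𝕢 (suc n) ∷ []) refl))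

  term : ℕ → ℕ → Series
  term n s = evens s (n ∸ s) ⊗ odd s ⊗ pow (pow 𝕢 (suc (n + n))) s

  -- The sum for m is first multiplied by 1 + q^(2m+1), the new factor of `odd (suc m)`; then again
  -- all but one product cancels.
  telescope : ∀ m j → j ≤ m →
    ∑ (suc j) (term (suc m)) ⊕ (𝟙 ⊕ pow 𝕢 (suc (m + m))) ⊗ ∑ (suc j) (term m)
      ≈ evens j (m ∸ j) ⊗ odd (suc j) ⊗ pow (pow 𝕢 (suc (m + m))) (suc j)
  telescope m zero _ =
    solveBy (`0 :+ v0 :* `1 :* `1 :+ (`1 :+ v2) :* (`0 :+ v1 :* `1 :* `1)) (v1 :* (`1 :* (`1 :+ v5 :* `1)) :* (v2 :* `1))
      (evens 0 (suc m) ∷ evens 0 m ∷ pow 𝕢 (suc (m + m)) ∷ pow 𝕢 (suc m) ∷ pow 𝕢 m ∷ 𝕢 ∷ pow 𝕢 (m + m) ∷ [])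
      (([ `1 ]* v0 ≋ v1 :* (`1 :+ v3 :^ 2) by evens-snoc 0 m)
      ∷ ([ v1 :* (v3 :+ v5 :* v4) ]* v3 ≋ v5 :* v4 by ≈-refl)
      ∷ ([ v1 :* v5 ]* v2 ≋ v5 :* v6 by ≈-refl)
      ∷ ([ v1 :* v5 :^ 2 ]* v6 ≋ v4 :* v4 by pow-+ 𝕢 m m) ∷ []) refl
  telescope m (suc j) j<m =
    solveBy (v0 :+ v1 :* v2 :* v3 :+ (`1 :+ v4) :* (v5 :+ v6 :* v2 :* v7))
            (v6 :* (v2 :* (`1 :+ v8)) :* (v4 :* v7))
      (∑ (suc j) (term (suc m)) ∷ evens (suc j) (m ∸ j) ∷ odd (suc j) ∷ pow (pow 𝕢 (suc (suc m + suc m))) (suc j)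
        ∷ x ∷ ∑ (suc j) (term m) ∷ evens (suc j) (m ∸ suc j) ∷ pow x (suc j)
        ∷ pow 𝕢 (suc (suc j + suc j)) ∷ evens j (m ∸ j) ∷ pow 𝕢 (suc j) ∷ pow 𝕢 (suc m) ∷ [])
      (([ `1 ]* v0 :+ (`1 :+ v4) :* v5 ≋ v9 :* v2 :* v7 by telescope m j (<⇒≤ j<m))
      ∷ ([ v2 :* v7 ]* v9 ≋ (`1 :+ v10 :^ 2) :* v6 by first)
      ∷ ([ v2 :* v3 ]* v1 ≋ v6 :* (`1 :+ v11 :^ 2) by last)
      ∷ ([ v6 :* v2 :* (`1 :+ v11 :^ 2) ]* v3 ≋ v10 :^ 2 :* v7 by powers)
      ∷ ([ v6 :* v2 :* v7 ]* v11 :^ 2 :* v10 :^ 2 ≋ v4 :* v8 by cross) ∷ []) refl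
    where
    x = pow 𝕢 (suc (m + m))
    first : evens j (m ∸ j) ≈ (𝟙 ⊕ pow (pow 𝕢 (suc j)) 2) ⊗ evens (suc j) (m ∸ suc j)
    first rewrite sym (suc-∸ j<m) = ≈-refl
    last : evens (suc j) (m ∸ j) ≈ evens (suc j) (m ∸ suc j) ⊗ (𝟙 ⊕ pow (pow 𝕢 (suc m)) 2)
    last = subst₂′ (suc-∸ j<m) (m+[n∸m]≡n j<m) (evens-snoc (suc j) (m ∸ suc j))
      where
      subst₂′ : ∀ {a b c d} → a ≡ b → c ≡ d →
        evens (suc j) a ≈ evens (suc j) (m ∸ suc j) ⊗ (𝟙 ⊕ pow (pow 𝕢 (suc c)) 2) →
        evens (suc j) b ≈ evens (suc j) (m ∸ suc j) ⊗ (𝟙 ⊕ pow (pow 𝕢 (suc d)) 2)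
      subst₂′ refl refl p = p
    powers : pow (pow 𝕢 (suc (suc m + suc m))) (suc j) ≈ pow (pow 𝕢 (suc j)) 2 ⊗ pow x (suc j)
    powers = ≈-trans (pow-cong (≈-trans (λ n → cong (λ k → pow 𝕢 k n) (cong (2 +_) (+-suc m m))) (pow-+ 𝕢 2 (suc (m + m)))) (suc j))
      (≈-trans (pow-⊗ (pow 𝕢 2) x (suc j))
        (⊗-congʳ (≈-trans (≈-sym (pow-* 𝕢 (suc j) 2))
          (≈-trans (λ n → cong (λ k → pow 𝕢 k n) (*-comm (suc j) 2)) (pow-* 𝕢 2 (suc j))))))
    cross : pow (pow 𝕢 (suc m)) 2 ⊗ pow (pow 𝕢 (suc j)) 2 ≈ x ⊗ pow 𝕢 (suc (suc j + suc j))
    cross = ≈-trans (⊗-cong (≈-sym (pow-* 𝕢 2 (suc m))) (≈-sym (pow-* 𝕢 2 (suc j))))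
      (≈-trans (≈-sym (pow-+ 𝕢 (2 * suc m) (2 * suc j)))
        (≈-trans (λ n → cong (λ k → pow 𝕢 k n) (exponents m j)) (pow-+ 𝕢 (suc (m + m)) _)))
      where
      exponents : ∀ m j → 2 * suc m + 2 * suc j ≡ suc (m + m) + suc (suc j + suc j)
      exponents = solve-∀

  gauss : ℕ → Series
  gauss n = ∑ n (term n)

  triangles : ℕ → Series
  triangles n = ∑ n (λ k → pow 𝕢 (tri k))

  gauss≈ : ∀ n → gauss n ≈ odd n ⊗ triangles (n + n)
  gauss≈ zero = ≈-sym (⊗-zeroʳ 𝟙)
  gauss≈ (suc m) = ≈-trans step (≈-sym (λ i → cong (λ k → (odd (suc m) ⊗ triangles (suc k)) i) (+-suc m m)))
    where
    x = pow 𝕢 (suc (m + m))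
    top : ∀ {k} → k ≡ 0 → evens m k ⊗ odd (suc m) ⊗ pow x (suc m) ≈ odd (suc m) ⊗ pow x (suc m)
    top refl = ⊗-congʳ (⊗-identityˡ _)
    top′ : ∀ {k} → k ≡ 0 → evens m k ⊗ odd m ⊗ pow x m ≈ odd m ⊗ pow x m
    top′ refl = ⊗-congʳ (⊗-identityˡ _)
    triangular : ∀ m → tri (m + m) ≡ m * suc (m + m)
    triangular zero = refl
    triangular (suc m) rewrite +-suc m m | triangular m = go m
      where
      go : ∀ m → m * suc (m + m) + suc (m + m) + suc (suc (m + m)) ≡ suc m * suc (suc (suc (m + m)))
      go = solve-∀
    at-top : pow 𝕢 (tri (m + m)) ≈ pow x m
    at-top rewrite triangular m = pow-* 𝕢 m (suc (m + m))
    step : gauss (suc m) ≈ odd (suc m) ⊗ triangles (suc (suc (m + m)))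
    step = solveBy v0 (v1 :* (v2 :+ v3 :+ v4))
      (gauss (suc m) ∷ odd (suc m) ∷ triangles (m + m) ∷ pow 𝕢 (tri (m + m)) ∷ pow 𝕢 (tri (m + m) + suc (m + m))
        ∷ gauss m ∷ evens m (m ∸ m) ⊗ odd m ⊗ pow x m ∷ x ∷ odd m ∷ pow x m ∷ [])
      (([ `1 ]* v0 :+ (`1 :+ v7) :* (v5 :+ v6) ≋ v1 :* (v7 :* v9) by
          ≈-trans (telescope m m ≤-refl) (top (n∸n≡0 m)))
      ∷ ([ `1 :+ v7 ]* v6 ≋ v8 :* v9 by top′ (n∸n≡0 m))
      ∷ ([ `1 :+ v7 ]* v5 ≋ v8 :* v2 by gauss≈ m)
      ∷ ([ v9 :+ v2 ]* v1 ≋ v8 :* (`1 :+ v7) by ≈-refl)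
      ∷ ([ v1 ]* v4 ≋ v3 :* v7 by pow-+ 𝕢 (tri (m + m)) (suc (m + m)))
      ∷ ([ v1 :* (`1 :+ v7) ]* v3 ≋ v9 by at-top) ∷ []) refl

  term-small : ∀ n s → term n (suc s) ≡[ suc n ] 𝟘
  term-small n s =
    ≡[]-trans (≈⇒≡[] _ eq) (⊗-drop[] (s≤s (m≤m+n n n)))
    where
    eq : term n (suc s) ≈ pow 𝕢 (suc (n + n)) ⊗ (evens (suc s) (n ∸ suc s) ⊗ odd (suc s) ⊗ pow (pow 𝕢 (suc (n + n))) s)
    eq = solve (v0 :* v1 :* (v2 :* v3)) (v2 :* (v0 :* v1 :* v3))
      (evens (suc s) (n ∸ suc s) ∷ odd (suc s) ∷ pow 𝕢 (suc (n + n)) ∷ pow (pow 𝕢 (suc (n + n))) s ∷ []) refl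

  gauss≡ : ∀ n k → ∑ (suc k) (term n) ≡[ suc n ] pow (euler n) 2
  gauss≡ n zero = ≈⇒≡[] _ (≈-trans (solve (`0 :+ v0 :* `1 :* `1) v0 (evens 0 n ∷ []) refl) (evens₀ n))
  gauss≡ n (suc k) =
    ≡[]-trans (⊕-congʳ[] (∑ (suc k) (term n)) (term-small n k))
      (≡[]-trans (≈⇒≡[] _ (⊕-identityʳ _)) (gauss≡ n k))

  -- Over 𝔽₂ the even factors 1 + q^(2i) form the square of an Euler product.
  euler-split : ∀ n → euler (n + n) ≈ odd n ⊗ pow (euler n) 2
  euler-split zero = solve `1 (`1 :* `1 :^ 2) [] refl
  euler-split (suc n) rewrite +-suc n n =
    solveBy (v0 :* (`1 :+ v1) :* (`1 :+ v2)) (v3 :* (`1 :+ v1) :* (v4 :* (`1 :+ v5)) :^ 2)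
      (euler (n + n) ∷ pow 𝕢 (suc (n + n)) ∷ pow 𝕢 (suc (suc (n + n))) ∷ odd n ∷ euler n ∷ pow 𝕢 (suc n) ∷ [])
      (([ (`1 :+ v1) :* (`1 :+ v2) ]* v0 ≋ v3 :* v4 :^ 2 by euler-split n)
      ∷ ([ (`1 :+ v1) :* v3 :* v4 :^ 2 ]* v2 ≋ v5 :^ 2 by
           ≈-trans (λ i → cong (λ k → pow 𝕢 k i) (double n)) (pow-* 𝕢 2 (suc n))) ∷ []) refl
    where
    double : ∀ n → suc (suc (n + n)) ≡ 2 * suc n
    double = solve-∀

  η₀ : η 0 ≡ true
  η₀ = refl

  -- In the limit Gauss' identity reads η² = ∏ (1 + q^(2i-1)) · ∑ q^(tri k), while the odd product
  -- times η² is η. Multiplying by η² gives η⁴ = η ∑ q^(tri k).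
  η³≡triangles : ∀ n → pow η 3 ≡[ n ] triangles (n + n)
  η³≡triangles zero i ()
  η³≡triangles n@(suc m) = ≡[]-trans (≡[]-sym (≈⇒≡[] n lhs)) (≡[]-trans (⊗-cong[] (λ _ _ → refl) cancelled) (≈⇒≡[] n rhs))
    where
    j = proj₁ (invert η η₀)
    jη : η ⊗ j ≈ 𝟙
    jη = proj₂ (invert η η₀)
    e≡ : euler n ≡[ n ] η
    e≡ = ≡[]-sym (≡[]-weaken (n≤1+n n) (η≡euler n))
    e2≡ : euler (n + n) ≡[ n ] η
    e2≡ = ≡[]-sym (≡[]-weaken (≤-trans (m≤m+n n n) (n≤1+n (n + n))) (η≡euler (n + n)))
    cancelled : pow η 4 ≡[ n ] η ⊗ triangles (n + n)
    cancelled =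
      ≡[]-trans (≡[]-sym (pow-cong[] e≡ 4))
        (≡[]-trans (≈⇒≡[] n (pow-* (euler n) 2 2))
          (≡[]-trans (⊗-cong[] {f = pow (euler n) 2} (λ _ _ → refl)
              (≡[]-trans (≈⇒≡[] n (⊗-identityʳ _))
                (≡[]-trans (≡[]-sym (≡[]-weaken (n≤1+n n) (gauss≡ n m))) (≈⇒≡[] n (gauss≈ n)))))
            (≡[]-trans (≈⇒≡[] n (≈-trans
                (solve (v0 :* (v1 :* v2)) (v1 :* v0 :* v2) (pow (euler n) 2 ∷ odd n ∷ triangles (n + n) ∷ []) refl)
                (⊗-congʳ (≈-sym (euler-split n)))))
              (⊗-cong[] e2≡ (λ _ _ → refl)))))
    lhs : j ⊗ pow η 4 ≈ pow η 3
    lhs = solveBy (v0 :* v1 :^ 4) (v1 :^ 3) (j ∷ η ∷ []) (([ v1 :^ 3 ]* v1 :* v0 ≋ `1 by jη) ∷ []) refl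
    rhs : j ⊗ (η ⊗ triangles (n + n)) ≈ triangles (n + n)
    rhs = solveBy (v0 :* (v1 :* v2)) v2 (j ∷ η ∷ triangles (n + n) ∷ []) (([ v2 ]* v1 :* v0 ≋ `1 by jη) ∷ []) refl

-- The 3-dissection of η³

open Pentagonal using (lo; hi; partial; η≡partial)
open Triangular using (triangles; η³≡triangles; η₀)

𝕍-pow𝕢 : ∀ k e → 𝕍 k (pow 𝕢 e) ≈ pow 𝕢 (e * suc k)
𝕍-pow𝕢 k e = ≈-trans (𝕍-pow k 𝕢 e) (≈-trans (pow-cong (𝕍-𝕢 k) e) (≈-sym (pow-* 𝕢 e (suc k))))

tri-3k : ∀ k → tri (k * 3) ≡ lo k * 3
tri-3k zero = refl
tri-3k (suc k) rewrite tri-3k k = go k (tri k)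
  where
  go : ∀ k t → (k * k + t) * 3 + suc (k * 3) + suc (suc (k * 3)) + suc (suc (suc (k * 3)))
       ≡ (suc k * suc k + (t + suc k)) * 3
  go = solve-∀

tri-3k+1 : ∀ k → tri (suc (k * 3)) ≡ suc (tri k * 9)
tri-3k+1 zero = refl
tri-3k+1 (suc k) rewrite tri-3k+1 k = go k (tri k)
  where
  go : ∀ k t → suc (t * 9) + suc (suc (k * 3)) + suc (suc (suc (k * 3))) + suc (suc (suc (suc (k * 3))))
       ≡ suc ((t + suc k) * 9)
  go = solve-∀

double-tri : ∀ k → tri k + tri k ≡ k * suc k
double-tri zero = refl
double-tri (suc k) = trans (go k (tri k)) (trans (cong (_+ (suc k + suc k)) (double-tri k)) (go′ k))
  where
  go : ∀ k t → (t + suc k) + (t + suc k) ≡ (t + t) + (suc k + suc k)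
  go = solve-∀
  go′ : ∀ k → k * suc k + (suc k + suc k) ≡ suc k * suc (suc k)
  go′ = solve-∀

tri-3k+2 : ∀ k → tri (suc (suc (k * 3))) ≡ hi k * 3
tri-3k+2 zero = refl
tri-3k+2 (suc k) rewrite tri-3k+2 k = go k (tri k)
  where
  go : ∀ k t → (suc k * suc k + t) * 3 + suc (suc (suc (k * 3))) + suc (suc (suc (suc (k * 3)))) + suc (suc (suc (suc (suc (k * 3)))))
       ≡ (suc (suc k) * suc (suc k) + (t + suc k)) * 3
  go = solve-∀

-- Indices 0 and 2 modulo 3 give three times the pentagonal numbers, index 1 gives 1 + 9 tri k.
triangles-3 : ∀ m → triangles (m * 3) ≈ 𝕍 2 (partial m) ⊕ 𝕢 ⊗ 𝕍 8 (triangles m)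
triangles-3 zero = ≈-sym (⊕-cong (stretch-𝟘 2 0) (≈-trans (⊗-congˡ (stretch-𝟘 8 0)) (⊗-zeroʳ 𝕢)))
triangles-3 (suc m) =
  solveBy (v0 :+ v1 :+ v2 :+ v3) (v4 :+ v5 :* v6)
    (triangles (m * 3) ∷ pow 𝕢 (tri (m * 3)) ∷ pow 𝕢 (tri (suc (m * 3))) ∷ pow 𝕢 (tri (suc (suc (m * 3))))
      ∷ 𝕍 2 (partial (suc m)) ∷ 𝕢 ∷ 𝕍 8 (triangles (suc m))
      ∷ 𝕍 2 (partial m) ∷ 𝕍 8 (triangles m) ∷ 𝕍 2 (pow 𝕢 (lo m)) ∷ 𝕍 2 (pow 𝕢 (hi m)) ∷ 𝕍 8 (pow 𝕢 (tri m)) ∷ [])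
    (([ `1 ]* v0 ≋ v7 :+ v5 :* v8 by triangles-3 m)
    ∷ ([ `1 ]* v4 ≋ v7 :+ (v9 :+ v10) by
         ≈-trans (𝕍-⊕ 2 (partial m) (pow 𝕢 (lo m) ⊕ pow 𝕢 (hi m)))
           (⊕-congʳ (𝕍 2 (partial m)) (𝕍-⊕ 2 (pow 𝕢 (lo m)) (pow 𝕢 (hi m)))))
    ∷ ([ v5 ]* v6 ≋ v8 :+ v11 by 𝕍-⊕ 8 (triangles m) (pow 𝕢 (tri m)))
    ∷ ([ `1 ]* v1 ≋ v9 by λ n → trans (cong (λ e → pow 𝕢 e n) (tri-3k m)) (sym (𝕍-pow𝕢 2 (lo m) n)))
    ∷ ([ `1 ]* v3 ≋ v10 by λ n → trans (cong (λ e → pow 𝕢 e n) (tri-3k+2 m)) (sym (𝕍-pow𝕢 2 (hi m) n)))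
    ∷ ([ `1 ]* v2 ≋ v5 :* v11 by
         λ n → trans (cong (λ e → pow 𝕢 e n) (tri-3k+1 m)) (sym (⊗-congˡ {𝕢} (𝕍-pow𝕢 8 (tri m)) n))) ∷ []) refl

η-cubes : pow η 3 ≈ 𝕍 2 η ⊕ 𝕢 ⊗ 𝕍 8 (pow η 3)
η-cubes = ≡[]⇒≈ λ n →
  ≡[]-trans (≡[]-weaken (m≤m*n n 3) (η³≡triangles (n * 3)))
    (≡[]-trans (≈⇒≡[] n (≈-trans (λ i → cong (λ k → triangles k i) (index n)) (triangles-3 (n + n))))
      (⊕-cong[] (𝕍-cong[] 2 (≡[]-sym (≡[]-weaken (m≤m+n n n) (η≡partial (n + n)))))
                (⊗-cong[] (λ _ _ → refl) (𝕍-cong[] 8 (≡[]-sym (η³≡triangles n))))))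
  where
  index : ∀ n → n * 3 + n * 3 ≡ (n + n) * 3
  index = solve-∀

-- Generating functions of b_m and p_t modulo 2

parity : ℕ → Bool
parity zero = false
parity (suc n) = not (parity n)

parity-+ : ∀ m n → parity (m + n) ≡ parity m xor parity n
parity-+ zero n = refl
parity-+ (suc m) n = trans (cong not (parity-+ m n)) (not-xor (parity m) (parity n))
  where
  not-xor : ∀ a b → not (a xor b) ≡ not a xor b
  not-xor false b = refl
  not-xor true b = not-involutive b

parity-* : ∀ m n → parity (m * n) ≡ parity m ∧ parity n
parity-* zero n = refl
parity-* (suc m) n = trans (parity-+ n (m * n)) (trans (cong (parity n xor_) (parity-* m n)) (go (parity m) (parity n)))
  where
  go : ∀ a b → b xor (a ∧ b) ≡ not a ∧ b
  go false b = xor-identityʳ b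
  go true b = xor-same b

%2-parity : ∀ n → n % 2 ≡ (if parity n then 1 else 0)
%2-parity zero = refl
%2-parity (suc zero) = refl
%2-parity (suc (suc n)) = trans (%2-parity n) (cong (if_then 1 else 0) (sym (not-involutive (parity n))))

parity-sum : ∀ (h : ℕ → ℕ) n →
  parity (sum (map h (upTo (suc n)))) ≡ parity (sum (map h (upTo n))) xor parity (h n)
parity-sum h n = begin
  parity (sum (map h (upTo (suc n))))            ≡⟨ cong (parity ∘ sum ∘ map h) (applyUpTo-∷ʳ id n) ⟨
  parity (sum (map h (upTo n ∷ʳ n)))             ≡⟨ cong (parity ∘ sum) (map-++ h (upTo n) (n ∷ [])) ⟩
  parity (sum (map h (upTo n) ∷ʳ h n))           ≡⟨ cong parity (sum-++ (map h (upTo n)) (h n ∷ [])) ⟩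
  parity (sum (map h (upTo n)) + (h n + 0))      ≡⟨ parity-+ (sum (map h (upTo n))) (h n + 0) ⟩
  parity (sum (map h (upTo n))) xor parity (h n + 0)
    ≡⟨ cong (λ x → parity (sum (map h (upTo n))) xor parity x) (+-identityʳ (h n)) ⟩
  parity (sum (map h (upTo n))) xor parity (h n) ∎
  where open ≡-Reasoning

parity-convolution : ∀ (a c : ℕ → ℕ) n →
  parity (sum (map (λ i → a i * c (n ∸ i)) (upTo (suc n)))) ≡ ((parity ∘ a) ⊗ (parity ∘ c)) n
parity-convolution a c n =
  trans (cong (parity ∘ sum) (map-applyUpTo id (λ i → a i * c (n ∸ i)) (suc n))) (go a n)
  where
  go : ∀ a n → parity (sum (applyUpTo (λ i → a i * c (n ∸ i)) (suc n))) ≡ ((parity ∘ a) ⊗ (parity ∘ c)) n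
  go a zero = trans (cong parity (+-identityʳ (a 0 * c 0))) (parity-* (a 0) (c 0))
  go a (suc n) = trans (parity-+ (a 0 * c (suc n)) _) (cong₂ _xor_ (parity-* (a 0) (c (suc n))) (go (a ∘ suc) n))

pow𝕢⊗-at : ∀ k f n → (pow 𝕢 k ⊗ f) n ≡ (if k ≤ᵇ n then f (n ∸ k) else false)
pow𝕢⊗-at zero f n = ⊗-identityˡ f n
pow𝕢⊗-at (suc k) f zero = refl
pow𝕢⊗-at (suc k) f (suc n) =
  trans (⊗-assoc 𝕢 (pow 𝕢 k) f (suc n))
    (trans (𝕢⊗-suc _ n) (trans (pow𝕢⊗-at k f n) (cong (λ b → if b then f (n ∸ k) else false) (≤ᵇ-suc k n))))
  where
  ≤ᵇ-suc : ∀ k n → (k ≤ᵇ n) ≡ (suc k ≤ᵇ suc n)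
  ≤ᵇ-suc zero n = refl
  ≤ᵇ-suc (suc k) n = refl

module Restricted (allowed : ℕ → Bool) where

  R : ℕ → Series
  R k n = parity (restrictedCount allowed k n)

  -- Each 1 + q^i belongs to `product` if the part i is allowed and to `coproduct` otherwise. From R
  -- · product = 1 and product · coproduct = euler follows R · euler = coproduct.
  factor cofactor : ℕ → Series
  factor i = if allowed i then 𝟙 ⊕ pow 𝕢 i else 𝟙
  cofactor i = if allowed i then 𝟙 else 𝟙 ⊕ pow 𝕢 i

  product coproduct : ℕ → Series
  product zero = 𝟙
  product (suc k) = product k ⊗ factor (suc k)
  coproduct zero = 𝟙
  coproduct (suc k) = coproduct k ⊗ cofactor (suc k)

  geometric : ∀ d r N → ∑ N (λ j → pow 𝕢 (j * d) ⊗ r) ⊗ (𝟙 ⊕ pow 𝕢 d) ≈ r ⊕ pow 𝕢 (N * d) ⊗ r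
  geometric d r zero = solve (`0 :* (`1 :+ v0)) (v1 :+ `1 :* v1) (pow 𝕢 d ∷ r ∷ []) refl
  geometric d r (suc N) =
    solveBy ((v0 :+ v1 :* v2) :* (`1 :+ v3)) (v2 :+ v4 :* v2)
      (∑ N (λ j → pow 𝕢 (j * d) ⊗ r) ∷ pow 𝕢 (N * d) ∷ r ∷ pow 𝕢 d ∷ pow 𝕢 (d + N * d) ∷ [])
      (([ `1 ]* v0 :* (`1 :+ v3) ≋ v2 :+ v1 :* v2 by geometric d r N)
      ∷ ([ v2 ]* v4 ≋ v3 :* v1 by pow-+ 𝕢 d (N * d)) ∷ []) refl

  -- The multiplicities of the part k + 1 form a geometric series. Below degree N its first N terms
  -- suffice, and 1 + q^(k+1) telescopes them.
  largest-part : ∀ k → allowed (suc k) ≡ true → R (suc k) ⊗ (𝟙 ⊕ pow 𝕢 (suc k)) ≈ R k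
  largest-part k ok = ≡[]⇒≈ λ N →
    ≡[]-trans (⊗-cong[] (agree N) (λ _ _ → refl))
      (≡[]-trans (≈⇒≡[] N (geometric (suc k) (R k) N))
        (≡[]-trans (⊕-congʳ[] (R k) (⊗-drop[] (m≤m*n N (suc k)))) (≈⇒≡[] N (⊕-identityʳ (R k)))))
    where
    h : ℕ → ℕ → ℕ
    h n j = if j * suc k ≤ᵇ n then restrictedCount allowed k (n ∸ j * suc k) else 0
    F : ℕ → Series
    F j = pow 𝕢 (j * suc k) ⊗ R k
    at : ∀ n j → parity (h n j) ≡ F j n
    at n j = trans (push (j * suc k ≤ᵇ n)) (sym (pow𝕢⊗-at (j * suc k) (R k) n))
      where
      push : ∀ b {x} → parity (if b then x else 0) ≡ (if b then parity x else false)
      push true = refl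
      push false = refl
    partial-sum : ∀ n m → parity (sum (map (h n) (upTo m))) ≡ ∑ m F n
    partial-sum n zero = refl
    partial-sum n (suc m) = trans (parity-sum (h n) m) (cong₂ _xor_ (partial-sum n m) (at n m))
    stable : ∀ n e → ∑ (e + suc n) F n ≡ ∑ (suc n) F n
    stable n zero = refl
    stable n (suc e) =
      trans (cong (∑ (e + suc n) F n xor_)
              (pow𝕢-low ((e + suc n) * suc k) (R k) n (≤-trans (m≤n+m (suc n) e) (m≤m*n _ (suc k)))))
        (trans (xor-identityʳ _) (stable n e))
    agree : ∀ N → R (suc k) ≡[ N ] ∑ N F
    agree N n l rewrite ok =
      trans (partial-sum n (suc n))
        (trans (sym (stable n (N ∸ suc n))) (cong (λ m → ∑ m F n) (m∸n+n≡m l)))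

  R-step : ∀ k → R (suc k) ⊗ factor (suc k) ≈ R k
  R-step k = go (allowed (suc k)) refl
    where
    go : ∀ b → allowed (suc k) ≡ b → R (suc k) ⊗ (if b then 𝟙 ⊕ pow 𝕢 (suc k) else 𝟙) ≈ R k
    go true eq = largest-part k eq
    go false eq = ≈-trans (⊗-identityʳ _) skip
      where
      skip : R (suc k) ≈ R k
      skip n rewrite eq = refl

  R-product : ∀ k → R k ⊗ product k ≈ 𝟙
  R-product zero = ≈-trans (⊗-identityʳ _) R₀
    where
    R₀ : R 0 ≈ 𝟙
    R₀ zero = refl
    R₀ (suc n) = refl
  R-product (suc k) =
    solveBy (v0 :* (v1 :* v2)) `1 (R (suc k) ∷ product k ∷ factor (suc k) ∷ R k ∷ [])
      (([ v1 ]* v0 :* v2 ≋ v3 by R-step k) ∷ ([ `1 ]* v3 :* v1 ≋ `1 by R-product k) ∷ []) refl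

  product-euler : ∀ k → product k ⊗ coproduct k ≈ euler k
  product-euler zero = ⊗-identityˡ 𝟙
  product-euler (suc k) =
    ≈-trans (⊗-interchange (product k) (factor (suc k)) (coproduct k) (cofactor (suc k)))
      (⊗-cong (product-euler k) (both (allowed (suc k))))
    where
    both : ∀ b → (if b then 𝟙 ⊕ pow 𝕢 (suc k) else 𝟙) ⊗ (if b then 𝟙 else 𝟙 ⊕ pow 𝕢 (suc k)) ≈ 𝟙 ⊕ pow 𝕢 (suc k)
    both true = ⊗-identityʳ _
    both false = ⊗-identityˡ _

  R-euler : ∀ k → R k ⊗ euler k ≈ coproduct k
  R-euler k = solveBy (v0 :* v1) v2 (R k ∷ euler k ∷ coproduct k ∷ product k ∷ [])
    (([ v0 ]* v3 :* v2 ≋ v1 by product-euler k) ∷ ([ v2 ]* v0 :* v3 ≋ `1 by R-product k) ∷ []) refl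

  R-stable : ∀ k → R (suc k) ≡[ suc k ] R k
  R-stable k = ≡[]-trans (≡[]-sym (unaffected (allowed (suc k)))) (≈⇒≡[] _ (R-step k))
    where
    unaffected : ∀ b → R (suc k) ⊗ (if b then 𝟙 ⊕ pow 𝕢 (suc k) else 𝟙) ≡[ suc k ] R (suc k)
    unaffected true = 1+pow-≡𝟙 (suc k) (R (suc k))
    unaffected false = ≈⇒≡[] _ (⊗-identityʳ _)

  count : Series
  count n = R n n

  R-≤ : ∀ m n → R (m + n) ≡[ suc n ] R n
  R-≤ zero n i l = refl
  R-≤ (suc m) n = ≡[]-trans (≡[]-weaken (s≤s (m≤n+m n m)) (R-stable (m + n))) (R-≤ m n)

  count≡R : ∀ n → count ≡[ suc n ] R n
  count≡R n i (s≤s l) = trans (sym (R-≤ (n ∸ i) i i ≤-refl)) (cong (λ k → R k i) (m∸n+n≡m l))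

  count-η : ∀ k → count ⊗ η ≡[ suc k ] coproduct k
  count-η k = ≡[]-trans (⊗-cong[] (count≡R k) (η≡euler k)) (≈⇒≡[] _ (R-euler k))

P : Series
P n = parity (p n)

P-inverse : P ⊗ η ≈ 𝟙
P-inverse = ≡[]⇒≈ λ n → ≡[]-trans (≡[]-weaken (n≤1+n n) (count-η n)) (≈⇒≡[] n (trivial n))
  where
  open Restricted (λ _ → true)
  trivial : ∀ k → coproduct k ≈ 𝟙
  trivial zero = ≈-refl
  trivial (suc k) = ≈-trans (⊗-identityʳ _) (trivial k)

parity-pm : ∀ t n → parity (pm t n) ≡ pow P t n
parity-pm zero zero = refl
parity-pm zero (suc n) = refl
parity-pm (suc t) n =
  trans (parity-convolution p (pm t) n) (⊗-congˡ {P} {parity ∘ pm t} {pow P t} (parity-pm t) n)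

-- The forbidden parts are the multiples of m + 1, so the coproduct up to n(m + 1) is the stretched
-- `euler n`.
regular-η : ∀ m → (parity ∘ b (suc m)) ⊗ η ≈ 𝕍 m η
regular-η m = ≡[]⇒≈ λ n →
  ≡[]-trans (≡[]-weaken (≤-trans (m≤m*n n (suc m)) (n≤1+n _)) (count-η (n * suc m)))
    (≡[]-trans (≈⇒≡[] n (blocks n))
      (𝕍-cong[] m (≡[]-sym (≡[]-weaken (n≤1+n n) (η≡euler n)))))
  where
  open Restricted (λ i → not ⌊ suc m ∣? i ⌋)
  cofactor-at : ∀ i {d} → ⌊ suc m ∣? i ⌋ ≡ d → cofactor i ≈ (if not d then 𝟙 else 𝟙 ⊕ pow 𝕢 i)
  cofactor-at i eq n = cong (λ d → (if not d then 𝟙 else 𝟙 ⊕ pow 𝕢 i) n) eq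
  multiple : ∀ j → cofactor (suc j * suc m) ≈ 𝟙 ⊕ pow 𝕢 (suc j * suc m)
  multiple j = cofactor-at (suc j * suc m)
    (trans (isYes≗does (suc m ∣? (suc j * suc m))) (dec-true (suc m ∣? (suc j * suc m)) (n∣m*n (suc j))))
  nonmultiple : ∀ j r → r < m → cofactor (suc r + j * suc m) ≈ 𝟙
  nonmultiple j r r<m = cofactor-at (suc r + j * suc m)
    (trans (isYes≗does (suc m ∣? (suc r + j * suc m)))
      (dec-false (suc m ∣? (suc r + j * suc m))
        (λ d → <⇒≱ (s≤s r<m) (∣⇒≤ (∣m+n∣m⇒∣n (subst (suc m ∣_) (+-comm (suc r) (j * suc m)) d) (n∣m*n j))))))
  within : ∀ j r → r ≤ m → coproduct (r + j * suc m) ≈ coproduct (j * suc m)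
  within j zero _ = ≈-refl
  within j (suc r) l =
    ≈-trans (⊗-cong (within j r (≤-trans (n≤1+n r) l)) (nonmultiple j r l)) (⊗-identityʳ _)
  blocks : ∀ j → coproduct (j * suc m) ≈ 𝕍 m (euler j)
  blocks zero = ≈-sym (𝕍-𝟙 m)
  blocks (suc j) =
    ≈-trans (⊗-cong (≈-trans (within j m ≤-refl) (blocks j)) (multiple j))
      (≈-sym (≈-trans (𝕍-⊗ m (euler j) (𝟙 ⊕ pow 𝕢 (suc j)))
        (⊗-congˡ (≈-trans (𝕍-⊕ m 𝟙 (pow 𝕢 (suc j))) (⊕-cong (𝕍-𝟙 m) (𝕍-pow𝕢 m (suc j)))))))

parity-b : ∀ m n → parity (b (suc m) n) ≡ (𝕍 m η ⊗ P) n
parity-b m = solveBy v0 (v1 :* v2) (parity ∘ b (suc m) ∷ 𝕍 m η ∷ P ∷ η ∷ [])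
  (([ v2 ]* v0 :* v3 ≋ v1 by regular-η m) ∷ ([ v0 ]* v2 :* v3 ≋ `1 by P-inverse) ∷ []) refl

-- Conjugates under roots of unity and the sum of the roots

𝕌 : ℕ → Series → Series
𝕌 k x m = x (m * suc k)

xsum : ℕ → (ℕ → Bool) → Bool
xsum zero h = false
xsum (suc n) h = xsum n h xor h n

xsum-cong : ∀ n {g h : ℕ → Bool} → (∀ i → g i ≡ h i) → xsum n g ≡ xsum n h
xsum-cong zero p = refl
xsum-cong (suc n) p = cong₂ _xor_ (xsum-cong n p) (p n)

xsum-xor : ∀ n (g h : ℕ → Bool) → xsum n (λ i → g i xor h i) ≡ xsum n g xor xsum n h
xsum-xor zero g h = refl
xsum-xor (suc n) g h =
  trans (cong (_xor (g n xor h n)) (xsum-xor n g h)) (xor-interchange (xsum n g) (xsum n h) (g n) (h n))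

xsum-∧ : ∀ n b (h : ℕ → Bool) → xsum n (λ i → b ∧ h i) ≡ b ∧ xsum n h
xsum-∧ zero b h = sym (∧-zeroʳ b)
xsum-∧ (suc n) b h = trans (cong (_xor (b ∧ h n)) (xsum-∧ n b h)) (sym (∧-distribˡ-xor b (xsum n h) (h n)))

xsum-false : ∀ n {h : ℕ → Bool} → (∀ i → h i ≡ false) → xsum n h ≡ false
xsum-false zero p = refl
xsum-false (suc n) p = trans (cong₂ _xor_ (xsum-false n p) (p n)) refl

xsum-const : ∀ n b → xsum n (λ _ → b) ≡ parity n ∧ b
xsum-const zero b = refl
xsum-const (suc n) b = trans (cong (_xor b) (xsum-const n b)) (go (parity n) b)
  where
  go : ∀ a b → (a ∧ b) xor b ≡ not a ∧ b
  go false b = refl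
  go true b = xor-same b

xsum-swap : ∀ m n (h : ℕ → ℕ → Bool) → xsum m (λ i → xsum n (h i)) ≡ xsum n (λ j → xsum m (λ i → h i j))
xsum-swap zero n h = sym (xsum-false n (λ _ → refl))
xsum-swap (suc m) n h =
  trans (cong (_xor xsum n (h m)) (xsum-swap m n h)) (sym (xsum-xor n (λ j → xsum m (λ i → h i j)) (h m)))

-- The action of 1 + ζ^c + ... + ζ^((n-1)c), where ζ shifts the argument by one.
window : ℕ → ℕ → (ℕ → Bool) → ℕ → Bool
window n c v k = xsum n (λ i → v (k + i * c))

window-slide : ∀ n c v k → window n c v (k + c) xor window n c v k ≡ v (k + n * c) xor v k
window-slide zero c v k rewrite +-identityʳ k = sym (xor-same (v k))
window-slide (suc n) c v k = begin
  (window n c v (k + c) xor v (k + c + n * c)) xor (window n c v k xor v (k + n * c))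
    ≡⟨ xor-interchange (window n c v (k + c)) (v (k + c + n * c)) (window n c v k) (v (k + n * c)) ⟩
  (window n c v (k + c) xor window n c v k) xor (v (k + c + n * c) xor v (k + n * c))
    ≡⟨ cong₂ _xor_ (window-slide n c v k) (cong (λ j → v j xor v (k + n * c)) (+-assoc k c (n * c))) ⟩
  (v (k + n * c) xor v k) xor (v (k + suc n * c) xor v (k + n * c))
    ≡⟨ cancel (v (k + n * c)) (v k) (v (k + suc n * c)) ⟩
  v (k + suc n * c) xor v k ∎
  where
  open ≡-Reasoning
  cancel : ∀ a b c → (a xor b) xor (c xor a) ≡ c xor b
  cancel false false false = refl
  cancel false false true = refl
  cancel false true false = refl
  cancel false true true = refl
  cancel true false false = refl
  cancel true false true = refl
  cancel true true false = refl
  cancel true true true = refl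

xor≡false⇒≡ : ∀ {a b} → a xor b ≡ false → a ≡ b
xor≡false⇒≡ {false} {false} _ = refl
xor≡false⇒≡ {true} {true} _ = refl

Invariant : (ℕ → Bool) → ℕ → Set
Invariant v d = ∀ k → v (k + d) ≡ v k

invariant-* : ∀ {v d} → Invariant v d → ∀ a → Invariant v (a * d)
invariant-* {v} p zero k = cong v (+-identityʳ k)
invariant-* {v} {d} p (suc a) k =
  trans (cong v (sym (+-assoc k d (a * d)))) (trans (invariant-* p a (k + d)) (p k))

-- By Bézout, e is an integer combination of a e and n e; the two cases are the two choices of
-- signs, written without subtraction.
invariant-coprime : ∀ {v a n e} → Coprime a n → Invariant v (a * e) → Invariant v n → Invariant v e
invariant-coprime {v} {a} {n} {e} co pa pn k with coprime-Bézout co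
... | Bézout.+- x y eq = begin
  v (k + e)              ≡⟨ invariant-* pn (y * e) (k + e) ⟨
  v (k + e + y * e * n)  ≡⟨ cong v (shuffle k e y n) ⟩
  v (k + (1 + y * n) * e) ≡⟨ cong (λ z → v (k + z * e)) eq ⟩
  v (k + x * a * e)      ≡⟨ cong (λ z → v (k + z)) (*-assoc x a e) ⟩
  v (k + x * (a * e))    ≡⟨ invariant-* pa x k ⟩
  v k                    ∎
  where
  open ≡-Reasoning
  shuffle : ∀ k e y n → k + e + y * e * n ≡ k + (1 + y * n) * e
  shuffle = solve-∀
... | Bézout.-+ x y eq = begin
  v (k + e)                  ≡⟨ invariant-* pa x (k + e) ⟨
  v (k + e + x * (a * e))    ≡⟨ cong v (shuffle k e x a) ⟩
  v (k + (1 + x * a) * e)    ≡⟨ cong (λ z → v (k + z * e)) eq ⟩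
  v (k + y * n * e)          ≡⟨ cong v (shuffle′ k y n e) ⟩
  v (k + y * e * n)          ≡⟨ invariant-* pn (y * e) k ⟩
  v k                        ∎
  where
  open ≡-Reasoning
  shuffle : ∀ k e x a → k + e + x * (a * e) ≡ k + (1 + x * a) * e
  shuffle = solve-∀
  shuffle′ : ∀ k y n e → k + y * n * e ≡ k + y * e * n
  shuffle′ = solve-∀

-- The coefficient of t^m ζ^k; a root of unity ζ acts by shifting k.
Twisted : Set
Twisted = ℕ → ℕ → Bool

infix 4 _∼_
infixl 6 _⊹_

_∼_ : Twisted → Twisted → Set
v ∼ w = ∀ m k → v m k ≡ w m k

_⊹_ : Twisted → Twisted → Twisted
(v ⊹ w) m k = v m k xor w m k

𝟎 : Twisted
𝟎 _ _ = false

-- Multiplication by x(ζ^i t).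
act : ℕ → Series → Twisted → Twisted
act i x w zero k = x 0 ∧ w 0 k
act i x w (suc m) k = (x 0 ∧ w (suc m) k) xor act i (tl x) w m (k + i)

act-cong : ∀ i x {v w} → v ∼ w → act i x v ∼ act i x w
act-cong i x p zero k = cong (x 0 ∧_) (p 0 k)
act-cong i x p (suc m) k = cong₂ _xor_ (cong (x 0 ∧_) (p (suc m) k)) (act-cong i (tl x) p m (k + i))

act-congˢ : ∀ i {x y} w → x ≈ y → act i x w ∼ act i y w
act-congˢ i w p zero k = cong (_∧ w 0 k) (p 0)
act-congˢ i w p (suc m) k =
  cong₂ _xor_ (cong (_∧ w (suc m) k) (p 0)) (act-congˢ i w (p ∘ suc) m (k + i))

act-⊕ : ∀ i x y w → act i (x ⊕ y) w ∼ act i x w ⊹ act i y w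
act-⊕ i x y w zero k = ∧-distribʳ-xor (w 0 k) (x 0) (y 0)
act-⊕ i x y w (suc m) k =
  trans (cong₂ _xor_ (∧-distribʳ-xor (w (suc m) k) (x 0) (y 0)) (act-⊕ i (tl x) (tl y) w m (k + i)))
    (xor-interchange (x 0 ∧ w (suc m) k) (y 0 ∧ w (suc m) k) _ _)

act-⊹ : ∀ i x v w → act i x (v ⊹ w) ∼ act i x v ⊹ act i x w
act-⊹ i x v w zero k = ∧-distribˡ-xor (x 0) (v 0 k) (w 0 k)
act-⊹ i x v w (suc m) k =
  trans (cong₂ _xor_ (∧-distribˡ-xor (x 0) (v (suc m) k) (w (suc m) k)) (act-⊹ i (tl x) v w m (k + i)))
    (xor-interchange (x 0 ∧ v (suc m) k) (x 0 ∧ w (suc m) k) _ _)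

act-• : ∀ i b x w m k → act i (b • x) w m k ≡ b ∧ act i x w m k
act-• i b x w zero k = ∧-assoc b (x 0) (w 0 k)
act-• i b x w (suc m) k =
  trans (cong₂ _xor_ (∧-assoc b (x 0) (w (suc m) k)) (act-• i b (tl x) w m (k + i)))
    (sym (∧-distribˡ-xor b (x 0 ∧ w (suc m) k) _))

act-⊗ : ∀ i x y w → act i (x ⊗ y) w ∼ act i x (act i y w)
act-⊗ i x y w zero k = ∧-assoc (x 0) (y 0) (w 0 k)
act-⊗ i x y w (suc m) k = begin
  ((x 0 ∧ y 0) ∧ w (suc m) k) xor act i (x 0 • tl y ⊕ tl x ⊗ y) w m (k + i)
    ≡⟨ cong₂ _xor_ (∧-assoc (x 0) (y 0) (w (suc m) k))
         (trans (act-⊕ i (x 0 • tl y) (tl x ⊗ y) w m (k + i))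
           (cong₂ _xor_ (act-• i (x 0) (tl y) w m (k + i)) (act-⊗ i (tl x) y w m (k + i)))) ⟩
  (x 0 ∧ r) xor ((x 0 ∧ s) xor t)
    ≡⟨ xor-assoc (x 0 ∧ r) (x 0 ∧ s) t ⟨
  ((x 0 ∧ r) xor (x 0 ∧ s)) xor t
    ≡⟨ cong (_xor t) (∧-distribˡ-xor (x 0) r s) ⟨
  (x 0 ∧ (r xor s)) xor t ∎
  where
  open ≡-Reasoning
  r = y 0 ∧ w (suc m) k
  s = act i (tl y) w m (k + i)
  t = act i (tl x) (act i y w) m (k + i)

act-𝟙 : ∀ i w → act i 𝟙 w ∼ w
act-𝟘 : ∀ i w → act i 𝟘 w ∼ 𝟎
act-𝟘 i w zero k = refl
act-𝟘 i w (suc m) k = act-𝟘 i w m (k + i)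
act-𝟙 i w zero k = refl
act-𝟙 i w (suc m) k = trans (cong (w (suc m) k xor_) (act-𝟘 i w m (k + i))) (xor-identityʳ _)

raise : ℕ → Twisted → Twisted
raise i w zero k = false
raise i w (suc m) k = w m (k + i)

act-raise : ∀ i j y w → act j y (raise i w) ∼ raise i (act j y w)
act-raise i j y w zero k = ∧-zeroʳ (y 0)
act-raise i j y w (suc zero) k =
  trans (cong ((y 0 ∧ w 0 (k + i)) xor_) (∧-zeroʳ (y 1))) (xor-identityʳ _)
act-raise i j y w (suc (suc m)) k =
  cong ((y 0 ∧ w (suc m) (k + i)) xor_)
    (trans (act-raise i j (tl y) w (suc m) (k + j))
      (cong (act j (tl y) w m) (trans (+-assoc k j i) (trans (cong (k +_) (+-comm j i)) (sym (+-assoc k i j))))))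

∧-swap : ∀ a b c → a ∧ (b ∧ c) ≡ b ∧ (a ∧ c)
∧-swap false b c = sym (∧-zeroʳ b)
∧-swap true b c = refl

act-comm : ∀ i x j y w → act i x (act j y w) ∼ act j y (act i x w)
act-comm i x j y w m k = sym (trans (act-cong j y (expand x) m k)
  (trans (act-⊹ j y (λ m k → x 0 ∧ w m k) (raise i (act i (tl x) w)) m k)
    (trans (cong₂ _xor_ (scalar (x 0) y w m k) (act-raise i j y (act i (tl x) w) m k)) (go m k))))
  where
  expand : ∀ x → act i x w ∼ (λ m k → x 0 ∧ w m k) ⊹ raise i (act i (tl x) w)
  expand x zero k = sym (xor-identityʳ _)
  expand x (suc m) k = refl
  scalar : ∀ b y w m k → act j y (λ m k → b ∧ w m k) m k ≡ b ∧ act j y w m k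
  scalar b y w zero k = ∧-swap (y 0) b (w 0 k)
  scalar b y w (suc m) k =
    trans (cong₂ _xor_ (∧-swap (y 0) b (w (suc m) k)) (scalar b (tl y) w m (k + j)))
      (sym (∧-distribˡ-xor b (y 0 ∧ w (suc m) k) _))
  go : ∀ m k → (x 0 ∧ act j y w m k) xor raise i (act j y (act i (tl x) w)) m k ≡ act i x (act j y w) m k
  go zero k = xor-identityʳ _
  go (suc m) k = cong ((x 0 ∧ act j y w (suc m) k) xor_) (sym (act-comm i (tl x) j y w m (k + i)))

act-shift : ∀ i x w l m k → act i x (λ m k → w m (k + l)) m k ≡ act i x w m (k + l)
act-shift i x w l zero k = refl
act-shift i x w l (suc m) k =
  cong ((x 0 ∧ w (suc m) (k + l)) xor_)
    (trans (act-shift i (tl x) w l m (k + i))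
      (cong (act i (tl x) w m) (trans (+-assoc k i l) (trans (cong (k +_) (+-comm i l)) (sym (+-assoc k l i))))))

act-xsum : ∀ i x n (F : ℕ → Twisted) m k →
  act i x (λ m k → xsum n (λ l → F l m k)) m k ≡ xsum n (λ l → act i x (F l) m k)
act-xsum i x zero F m k = zeros x m k
  where
  zeros : ∀ x m k → act i x 𝟎 m k ≡ false
  zeros x zero k = ∧-zeroʳ (x 0)
  zeros x (suc m) k = trans (cong₂ _xor_ (∧-zeroʳ (x 0)) (zeros (tl x) m (k + i))) refl
act-xsum i x (suc n) F m k =
  trans (act-⊹ i x (λ m k → xsum n (λ l → F l m k)) (F n) m k)
    (cong (_xor act i x (F n) m k) (act-xsum i x n F m k))

act-𝟎 : ∀ i x → act i x 𝟎 ∼ 𝟎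
act-𝟎 i x = act-xsum i x 0 (λ _ → 𝟎)

act-low : ∀ i x w m → (∀ m′ → m′ ≤ m → ∀ k → w m′ k ≡ false) → ∀ k → act i x w m k ≡ false
act-low i x w zero z k = trans (cong (x 0 ∧_) (z 0 z≤n k)) (∧-zeroʳ (x 0))
act-low i x w (suc m) z k =
  cong₂ _xor_ (trans (cong (x 0 ∧_) (z (suc m) ≤-refl k)) (∧-zeroʳ (x 0)))
    (act-low i (tl x) w m (λ m′ l → z m′ (m≤n⇒m≤1+n l)) (k + i))

-- The leading coefficient of x(ζ^i t) is ζ^(di), so the lowest coefficient of w comes back shifted
-- by d i. Roots will be separated by comparing these shifts.
act-lead : ∀ i d x w m → (∀ e → e < d → x e ≡ false) → x d ≡ true →
  (∀ m′ → m′ < m → ∀ k → w m′ k ≡ false) → ∀ k → act i x w (d + m) k ≡ w m (k + d * i)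
act-lead i zero x w zero lo hi z k rewrite hi | +-identityʳ k = refl
act-lead i zero x w (suc m) lo hi z k rewrite hi | +-identityʳ k =
  trans (cong (w (suc m) k xor_) (act-low i (tl x) w m (λ m′ l → z m′ (s≤s l)) (k + i))) (xor-identityʳ _)
act-lead i (suc d) x w m lo hi z k rewrite lo 0 (s≤s z≤n) =
  trans (act-lead i d (tl x) w m (λ e l → lo (suc e) (s≤s l)) hi z (k + i)) (cong (w m) (+-assoc k i (d * i)))

monic : List Series → Series → Series
monic [] x = 𝟙
monic (c ∷ cs) x = x ⊗ monic cs x ⊕ c

-- As coefficients are listed from the constant term upwards, this one stands just below the leading
-- 1: over 𝔽₂ it is the sum of the roots.
last : Series → List Series → Series
last c [] = c
last c (c′ ∷ cs) = last c′ cs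

module Trace (n′ : ℕ) (prime : Prime (suc n′)) (odd : parity (suc n′) ≡ true) (2≤n : 2 ≤ suc n′) where

  n : ℕ
  n = suc n′

  -- Annihilated by 1 + ζ + … + ζ^(n-1).
  Balanced : Twisted → Set
  Balanced w = ∀ m k → window n 1 (w m) k ≡ false

  balanced-act : ∀ i x w → Balanced w → Balanced (act i x w)
  balanced-act i x w bw m k =
    trans (xsum-cong n (λ l → sym (act-shift i x w (l * 1) m k)))
      (trans (sym (act-xsum i x n (λ l m k → w m (k + l * 1)) m k))
        (trans (act-cong i x bw m k) (act-𝟎 i x m k)))

  periodic : ∀ {v} → (∀ k → window n 1 v k ≡ false) → Invariant v n
  periodic {v} z k =
    trans (cong (λ d → v (k + d)) (sym (*-identityʳ n)))
      (xor≡false⇒≡ (trans (sym (window-slide n 1 v k)) (cong₂ _xor_ (z (k + 1)) (z k))))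

  periodic-* : ∀ v → (∀ k → window n 1 v k ≡ false) → ∀ a k → v (k + a * n) ≡ v k
  periodic-* v z a k = invariant-* {v} (periodic z) a k

  -- For constant v the window is n v, and n is odd.
  constant-vanishes : ∀ {v} → (∀ k → window n 1 v k ≡ false) → Invariant v 1 → ∀ k → v k ≡ false
  constant-vanishes {v} z inv k = begin
    v k                 ≡⟨ cong (_∧ v k) odd ⟨
    parity n ∧ v k      ≡⟨ xsum-const n (v k) ⟨
    xsum n (λ _ → v k)  ≡⟨ xsum-cong n (λ i → sym (invariant-* inv i k)) ⟩
    window n 1 v k      ≡⟨ z k ⟩
    false               ∎
    where open ≡-Reasoning

  coprime-vanishes : ∀ {v d} → Coprime d n → (∀ k → window n 1 v k ≡ false) → Invariant v d → ∀ k → v k ≡ false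
  coprime-vanishes {v} {d} co z inv =
    constant-vanishes z
      (invariant-coprime co (λ k → trans (cong (λ e → v (k + e)) (*-identityʳ d)) (inv k)) (periodic z))

  Root : Set
  Root = ℕ × Series

  ⟨_⟩ : Root → Twisted → Twisted
  ⟨ i , x ⟩ = act i x

  -- Expresses that r - s is no zero divisor. Over 𝔽₂ the polynomial 1 + ζ + ... + ζ^(n-1) may
  -- factor, so it is not enough for the roots to be distinct.
  Separated : Root → Root → Set
  Separated r s = ∀ w → Balanced w → ⟨ r ⟩ w ∼ ⟨ s ⟩ w → w ∼ 𝟎

  -- Dividing out a root produces coefficients that are polynomials in several conjugates, no longer
  -- a single twisted series. They are kept as additive operators that commute with every `act` and
  -- preserve `Balanced`.
  record Op : Set where
    field
      fn : Twisted → Twisted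
      fn-cong : ∀ {v w} → v ∼ w → fn v ∼ fn w
      fn-⊹ : ∀ v w → fn (v ⊹ w) ∼ fn v ⊹ fn w
      fn-act : ∀ i x w → fn (act i x w) ∼ act i x (fn w)
      fn-balanced : ∀ w → Balanced w → Balanced (fn w)
  open Op

  actOp : Root → Op
  actOp (i , x) = record
    { fn = act i x
    ; fn-cong = act-cong i x
    ; fn-⊹ = act-⊹ i x
    ; fn-act = λ j y w → act-comm i x j y w
    ; fn-balanced = balanced-act i x
    }

  balanced-⊹ : ∀ v w → Balanced v → Balanced w → Balanced (v ⊹ w)
  balanced-⊹ v w bv bw m k =
    trans (xsum-xor n (λ i → v m (k + i * 1)) (λ i → w m (k + i * 1))) (cong₂ _xor_ (bv m k) (bw m k))

  -- Monic polynomials, from the constant term upwards.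
  ev : List Op → Root → Twisted → Twisted
  ev [] r w = w
  ev (c ∷ cs) r w = ⟨ r ⟩ (ev cs r w) ⊹ fn c w

  evOp : List Op → Root → Op
  evOp [] r = record { fn = id ; fn-cong = id ; fn-⊹ = λ _ _ _ _ → refl ; fn-act = λ _ _ _ _ _ → refl ; fn-balanced = λ _ → id }
  evOp (c ∷ cs) r@(i , x) = record
    { fn = λ w → act i x (fn e w) ⊹ fn c w
    ; fn-cong = λ p m k → cong₂ _xor_ (act-cong i x (fn-cong e p) m k) (fn-cong c p m k)
    ; fn-⊹ = λ v w m k →
        trans (cong₂ _xor_ (trans (act-cong i x (fn-⊹ e v w) m k) (act-⊹ i x (fn e v) (fn e w) m k)) (fn-⊹ c v w m k))
          (xor-interchange (act i x (fn e v) m k) (act i x (fn e w) m k) (fn c v m k) (fn c w m k))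
    ; fn-act = λ j y w m k →
        trans (cong₂ _xor_ (trans (act-cong i x (fn-act e j y w) m k) (act-comm i x j y (fn e w) m k)) (fn-act c j y w m k))
          (sym (act-⊹ j y (act i x (fn e w)) (fn c w) m k))
    ; fn-balanced = λ w bw → balanced-⊹ (act i x (fn e w)) (fn c w)
        (balanced-act i x (fn e w) (fn-balanced e w bw)) (fn-balanced c w bw)
    }
    where e = evOp cs r

  evOp-ev : ∀ cs r w → fn (evOp cs r) w ∼ ev cs r w
  evOp-ev [] r w m k = refl
  evOp-ev (c ∷ cs) (i , x) w m k = cong (_xor fn c w m k) (act-cong i x (evOp-ev cs (i , x) w) m k)

  ev-balanced : ∀ cs r w → Balanced w → Balanced (ev cs r w)
  ev-balanced [] r w bw = bw
  ev-balanced (c ∷ cs) (i , x) w bw = balanced-⊹ (act i x (ev cs (i , x) w)) (fn c w)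
    (balanced-act i x (ev cs (i , x) w) (ev-balanced cs (i , x) w bw)) (fn-balanced c w bw)

  -- Horner's scheme: the coefficients of the quotient by x - r are the values at r of the truncated
  -- polynomials.
  quotient : Root → Op → List Op → List Op
  quotient r c [] = []
  quotient r c (c′ ∷ cs) = evOp (c′ ∷ cs) r ∷ quotient r c′ cs

  division : ∀ c cs r s w →
    ev (c ∷ cs) r w ∼ (⟨ r ⟩ (ev (quotient s c cs) r w) ⊹ ⟨ s ⟩ (ev (quotient s c cs) r w)) ⊹ ev (c ∷ cs) s w
  division c [] r s w m k = lemma (⟨ r ⟩ w m k) (⟨ s ⟩ w m k) (fn c w m k)
    where
    lemma : ∀ a b c → a xor c ≡ (a xor b) xor (b xor c)
    lemma a b c = trans (cong (a xor_) (trans (cong (_xor c) (sym (xor-same b))) (xor-assoc b b c)))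
                    (sym (xor-assoc a b (b xor c)))
  division c (c′ ∷ cs) r@(i , x) s@(j , y) w m k = begin
    act i x (ev (c′ ∷ cs) r w) m k xor C
      ≡⟨ cong (_xor C) (trans (act-cong i x (division c′ cs r s w) m k)
           (trans (act-⊹ i x _ e₀ m k) (cong (_xor act i x e₀ m k) (act-⊹ i x _ _ m k)))) ⟩
    ((act i x (act i x q) m k xor act i x (act j y q) m k) xor act i x e₀ m k) xor C
      ≡⟨ cong (λ z → ((act i x (act i x q) m k xor z) xor act i x e₀ m k) xor C) (act-comm i x j y q m k) ⟩
    ((A xor B) xor D) xor C
      ≡⟨ rearrange A B D E C ⟩
    ((A xor D) xor (B xor E)) xor (E xor C)
      ≡⟨ cong (_xor (E xor C)) (cong₂ _xor_
           (trans (cong (A xor_) (act-cong i x (λ m k → sym (evOp-ev (c′ ∷ cs) s w m k)) m k)) (sym (act-⊹ i x _ _ m k)))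
           (trans (cong (B xor_) (act-cong j y (λ m k → sym (evOp-ev (c′ ∷ cs) s w m k)) m k)) (sym (act-⊹ j y _ _ m k)))) ⟩
    (act i x Q m k xor act j y Q m k) xor ev (c ∷ c′ ∷ cs) s w m k ∎
    where
    open ≡-Reasoning
    q = ev (quotient s c′ cs) r w
    e₀ = ev (c′ ∷ cs) s w
    Q = ev (quotient s c (c′ ∷ cs)) r w
    A = act i x (act i x q) m k
    B = act j y (act i x q) m k
    C = fn c w m k
    D = act i x e₀ m k
    E = act j y e₀ m k
    rearrange : ∀ a b d e c → ((a xor b) xor d) xor c ≡ ((a xor d) xor (b xor e)) xor (e xor c)
    rearrange a b d false c = cong (_xor c) (trans (xor-assoc a b d) (trans (cong (a xor_) (xor-comm b d)) (trans (sym (xor-assoc a d b)) (cong ((a xor d) xor_) (sym (xor-identityʳ b))))))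
    rearrange a b d true c = go a b d c
      where
      go : ∀ a b d c → ((a xor b) xor d) xor c ≡ ((a xor d) xor (b xor true)) xor not c
      go false false false c = sym (not-involutive c)
      go false false true c = refl
      go false true false c = refl
      go false true true c = sym (not-involutive c)
      go true false false c = refl
      go true false true c = sym (not-involutive c)
      go true true false c = sym (not-involutive c)
      go true true true c = refl

  top : Op → List Op → Op
  top c [] = c
  top c (c′ ∷ cs) = top c′ cs

  rootSum : List Root → Twisted → Twisted
  rootSum [] w = 𝟎
  rootSum (r ∷ rs) w = ⟨ r ⟩ w ⊹ rootSum rs w

  top-quotient : ∀ r c cs w →
    fn (top (evOp (c ∷ cs) r) (quotient r c cs)) w ∼ ⟨ r ⟩ w ⊹ fn (top c cs) w
  top-quotient (i , x) c [] w m k = refl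
  top-quotient r c (c′ ∷ cs) w = top-quotient r c′ cs w

  Vanishes : Op → List Op → Root → Set
  Vanishes c cs r = ∀ w → Balanced w → ev (c ∷ cs) r w ∼ 𝟎

  length-quotient : ∀ r c cs → length (quotient r c cs) ≡ length cs
  length-quotient r c [] = refl
  length-quotient r c (c′ ∷ cs) = cong suc (length-quotient r c′ cs)

  -- Vieta by induction on the degree. One root is divided out, the others annihilate the quotient
  -- because each is separated from the removed root, and the second coefficient changes by that
  -- root.
  roots-sum : ∀ c cs r rs → length rs ≡ length cs → All (Vanishes c cs) (r ∷ rs) →
    AllPairs Separated (r ∷ rs) → ∀ w → Balanced w → rootSum (r ∷ rs) w ∼ fn (top c cs) w
  roots-sum c [] r [] _ (v ∷ []) _ w bw m k =
    trans (xor-identityʳ (⟨ r ⟩ w m k)) (xor≡false⇒≡ {⟨ r ⟩ w m k} (v w bw m k))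
  roots-sum c (c′ ∷ cs) r (r′ ∷ rs) len (v ∷ vs) (sep ∷ seps) w bw m k =
    trans (cong (⟨ r ⟩ w m k xor_)
            (roots-sum (evOp (c′ ∷ cs) r) (quotient r c′ cs) r′ rs
              (trans (suc-injective len) (sym (length-quotient r c′ cs)))
              (All.zipWith (λ {s} p → vanishes s p) (sep , vs)) seps w bw m k))
      (trans (cong (⟨ r ⟩ w m k xor_) (top-quotient r c′ cs w m k))
        (trans (sym (xor-assoc (⟨ r ⟩ w m k) (⟨ r ⟩ w m k) (fn (top c′ cs) w m k)))
          (cong (_xor fn (top c′ cs) w m k) (xor-same (⟨ r ⟩ w m k)))))
    where
    vanishes : ∀ s → Separated r s × Vanishes c (c′ ∷ cs) s → Vanishes (evOp (c′ ∷ cs) r) (quotient r c′ cs) s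
    vanishes s (sp , vn) w bw =
      sp (ev (quotient r c (c′ ∷ cs)) s w) (ev-balanced (quotient r c (c′ ∷ cs)) s w bw) equal
      where
      equal : ⟨ r ⟩ (ev (quotient r c (c′ ∷ cs)) s w) ∼ ⟨ s ⟩ (ev (quotient r c (c′ ∷ cs)) s w)
      E : Twisted
      E = ev (quotient r c (c′ ∷ cs)) s w
      equal m k = sym (xor≡false⇒≡ {⟨ s ⟩ E m k} {⟨ r ⟩ E m k}
        (trans (sym (xor-identityʳ (⟨ s ⟩ E m k xor ⟨ r ⟩ E m k)))
          (trans (cong ((⟨ s ⟩ E m k xor ⟨ r ⟩ E m k) xor_) (sym (v w bw m k)))
            (trans (sym (division c (c′ ∷ cs) s r w m k)) (vn w bw m k)))))

  coprime-of-∤ : ∀ {c} → ¬ (n ∣ c) → Coprime c n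
  coprime-of-∤ n∤c (d∣c , d∣n) with prime⇒irreducible prime d∣n
  ... | inj₁ d≡1 = d≡1
  ... | inj₂ refl = ⊥-elim (n∤c d∣c)

  -- The character sum ∑ ζ^(ic). It equals n = 1 if n divides c; otherwise it is invariant under ζ^c
  -- with c prime to n, and so kills balanced elements.
  window-stride : ∀ c {v} → (∀ k → window n 1 v k ≡ false) → ∀ k →
    window n c v k ≡ (if does (n ∣? c) then v k else false)
  window-stride c {v} z k = go c (n ∣? c)
   where
   go : ∀ c (d : Dec (n ∣ c)) → window n c v k ≡ (if does d then v k else false)
   go c (yes (divides a refl)) =
    trans (xsum-cong n (λ i → trans (cong (λ e → v (k + e)) (sym (*-assoc i a n))) (periodic-* v z (i * a) k)))
      (trans (xsum-const n (v k)) (cong (_∧ v k) odd))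
   go c (no n∤c) = coprime-vanishes {window n c v} {c} (coprime-of-∤ n∤c) σ-window σ-invariant k
    where
    σ-window : ∀ k → window n 1 (window n c v) k ≡ false
    σ-window k =
      trans (xsum-swap n n (λ l i → v (k + l * 1 + i * c)))
        (xsum-false n (λ i → trans (xsum-cong n (λ l → cong v (shuffle k (l * 1) (i * c)))) (z (k + i * c))))
      where
      shuffle : ∀ a b c → a + b + c ≡ a + c + b
      shuffle = solve-∀
    σ-invariant : Invariant (window n c v) c
    σ-invariant k = xor≡false⇒≡
      (trans (window-slide n c v k)
        (trans (cong (_xor v k) (trans (cong (λ e → v (k + e)) (*-comm n c)) (periodic-* v z c k)))
          (xor-same (v k))))

  mask : ℕ → Series → Series
  mask c x j = if does (n ∣? (c + j)) then x j else false

  mask-head : ∀ c x β → x 0 ∧ (if does (n ∣? c) then β else false) ≡ mask c x 0 ∧ β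
  mask-head c x β rewrite +-identityʳ c with does (n ∣? c)
  ... | true = refl
  ... | false = ∧-zeroʳ (x 0)

  -- The weight ζ^(ic) serves the induction: removing the head of x multiplies the i-th conjugate by
  -- a further ζ^i.
  conjugate-sum : ∀ c x w → Balanced w → ∀ m k →
    xsum n (λ i → act i x w m (k + i * c)) ≡ act 0 (mask c x) w m k
  conjugate-sum c x w bw zero k =
    trans (xsum-∧ n (x 0) (λ i → w 0 (k + i * c)))
      (trans (cong (x 0 ∧_) (window-stride c {w 0} (bw 0) k)) (mask-head c x (w 0 k)))
  conjugate-sum c x w bw (suc m) k =
    trans (xsum-xor n (λ i → x 0 ∧ w (suc m) (k + i * c)) (λ i → act i (tl x) w m (k + i * c + i)))
      (cong₂ _xor_
        (trans (xsum-∧ n (x 0) (λ i → w (suc m) (k + i * c)))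
          (trans (cong (x 0 ∧_) (window-stride c {w (suc m)} (bw (suc m)) k)) (mask-head c x (w (suc m) k))))
        (trans (xsum-cong n (λ i → cong (act i (tl x) w m) (index k i c)))
          (trans (conjugate-sum (suc c) (tl x) w bw m k)
            (trans (act-congˢ 0 w (λ j → cong (λ e → if does (n ∣? e) then x (suc j) else false) (sym (+-suc c j))) m k)
              (cong (act 0 (tl (mask c x)) w m) (sym (+-identityʳ k)))))))
    where
    index : ∀ k i c → k + i * c + i ≡ k + i * suc c
    index = solve-∀

  mask-𝕌 : ∀ x → mask 0 x ≈ 𝕍 n′ (𝕌 n′ x)
  mask-𝕌 x j = go j (n ∣? j)
    where
    go : ∀ j (d : Dec (n ∣ j)) → (if does d then x j else false) ≡ 𝕍 n′ (𝕌 n′ x) j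
    go j (yes (divides a refl)) = sym (𝕍-at n′ (𝕌 n′ x) a)
    go j (no n∤j) with 𝕍 n′ (𝕌 n′ x) j in eq
    ... | false = refl
    ... | true with 𝕍-supp n′ (𝕌 n′ x) j eq
    ...   | a , j≡ , _ = ⊥-elim (n∤j (divides a j≡))

  act-periodic : ∀ i x w → Balanced w → ∀ m → Invariant (act i x w m) n
  act-periodic i x w bw m = periodic (balanced-act i x w bw m)

  -- All exponents of the stretched series are t modulo n, so the twist by i amounts to ζ^(it).
  act-stretch : ∀ i t c w → Balanced w → ∀ m k → act i (stretch n′ t c) w m k ≡ act 0 (stretch n′ t c) w m (k + i * t)
  act-stretch i zero c w bw zero k rewrite *-zeroʳ i | +-identityʳ k = refl
  act-stretch i (suc t) c w bw zero k = refl
  act-stretch i zero c w bw (suc m) k rewrite *-zeroʳ i | +-identityʳ k | +-identityʳ k =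
    cong ((c 0 ∧ w (suc m) k) xor_)
      (trans (act-stretch i n′ (tl c) w bw m (k + i))
        (trans (cong (act 0 (stretch n′ n′ (tl c)) w m) (index k i n′))
          (invariant-* (act-periodic 0 (stretch n′ n′ (tl c)) w bw m) i k)))
    where
    index : ∀ k i n′ → k + i + i * n′ ≡ k + i * suc n′
    index = solve-∀
  act-stretch i (suc t) c w bw (suc m) k =
    trans (act-stretch i t c w bw m (k + i))
      (cong (act 0 (stretch n′ t c) w m) (index k i t))
    where
    index : ∀ k i t → k + i + i * t ≡ k + i * suc t + 0
    index = solve-∀

  act-scalar : ∀ i c w → Balanced w → act 0 (𝕍 n′ c) w ∼ act i (𝕍 n′ c) w
  act-scalar i c w bw m k =
    sym (trans (act-stretch i 0 c w bw m k)
      (cong (act 0 (𝕍 n′ c) w m) (trans (cong (k +_) (*-zeroʳ i)) (+-identityʳ k))))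

  scalarOp : Series → Op
  scalarOp c = actOp (0 , 𝕍 n′ c)

  ev-monic : ∀ cs i x w → Balanced w → ev (map scalarOp cs) (i , x) w ∼ act i (monic (map (𝕍 n′) cs) x) w
  ev-monic [] i x w bw m k = sym (act-𝟙 i w m k)
  ev-monic (c ∷ cs) i x w bw m k =
    trans (cong₂ _xor_
            (trans (act-cong i x (ev-monic cs i x w bw) m k) (sym (act-⊗ i x (monic (map (𝕍 n′) cs) x) w m k)))
            (act-scalar i c w bw m k))
      (sym (act-⊕ i (x ⊗ monic (map (𝕍 n′) cs) x) (𝕍 n′ c) w m k))

  top-last : ∀ c cs → fn (top (scalarOp c) (map scalarOp cs)) ≡ act 0 (𝕍 n′ (last c cs))
  top-last c [] = refl
  top-last c (c′ ∷ cs) = top-last c′ cs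

  -- A balanced element on which X acts by its own coefficients.
  u : ℕ → Bool
  u = 𝕍 n′ (λ _ → true)

  probe : Twisted
  probe zero k = u (k + 1) xor u k
  probe (suc m) k = false

  probe-balanced : Balanced probe
  probe-balanced (suc m) k = xsum-false n (λ _ → refl)
  probe-balanced zero k = begin
    xsum n (λ i → u (k + i * 1 + 1) xor u (k + i * 1))
      ≡⟨ xsum-cong n (λ i → cong (λ e → u e xor u (k + i * 1)) (shuffle k (i * 1))) ⟩
    xsum n (λ i → u (k + 1 + i * 1) xor u (k + i * 1))
      ≡⟨ xsum-xor n (λ i → u (k + 1 + i * 1)) (λ i → u (k + i * 1)) ⟩
    window n 1 u (k + 1) xor window n 1 u k
      ≡⟨ window-slide n 1 u k ⟩
    u (k + n * 1) xor u k
      ≡⟨ cong (_xor u k) (trans (cong u (trans (cong (k +_) (*-identityʳ n)) (trans (+-suc k n′) (cong suc (+-comm k n′))))) (stretch-at n′ n′ (λ _ → true) k)) ⟩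
    u k xor u k
      ≡⟨ xor-same (u k) ⟩
    false ∎
    where
    open ≡-Reasoning
    shuffle : ∀ a b → a + b + 1 ≡ a + 1 + b
    shuffle = solve-∀

  probe₀ : probe 0 0 ≡ true
  probe₀ = go n′ 2≤n
    where
    go : ∀ d → 2 ≤ suc d → stretch d d (λ _ → true) 0 xor true ≡ true
    go (suc d) _ = refl
    go zero (s≤s ())

  act-probe : ∀ x m → act 0 x probe m 0 ≡ x m
  act-probe x zero = trans (cong (x 0 ∧_) probe₀) (∧-identityʳ (x 0))
  act-probe x (suc m) = trans (cong (_xor act 0 (tl x) probe m 0) (∧-zeroʳ (x 0))) (act-probe (tl x) m)

  -- The conjugates ρ(ζ^i t) have leading coefficients ζ^(di), pairwise different since d is prime
  -- to n, and the remaining root R(tⁿ) has order 0 < d. Comparing lowest coefficients separates all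
  -- n + 1 roots.
  module Conjugates (ρ : Series) (d : ℕ) (low : ∀ e → e < d → ρ e ≡ false) (lead : ρ d ≡ true)
    (0<d : 0 < d) (coprime : Coprime d n) (R : Series) (R₀ : R 0 ≡ true) where

    conjugates : ℕ → List Root
    conjugates zero = (0 , 𝕍 n′ R) ∷ []
    conjugates (suc i) = (i , ρ) ∷ conjugates i

    ρ₀ : ρ 0 ≡ false
    ρ₀ = low 0 0<d

    separated : ∀ j e → j + suc e < n → Separated (j + suc e , ρ) (j , ρ)
    separated j e i<n w bw same m = <-rec (λ m → ∀ k → w m k ≡ false) vanish m
      where
      vanish : ∀ m → (∀ {m′} → m′ < m → ∀ k → w m′ k ≡ false) → ∀ k → w m k ≡ false
      vanish m z = coprime-vanishes coprime-e (bw m) (invariant-coprime coprime invariant (periodic (bw m)))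
        where
        coprime-e : Coprime (suc e) n
        coprime-e = Coprimality.sym (prime⇒coprime prime (≤-<-trans (m≤n+m (suc e) j) i<n))
        equal : ∀ k → w m (k + d * (j + suc e)) ≡ w m (k + d * j)
        equal k = trans (sym (act-lead (j + suc e) d ρ w m low lead (λ _ l → z l) k))
          (trans (same (d + m) k) (act-lead j d ρ w m low lead (λ _ l → z l) k))
        invariant : Invariant (w m) (d * suc e)
        -- Subtraction of d j is replaced by addition of d j n′, since shifts by n = n′ + 1 act
        -- trivially.
        invariant k = begin
          w m (k + d * suc e)                    ≡⟨ periodic-* (w m) (bw m) (d * j) (k + d * suc e) ⟨
          w m (k + d * suc e + d * j * suc n′)   ≡⟨ cong (w m) (shuffle k d e j n′) ⟩
          w m (k + d * j * n′ + d * (j + suc e)) ≡⟨ equal (k + d * j * n′) ⟩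
          w m (k + d * j * n′ + d * j)           ≡⟨ cong (w m) (shuffle′ k d j n′) ⟩
          w m (k + d * j * suc n′)               ≡⟨ periodic-* (w m) (bw m) (d * j) k ⟩
          w m k                                  ∎
          where
          open ≡-Reasoning
          shuffle : ∀ k d e j n′ → k + d * suc e + d * j * suc n′ ≡ k + d * j * n′ + d * (j + suc e)
          shuffle = solve-∀
          shuffle′ : ∀ k d j n′ → k + d * j * n′ + d * j ≡ k + d * j * suc n′
          shuffle′ = solve-∀

    separated-R : ∀ i → Separated (i , ρ) (0 , 𝕍 n′ R)
    separated-R i w bw same m = <-rec (λ m → ∀ k → w m k ≡ false) vanish m
      where
      vanish : ∀ m → (∀ {m′} → m′ < m → ∀ k → w m′ k ≡ false) → ∀ k → w m k ≡ false
      vanish m z k =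
        trans (cong (w m) (sym (+-identityʳ k)))
          (trans (sym (act-lead 0 0 (𝕍 n′ R) w m (λ _ ()) R₀ (λ _ l → z l) k))
            (trans (sym (same m k)) (zero-at m z k)))
        where
        zero-at : ∀ m → (∀ {m′} → m′ < m → ∀ k → w m′ k ≡ false) → ∀ k → act i ρ w m k ≡ false
        zero-at zero z k rewrite ρ₀ = refl
        zero-at (suc m) z k rewrite ρ₀ = act-low i (tl ρ) w m (λ _ l → z (s≤s l)) (k + i)

    separated-all : ∀ i → i ≤ n → AllPairs Separated (conjugates i)
    separated-all zero _ = [] ∷ []
    separated-all (suc i) i<n = from i ≤-refl ∷ separated-all i (<⇒≤ i<n)
      where
      from : ∀ j → j ≤ i → All (Separated (i , ρ)) (conjugates j)
      from zero _ = separated-R i ∷ []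
      from (suc j) j<i =
        subst (λ i → i < n → Separated (i , ρ) (j , ρ)) (trans (+-comm j _) (trans (sym (+-suc (i ∸ suc j) j)) (m∸n+n≡m j<i)))
          (separated j (i ∸ suc j)) i<n ∷ from j (<⇒≤ j<i)

    sum-conjugates : ∀ i w m k →
      rootSum (conjugates i) w m k ≡ xsum i (λ l → act l ρ w m k) xor act 0 (𝕍 n′ R) w m k
    sum-conjugates zero w m k = xor-identityʳ _
    sum-conjugates (suc i) w m k =
      trans (cong (act i ρ w m k xor_) (sum-conjugates i w m k))
        (trans (sym (xor-assoc (act i ρ w m k) (xsum i (λ l → act l ρ w m k)) _))
          (cong (_xor act 0 (𝕍 n′ R) w m k) (xor-comm (act i ρ w m k) _)))

    length-conjugates : ∀ i → length (conjugates i) ≡ suc i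
    length-conjugates zero = refl
    length-conjugates (suc i) = cong suc (length-conjugates i)

    -- The conjugates ρ(ζ^i t) sum to the part of ρ with exponents divisible by n.
    trace : ∀ c cs → length cs ≡ n → monic (map (𝕍 n′) (c ∷ cs)) ρ ≈ 𝟘 → monic (c ∷ cs) R ≈ 𝟘 →
      last c cs ≈ 𝕌 n′ ρ ⊕ R
    trace c cs len root-ρ root-R j = begin
      last c cs j                              ≡⟨ 𝕍-at n′ (last c cs) j ⟨
      𝕍 n′ (last c cs) M                       ≡⟨ act-probe (𝕍 n′ (last c cs)) M ⟨
      act 0 (𝕍 n′ (last c cs)) probe M 0       ≡⟨ cong (λ F → F probe M 0) (top-last c cs) ⟨
      fn (top (scalarOp c) (map scalarOp cs)) probe M 0
        ≡⟨ roots-sum (scalarOp c) (map scalarOp cs) (n′ , ρ) (conjugates n′)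
             (trans (length-conjugates n′) (trans (sym len) (sym (length-map scalarOp cs))))
             (vanish-all n) (separated-all n ≤-refl) probe probe-balanced M 0 ⟨
      rootSum (conjugates n) probe M 0         ≡⟨ sum-conjugates n probe M 0 ⟩
      xsum n (λ l → act l ρ probe M 0) xor act 0 (𝕍 n′ R) probe M 0
        ≡⟨ cong₂ _xor_
             (trans (xsum-cong n (λ l → cong (act l ρ probe M) (sym (*-zeroʳ l))))
               (trans (conjugate-sum 0 ρ probe probe-balanced M 0)
                 (trans (act-probe (mask 0 ρ) M) (mask-𝕌 ρ M))))
             (act-probe (𝕍 n′ R) M) ⟩
      𝕍 n′ (𝕌 n′ ρ) M xor 𝕍 n′ R M             ≡⟨ cong₂ _xor_ (𝕍-at n′ (𝕌 n′ ρ) j) (𝕍-at n′ R j) ⟩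
      𝕌 n′ ρ j xor R j                         ∎
      where
      open ≡-Reasoning
      M = j * n
      vanishes : ∀ i x → monic (map (𝕍 n′) (c ∷ cs)) x ≈ 𝟘 → Vanishes (scalarOp c) (map scalarOp cs) (i , x)
      vanishes i x root w bw m k =
        trans (ev-monic (c ∷ cs) i x w bw m k) (trans (act-congˢ i w root m k) (act-𝟘 i w m k))
      𝕍-monic : ∀ cs → 𝕍 n′ (monic cs R) ≈ monic (map (𝕍 n′) cs) (𝕍 n′ R)
      𝕍-monic [] = 𝕍-𝟙 n′
      𝕍-monic (c ∷ cs) =
        ≈-trans (𝕍-⊕ n′ (R ⊗ monic cs R) c)
          (⊕-cong (≈-trans (𝕍-⊗ n′ R (monic cs R)) (⊗-congˡ (𝕍-monic cs))) (≈-refl {𝕍 n′ c}))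
      vanish-all : ∀ i → All (Vanishes (scalarOp c) (map scalarOp cs)) (conjugates i)
      vanish-all zero =
        vanishes 0 (𝕍 n′ R)
          (≈-trans (≈-sym (𝕍-monic (c ∷ cs))) (≈-trans (𝕍-cong n′ root-R) (stretch-𝟘 n′ 0))) ∷ []
      vanish-all (suc i) = vanishes i ρ root-ρ ∷ vanish-all i

-- Dissections of P at the primes 5, 7 and 29

𝕌-shift : ∀ k x → 𝕌 k (pow 𝕢 (suc k) ⊗ x) ≈ 𝕢 ⊗ 𝕌 k x
𝕌-shift k x zero = refl
𝕌-shift k x (suc m) = trans (pow𝕢-shift (suc k) x (m * suc k)) (sym (𝕢⊗-suc (𝕌 k x) m))

𝕌-const : ∀ k b x → 𝕌 k (const b ⊗ x) ≈ const b ⊗ 𝕌 k x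
𝕌-const k b x m = trans (sym (•-as-⊗ b x (m * suc k))) (•-as-⊗ b (𝕌 k x) m)

𝕌-⊗[] : ∀ n k g x → 𝕌 k (𝕍 k g ⊗ x) ≡[ n ] g ⊗ 𝕌 k x
𝕌-⊗[] zero k g x i ()
𝕌-⊗[] (suc n) k g x =
  ≡[]-trans (≈⇒≡[] _ lhs)
    (≡[]-trans (⊕-congʳ[] (const (hd g) ⊗ 𝕌 k x) (𝕢⊗-cong[] (𝕌-⊗[] n k (tl g) x)))
      (≈⇒≡[] _ rhs))
  where
  lhs : 𝕌 k (𝕍 k g ⊗ x) ≈ const (hd g) ⊗ 𝕌 k x ⊕ 𝕢 ⊗ 𝕌 k (𝕍 k (tl g) ⊗ x)
  lhs = ≈-trans
    (λ m → solveBy (v0 :* v1) (v2 :* v1 :+ v3 :* (v4 :* v1))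
             (𝕍 k g ∷ x ∷ const (hd g) ∷ pow 𝕢 (suc k) ∷ 𝕍 k (tl g) ∷ [])
             (([ v1 ]* v0 ≋ v2 :+ v3 :* v4 by 𝕍-eq k g) ∷ []) refl (m * suc k))
    (⊕-cong (𝕌-const k (hd g) x) (𝕌-shift k (𝕍 k (tl g) ⊗ x)))
  rhs : const (hd g) ⊗ 𝕌 k x ⊕ 𝕢 ⊗ (tl g ⊗ 𝕌 k x) ≈ g ⊗ 𝕌 k x
  rhs = solveBy (v0 :* v1 :+ v2 :* (v3 :* v1)) (v4 :* v1) (const (hd g) ∷ 𝕌 k x ∷ 𝕢 ∷ tl g ∷ g ∷ [])
    (([ v1 ]* v4 ≋ v0 :+ v2 :* v3 by decompose g) ∷ []) refl

𝕌-⊗ : ∀ k g x → 𝕌 k (𝕍 k g ⊗ x) ≈ g ⊗ 𝕌 k x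
𝕌-⊗ k g x = ≡[]⇒≈ (λ n → 𝕌-⊗[] n k g x)

𝕌-cong : ∀ k {x y} → x ≈ y → 𝕌 k x ≈ 𝕌 k y
𝕌-cong k p m = p (m * suc k)

𝕍₁-odd : ∀ f n → parity n ≡ true → 𝕍 1 f n ≡ false
𝕍₁-odd f n o with 𝕍 1 f n in eq
... | false = refl
... | true with 𝕍-supp 1 f n eq
...   | m , refl , _ = trans (sym o) (trans (parity-* m 2) (∧-zeroʳ (parity m)))

-- Squaring doubles exponents, and for odd k + 1 the number m (k + 1) is even exactly when m is.
𝕌-square : ∀ k x → parity (suc k) ≡ true → 𝕌 k (pow x 2) ≈ pow (𝕌 k x) 2
𝕌-square k x odd m = trans (frobenius x (m * suc k)) (trans (go (m % 2) refl) (sym (frobenius (𝕌 k x) m)))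
  where
  go : ∀ r → m % 2 ≡ r → 𝕍 1 x (m * suc k) ≡ 𝕍 1 (𝕌 k x) m
  go zero r≡ = trans (cong (𝕍 1 x) even) (trans (𝕍-at 1 x (m / 2 * suc k)) (sym (trans (cong (𝕍 1 (𝕌 k x)) m≡) (𝕍-at 1 (𝕌 k x) (m / 2)))))
    where
    m≡ : m ≡ m / 2 * 2
    m≡ = trans (m≡m%n+[m/n]*n m 2) (cong (_+ m / 2 * 2) r≡)
    even : m * suc k ≡ m / 2 * suc k * 2
    even = trans (cong (_* suc k) m≡) (trans (*-assoc (m / 2) 2 (suc k)) (trans (cong (m / 2 *_) (*-comm 2 (suc k))) (sym (*-assoc (m / 2) (suc k) 2))))
  go (suc r) r≡ = trans (𝕍₁-odd x (m * suc k) (trans (parity-* m (suc k)) (cong₂ _∧_ odd-m odd))) (sym (𝕍₁-odd (𝕌 k x) m odd-m))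
    where
    odd-m : parity m ≡ true
    odd-m with parity m in eq
    ... | true = refl
    ... | false with () ← trans (sym r≡) (trans (%2-parity m) (cong (if_then 1 else 0) eq))

𝕌-fourth : ∀ k x → parity (suc k) ≡ true → 𝕌 k (pow x 4) ≈ pow (𝕌 k x) 4
𝕌-fourth k x odd =
  ≈-trans (𝕌-cong k (pow-* x 2 2))
    (≈-trans (𝕌-square k (pow x 2) odd) (≈-trans (pow-cong (𝕌-square k x odd) 2) (≈-sym (pow-* (𝕌 k x) 2 2))))

η[_] P[_] : ℕ → Series
η[ k ] = 𝕍 k η
P[ k ] = 𝕍 k P

P-inverse[_] : ∀ k → P[ k ] ⊗ η[ k ] ≈ 𝟙
P-inverse[ k ] = ≈-trans (≈-sym (𝕍-⊗ k P η)) (≈-trans (𝕍-cong k P-inverse) (𝕍-𝟙 k))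

-- The sum 1 + u + ... + u^(k-1). As (1 + u) times it is 1 + u^k, it is the cofactor with which an
-- equation u = 1 reduces u^k to 1.
geo : ∀ {n} → ℕ → Expr n → Expr n
geo zero u = `0
geo (suc k) u = geo k u :+ u :^ k

monicᴱ : ∀ {n} → List (Expr n) → Expr n → Expr n
monicᴱ [] x = `1
monicᴱ (c ∷ cs) x = x :* monicᴱ cs x :+ c

-- For a relation ∑ q^e x^a y^b = 0 between x = η(q), y = η(q^p), homogeneous
-- of weight (p+1)/24 for the grading where q^e has weight e, the series
-- t^d η(t^p)^p / η(t) with d = (p²-1)/24 is a root of the polynomial with
-- coefficients D^((pa+b-p-1)/24) of degree p+1-a, D = q η(q)^24.
module _ (Terms : List (ℕ × ℕ × ℕ)) where

  relation : ∀ {n} → Expr n → Expr n → Expr n → Expr n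
  relation q x y = go Terms
    where
    go : List (ℕ × ℕ × ℕ) → Expr _
    go [] = `0
    go ((a , b , e) ∷ ts) = q :^ e :* x :^ a :* y :^ b :+ go ts

  -- If i inverts x, then i^g x^a = i^(g-a); the first expression collects the cofactors of i x = 1
  -- for all terms of i^g times the relation. The second does the same for y.
  cofactorˣ cofactorʸ : ∀ {n} → ℕ → Expr n → Expr n → Expr n → Expr n → Expr n
  cofactorˣ g q x y i = go Terms
    where
    go : List (ℕ × ℕ × ℕ) → Expr _
    go [] = `0
    go ((a , b , e) ∷ ts) = q :^ e :* y :^ b :* i :^ (g ∸ a) :* geo a (i :* x) :+ go ts
  cofactorʸ g q x y i = go Terms
    where
    go : List (ℕ × ℕ × ℕ) → Expr _
    go [] = `0
    go ((a , b , e) ∷ ts) = q :^ e :* x :^ a :* i :^ (g ∸ b) :* geo b (i :* y) :+ go ts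

D : Series
D = 𝕢 ⊗ pow η 24

D[_] : ℕ → Series
D[ k ] = pow 𝕢 (suc k) ⊗ pow η[ k ] 24

𝕍-D : ∀ k → 𝕍 k D ≈ D[ k ]
𝕍-D k = ≈-trans (𝕍-⊗ k 𝕢 (pow η 24)) (⊗-cong (𝕍-𝕢 k) (𝕍-pow k η 24))

monic-𝕍 : ∀ n (cs : List (Expr 1)) x →
  monic (map (𝕍 n) (map (λ c → ⟦ c ⟧ (D ∷ [])) cs)) x ≈ monic (map (λ c → ⟦ c ⟧ (D[ n ] ∷ [])) cs) x
monic-𝕍 n [] x = ≈-refl
monic-𝕍 n (c ∷ cs) x =
  ⊕-cong (⊗-congˡ (monic-𝕍 n cs x)) (𝕍-expr n c (D ∷ []) (D[ n ] ∷ []) λ where zero → 𝕍-D n)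

pow𝕢-lead : ∀ d u → u 0 ≡ true → (pow 𝕢 d ⊗ u) d ≡ true
pow𝕢-lead d u u₀ = trans (cong (pow 𝕢 d ⊗ u) (sym (+-identityʳ d))) (trans (pow𝕢-shift d u 0) u₀)


module Dissection (n′ d : ℕ) (prime : Prime (suc n′)) (odd : parity (suc n′) ≡ true) (2≤n : 2 ≤ suc n′)
  (0<d : 0 < d) (coprime : Coprime d (suc n′)) (terms : List (ℕ × ℕ × ℕ))
  (relation-holds : ∀ z → ⟦ relation terms v0 v1 v2 ⟧ (𝕢 ∷ η ∷ η[ n′ ] ∷ z ∷ []) ≈ 𝟘)
  (c : ∀ {n} → Expr n → Expr n) (cs : ∀ {n} → Expr n → List (Expr n)) where

  n g : ℕ
  n = suc n′
  g = suc n

  open Trace n′ prime odd 2≤n using (module Conjugates)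

  u ρ R : Series
  u = pow η[ n′ ] n ⊗ P
  ρ = pow 𝕢 d ⊗ u
  R = pow η n ⊗ P[ n′ ]

  u₀ : u 0 ≡ true
  u₀ = trans (cong (_∧ P 0) (pow-unit {η[ n′ ]} refl n)) refl

  R₀ : R 0 ≡ true
  R₀ = trans (cong (_∧ P[ n′ ] 0) (pow-unit {η} refl n)) refl

  open Conjugates ρ d (λ e → pow𝕢-low d u e) (pow𝕢-lead d u u₀) 0<d coprime R R₀

  coefficients : ∀ {n} → Expr n → List (Expr n)
  coefficients x = c x ∷ cs x

  -- As 24 d = n² - 1 at the levels used, κˣ P^g turns the term q^e x^a y^b into D(qⁿ)^k ρ^(g-a)
  -- with integral k. Likewise κʸ P(qⁿ)^g gives D^k R^(g-b).
  κˣ κʸ dˣ dʸ : Expr 4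
  κˣ = v0 :^ (n * d) :* v2 :^ (24 * d)
  κʸ = v1 :^ (24 * d)
  dˣ = v0 :^ n :* v2 :^ 24
  dʸ = v0 :* v1 :^ 24

  hypsˣ : List (Hyp (𝕢 ∷ η ∷ η[ n′ ] ∷ P ∷ []))
  hypsˣ = ([ κˣ :* v3 :^ g ]* relation terms v0 v1 v2 ≋ `0 by relation-holds P)
    ∷ ([ κˣ :* cofactorˣ terms g v0 v1 v2 v3 ]* v3 :* v1 ≋ `1 by P-inverse) ∷ []

  hypsʸ : List (Hyp (𝕢 ∷ η ∷ η[ n′ ] ∷ P[ n′ ] ∷ []))
  hypsʸ = ([ κʸ :* v3 :^ g ]* relation terms v0 v1 v2 ≋ `0 by relation-holds P[ n′ ])
    ∷ ([ κʸ :* cofactorʸ terms g v0 v1 v2 v3 ]* v3 :* v2 ≋ `1 by P-inverse[ n′ ]) ∷ []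

  rootˣ rootʸ : Expr 4
  rootˣ = monicᴱ (coefficients dˣ) (v0 :^ d :* (v2 :^ n :* v3))
  rootʸ = monicᴱ (coefficients dʸ) (v1 :^ n :* v3)

  values : List (Expr 1) → List Series
  values = map (λ c → ⟦ c ⟧ (D ∷ []))

  module _
    (substˣ : monic (map (λ c → ⟦ c ⟧ (D[ n′ ] ∷ [])) (coefficients v0)) ρ ≈ ⟦ rootˣ ⟧ (𝕢 ∷ η ∷ η[ n′ ] ∷ P ∷ []))
    (substʸ : monic (values (coefficients v0)) R ≈ ⟦ rootʸ ⟧ (𝕢 ∷ η ∷ η[ n′ ] ∷ P[ n′ ] ∷ []))
    (checkˣ : norm (rootˣ :+ `0 :+ total hypsˣ) ≡ [])
    (checkʸ : norm (rootʸ :+ `0 :+ total hypsʸ) ≡ [])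
    (len : length (values (cs v0)) ≡ n) where

    -- By the trace, the second coefficient is 𝕌 ρ + R. The power η(tⁿ)ⁿ in ρ leaves 𝕌 as ηⁿ, and
    -- multiplication by Pⁿ removes ηⁿ there and in R.
    dissection : 𝕌 n′ (pow 𝕢 d ⊗ P) ≈ pow P n ⊗ last (⟦ c v0 ⟧ (D ∷ [])) (values (cs v0)) ⊕ P[ n′ ]
    dissection = solveBy v0 (v1 :* v2 :+ v3)
      (F ∷ pow P n ∷ last (⟦ c v0 ⟧ (D ∷ [])) (values (cs v0)) ∷ P[ n′ ] ∷ pow η n ∷ 𝕌 n′ ρ ∷ [])
      (([ v1 ]* v2 ≋ v5 :+ v4 :* v3 by trace (⟦ c v0 ⟧ (D ∷ [])) (values (cs v0)) len
            (≈-trans (monic-𝕍 n′ (coefficients v0) ρ) (≈-trans substˣ (solveBy rootˣ `0 _ hypsˣ checkˣ)))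
            (≈-trans substʸ (solveBy rootʸ `0 _ hypsʸ checkʸ)))
      ∷ ([ v1 ]* v5 ≋ v4 :* v0 by
           ≈-trans (𝕌-cong n′ (≈-trans
               (solve (v0 :* (v1 :* v2)) (v1 :* (v0 :* v2)) (pow 𝕢 d ∷ pow η[ n′ ] n ∷ P ∷ []) refl)
               (⊗-congʳ (≈-sym (𝕍-pow n′ η n)))))
             (𝕌-⊗ n′ (pow η n) (pow 𝕢 d ⊗ P)))
      ∷ ([ v0 :+ v3 ]* v1 :* v4 ≋ `1 by
           ≈-trans (≈-sym (pow-⊗ P η n)) (≈-trans (pow-cong P-inverse n) (pow-𝟙 n))) ∷ []) refl
      where
      F = 𝕌 n′ (pow 𝕢 d ⊗ P)

module Level5 where
  open Modular.Level5 η Triangular.η₀ η-cubes using (modular₅) public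

  terms : List (ℕ × ℕ × ℕ)
  terms = (6 , 0 , 0) ∷ (1 , 1 , 0) ∷ (0 , 6 , 1) ∷ []

  relation-holds : ⟦ relation terms v0 v1 v2 ⟧ (𝕢 ∷ η ∷ η[ 4 ] ∷ []) ≈ 𝟘
  relation-holds = solveBy (relation terms v0 v1 v2) `0 (𝕢 ∷ η ∷ η[ 4 ] ∷ [])
    (([ `1 ]* v1 :^ 6 :+ v0 :* v2 :^ 6 ≋ v1 :* v2 by modular₅) ∷ []) refl

  -- The polynomial is z⁶ + z⁵ + D.
  open Dissection 4 1 (from-yes (prime? 5)) refl (s≤s (s≤s z≤n)) (s≤s z≤n) (from-yes (coprime? 1 5))
    terms (λ _ → relation-holds) (λ d → d) (λ d → `0 ∷ `0 ∷ `0 ∷ `0 ∷ `1 ∷ [])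

  dissection₅ : 𝕌 4 (pow 𝕢 1 ⊗ P) ≈ pow P 5 ⊗ 𝟙 ⊕ P[ 4 ]
  dissection₅ = dissection ≈-refl ≈-refl refl refl refl

module Level7 where
  open Modular7.Level7 η Triangular.η₀ η-cubes using (modular₇) public

  terms : List (ℕ × ℕ × ℕ)
  terms = (8 , 0 , 0) ∷ (1 , 1 , 0) ∷ (4 , 4 , 1) ∷ (0 , 8 , 2) ∷ []

  relation-holds : ⟦ relation terms v0 v1 v2 ⟧ (𝕢 ∷ η ∷ η[ 6 ] ∷ []) ≈ 𝟘
  relation-holds = solveBy (relation terms v0 v1 v2) `0 (𝕢 ∷ η ∷ η[ 6 ] ∷ [])
    (([ `1 ]* v1 :^ 8 :+ v0 :^ 2 :* v2 :^ 8 ≋ v1 :* v2 :+ v0 :* (v1 :* v2) :^ 4 by modular₇) ∷ []) refl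

  -- The polynomial is z⁸ + z⁷ + D z⁴ + D².
  open Dissection 6 2 (from-yes (prime? 7)) refl (s≤s (s≤s z≤n)) (s≤s z≤n) (from-yes (coprime? 2 7))
    terms (λ _ → relation-holds) (λ d → d :^ 2) (λ d → `0 ∷ `0 ∷ `0 ∷ d ∷ `0 ∷ `0 ∷ `1 ∷ [])

  dissection₇ : 𝕌 6 (pow 𝕢 2 ⊗ P) ≈ pow P 7 ⊗ 𝟙 ⊕ P[ 6 ]
  dissection₇ = dissection ≈-refl ≈-refl refl refl refl

module Level29 where
  open Modular.Level29 η Triangular.η₀ η-cubes using (modular₂₉)

  terms : List (ℕ × ℕ × ℕ)
  terms = (30 , 0 , 0) ∷ (25 , 1 , 1) ∷ (24 , 6 , 7) ∷ (20 , 2 , 2) ∷ (15 , 3 , 3) ∷ (14 , 8 , 9)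
    ∷ (10 , 4 , 4) ∷ (8 , 14 , 16) ∷ (6 , 24 , 28) ∷ (5 , 5 , 5) ∷ (4 , 10 , 11) ∷ (3 , 15 , 17)
    ∷ (2 , 20 , 23) ∷ (1 , 1 , 0) ∷ (1 , 25 , 29) ∷ (0 , 30 , 35) ∷ []

  -- The equation of modular₂₉ has the extraneous factor a + s.
  relation-holds : ⟦ relation terms v0 v1 v2 ⟧ (𝕢 ∷ η ∷ η[ 28 ] ∷ []) ≈ 𝟘
  relation-holds = unit-cancel {u = ⟦ a :+ v0 :* s ⟧ (𝕢 ∷ η ∷ η[ 28 ] ∷ [])} refl
    (solveBy (relation terms v0 v1 v2 :* (a :+ v0 :* s)) `0 (𝕢 ∷ η ∷ η[ 28 ] ∷ [])
      (([ `1 ]* a :^ 6 :+ v0 :^ 6 :* s :^ 6 :+ a :* s :+ v0 :* s :^ 2 ≋ `0 by modular₂₉) ∷ []) refl)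
    where
    a s : Expr 3
    a = v1 :^ 6 :+ v0 :^ 7 :* v2 :^ 6
    s = v1 :* v2

  -- The second coefficient 1 + D stems from the two terms with a = 1.
  open Dissection 28 35 (from-yes (prime? 29)) refl (s≤s (s≤s z≤n)) (s≤s z≤n) (from-yes (coprime? 35 29))
    terms (λ _ → relation-holds) (λ d → d :^ 35)
    (λ d → `0 ∷ `0 ∷ `0 ∷ `0 ∷ d :^ 29 ∷ d :^ 28 ∷ `0 ∷ `0 ∷ `0 ∷ d :^ 23 ∷ `0 ∷ `0 ∷ `0 ∷ `0 ∷ d :^ 17
         ∷ d :^ 16 ∷ `0 ∷ `0 ∷ `0 ∷ d :^ 11 ∷ `0 ∷ d :^ 9 ∷ `0 ∷ d :^ 7 ∷ d :^ 5 ∷ d :^ 4 ∷ d :^ 3 ∷ d :^ 2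
         ∷ `1 :+ d ∷ [])

  dissection₂₉ : 𝕌 28 (pow 𝕢 35 ⊗ P) ≈ pow P 29 ⊗ (𝟙 ⊕ D) ⊕ P[ 28 ]
  dissection₂₉ = dissection ≈-refl ≈-refl refl refl refl

-- Hecke operators at 5 and 7

pow𝕢-supp : ∀ e n → pow 𝕢 e n ≡ true → n ≡ e
pow𝕢-supp zero zero _ = refl
pow𝕢-supp (suc e) (suc n) p = cong suc (pow𝕢-supp e n (trans (sym (𝕢⊗-suc (pow 𝕢 e) n)) p))

𝕌-hit : ∀ k {e} m → e ≡ m * suc k → 𝕌 k (pow 𝕢 e) ≈ pow 𝕢 m
𝕌-hit k m refl j = trans (sym (𝕍-pow𝕢 k m (j * suc k))) (𝕍-at k (pow 𝕢 m) j)

𝕌-miss : ∀ k {e} c m → suc c < suc k → e ≡ suc c + m * suc k → 𝕌 k (pow 𝕢 e) ≈ 𝟘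
𝕌-miss k {e} c m c<k e≡ j with pow 𝕢 e (j * suc k) in eq
... | false = refl
... | true with () ← trans (sym (m*n%n≡0 j (suc k)))
                 (trans (cong (_% suc k) (trans (pow𝕢-supp e (j * suc k) eq) e≡))
                   (trans ([m+kn]%n≡m%n (suc c) m (suc k)) (m<n⇒m%n≡m c<k)))

-- The witness is 5 tri m - 2m, described without subtraction.
tri-5 : ∀ m → ∃ λ s → tri (m * 5) ≡ s * 5 × s + 2 * m ≡ 5 * tri m
tri-5 zero = 0 , refl , refl
tri-5 (suc m) with tri-5 m
... | s , e , e′ = s + 5 * m + 3 , trans (cong (λ t → t + suc (m * 5) + (2 + m * 5) + (3 + m * 5) + (4 + m * 5) + (5 + m * 5)) e) (go m s)
                 , trans (go′ m s) (trans (cong (_+ 5 * suc m) e′) (go″ m (tri m)))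
  where
  go : ∀ m s → s * 5 + suc (m * 5) + (2 + m * 5) + (3 + m * 5) + (4 + m * 5) + (5 + m * 5) ≡ (s + 5 * m + 3) * 5
  go = solve-∀
  go′ : ∀ m s → s + 5 * m + 3 + 2 * suc m ≡ s + 2 * m + 5 * suc m
  go′ = solve-∀
  go″ : ∀ m t → 5 * t + 5 * suc m ≡ 5 * (t + suc m)
  go″ = solve-∀

tri-7 : ∀ m → ∃ λ s → tri (m * 7) ≡ s * 7 × s + 3 * m ≡ 7 * tri m
tri-7 zero = 0 , refl , refl
tri-7 (suc m) with tri-7 m
... | s , e , e′ = s + 7 * m + 4 , trans (cong (λ t → t + suc (m * 7) + (2 + m * 7) + (3 + m * 7) + (4 + m * 7) + (5 + m * 7) + (6 + m * 7) + (7 + m * 7)) e) (go m s)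
                 , trans (go′ m s) (trans (cong (_+ 7 * suc m) e′) (go″ m (tri m)))
  where
  go : ∀ m s → s * 7 + suc (m * 7) + (2 + m * 7) + (3 + m * 7) + (4 + m * 7) + (5 + m * 7) + (6 + m * 7) + (7 + m * 7) ≡ (s + 7 * m + 4) * 7
  go = solve-∀
  go′ : ∀ m s → s + 7 * m + 4 + 3 * suc m ≡ s + 3 * m + 7 * suc m
  go′ = solve-∀
  go″ : ∀ m t → 7 * t + 7 * suc m ≡ 7 * (t + suc m)
  go″ = solve-∀

-- If 24 e + 1 = x², then 5 divides 4 + e exactly when it divides x. In each block of five indices
-- this leaves one `hi` and one `lo`, which return as `lo m` and `hi m`.
𝕌₅-partial : ∀ m → 𝕌 4 (pow 𝕢 4 ⊗ partial (m * 5)) ≈ 𝕢 ⊗ 𝕍 4 (partial m)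
𝕌₅-partial zero = ≈-trans (𝕌-cong 4 (⊗-zeroʳ (pow 𝕢 4))) (≈-sym (≈-trans (⊗-congˡ (stretch-𝟘 4 0)) (⊗-zeroʳ 𝕢)))
𝕌₅-partial (suc m) with tri-5 m
... | s , tri≡ , s≡ = ≈-trans (≈-trans expand collapse) (≈-sym target)
  where
  L : Series → Series
  L x = 𝕌 4 (pow 𝕢 4 ⊗ x)
  L-pair : ∀ x y z → L (x ⊕ (y ⊕ z)) ≈ L x ⊕ (L y ⊕ L z)
  L-pair x y z = ≈-trans (𝕌-cong 4 (⊗-distribˡ (pow 𝕢 4) x (y ⊕ z)))
    (⊕-congʳ (L x) (𝕌-cong 4 (⊗-distribˡ (pow 𝕢 4) y z)))
  t : ℕ → Series
  t e = 𝕌 4 (pow 𝕢 (4 + e))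
  L-t : ∀ e → L (pow 𝕢 e) ≈ t e
  L-t e = 𝕌-cong 4 (≈-sym (pow-+ 𝕢 4 e))
  step : ∀ k {x} y → L (partial k) ≈ x → t (lo k) ⊕ t (hi k) ≈ y → L (partial (suc k)) ≈ x ⊕ y
  step k y p r = ≈-trans (L-pair (partial k) (pow 𝕢 (lo k)) (pow 𝕢 (hi k)))
    (⊕-cong p (≈-trans (⊕-cong (L-t (lo k)) (L-t (hi k))) r))
  k = m * 5
  both-miss : ∀ {a b} → a ≈ 𝟘 → b ≈ 𝟘 → a ⊕ b ≈ 𝟘
  both-miss = ⊕-cong
  expand : L (partial (suc m * 5)) ≈
    (𝕢 ⊗ 𝕍 4 (partial m)) ⊕ pow 𝕢 (1 + lo m * 5) ⊕ 𝟘 ⊕ 𝟘 ⊕ 𝟘 ⊕ pow 𝕢 (1 + hi m * 5)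
  expand =
    step (4 + k) _ (step (3 + k) _ (step (2 + k) _ (step (1 + k) _ (step k _ (𝕌₅-partial m)
      (⊕-cong {g = t (hi k)} (𝕌-miss 4 3 (5 * (m * m) + s) (s≤s (s≤s (s≤s (s≤s (s≤s z≤n))))) (trans (cong (λ x → 4 + (k * k + x)) tri≡) (lo₀ m s)))
                             (𝕌-hit 4 (1 + lo m * 5) (trans (cong (λ x → 4 + (suc k * suc k + x)) tri≡) (trans (hi₀ m s) (trans (cong (λ x → (1 + (5 * (m * m) + x)) * 5) s≡) (hi₀′ m (tri m))))))))
      (both-miss (𝕌-miss 4 0 (1 + 3 * m + 5 * (m * m) + s) (s≤s (s≤s z≤n)) (trans (cong (λ x → 4 + (suc k * suc k + (x + suc k))) tri≡) (lo₁ m s)))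
                 (𝕌-miss 4 3 (1 + 5 * m + 5 * (m * m) + s) (s≤s (s≤s (s≤s (s≤s (s≤s z≤n))))) (trans (cong (λ x → 4 + ((2 + k) * (2 + k) + (x + suc k))) tri≡) (hi₁ m s)))))
      (both-miss (𝕌-miss 4 0 (2 + 6 * m + 5 * (m * m) + s) (s≤s (s≤s z≤n)) (trans (cong (λ x → 4 + ((2 + k) * (2 + k) + (x + suc k + (2 + k)))) tri≡) (lo₂ m s)))
                 (𝕌-miss 4 0 (3 + 8 * m + 5 * (m * m) + s) (s≤s (s≤s z≤n)) (trans (cong (λ x → 4 + ((3 + k) * (3 + k) + (x + suc k + (2 + k)))) tri≡) (hi₂ m s)))))
      (both-miss (𝕌-miss 4 3 (3 + 9 * m + 5 * (m * m) + s) (s≤s (s≤s (s≤s (s≤s (s≤s z≤n))))) (trans (cong (λ x → 4 + ((3 + k) * (3 + k) + (x + suc k + (2 + k) + (3 + k)))) tri≡) (lo₃ m s)))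
                 (𝕌-miss 4 0 (5 + 11 * m + 5 * (m * m) + s) (s≤s (s≤s z≤n)) (trans (cong (λ x → 4 + ((4 + k) * (4 + k) + (x + suc k + (2 + k) + (3 + k)))) tri≡) (hi₃ m s)))))
      (≈-trans (⊕-cong (𝕌-hit 4 (1 + hi m * 5) (trans (cong (λ x → 4 + ((4 + k) * (4 + k) + (x + suc k + (2 + k) + (3 + k) + (4 + k)))) tri≡) (trans (lo₄ m s) (trans (cong (λ x → (1 + (5 * (suc m * suc m) + x)) * 5) s≡) (lo₄′ m (tri m))))))
                       (𝕌-miss 4 3 (7 + 14 * m + 5 * (m * m) + s) (s≤s (s≤s (s≤s (s≤s (s≤s z≤n))))) (trans (cong (λ x → 4 + ((5 + k) * (5 + k) + (x + suc k + (2 + k) + (3 + k) + (4 + k)))) tri≡) (hi₄ m s))))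
        (⊕-identityʳ _))
    where
    lo₀ : ∀ m s → 4 + (m * 5 * (m * 5) + s * 5) ≡ 4 + (5 * (m * m) + s) * 5
    lo₀ = solve-∀
    hi₀ : ∀ m s → 4 + (suc (m * 5) * suc (m * 5) + s * 5) ≡ (1 + (5 * (m * m) + (s + 2 * m))) * 5
    hi₀ = solve-∀
    hi₀′ : ∀ m t → (1 + (5 * (m * m) + 5 * t)) * 5 ≡ (1 + (m * m + t) * 5) * 5
    hi₀′ = solve-∀
    lo₁ : ∀ m s → 4 + (suc (m * 5) * suc (m * 5) + (s * 5 + suc (m * 5))) ≡ 1 + (1 + 3 * m + 5 * (m * m) + s) * 5
    lo₁ = solve-∀
    hi₁ : ∀ m s → 4 + ((2 + m * 5) * (2 + m * 5) + (s * 5 + suc (m * 5))) ≡ 4 + (1 + 5 * m + 5 * (m * m) + s) * 5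
    hi₁ = solve-∀
    lo₂ : ∀ m s → 4 + ((2 + m * 5) * (2 + m * 5) + (s * 5 + suc (m * 5) + (2 + m * 5))) ≡ 1 + (2 + 6 * m + 5 * (m * m) + s) * 5
    lo₂ = solve-∀
    hi₂ : ∀ m s → 4 + ((3 + m * 5) * (3 + m * 5) + (s * 5 + suc (m * 5) + (2 + m * 5))) ≡ 1 + (3 + 8 * m + 5 * (m * m) + s) * 5
    hi₂ = solve-∀
    lo₃ : ∀ m s → 4 + ((3 + m * 5) * (3 + m * 5) + (s * 5 + suc (m * 5) + (2 + m * 5) + (3 + m * 5))) ≡ 4 + (3 + 9 * m + 5 * (m * m) + s) * 5
    lo₃ = solve-∀
    hi₃ : ∀ m s → 4 + ((4 + m * 5) * (4 + m * 5) + (s * 5 + suc (m * 5) + (2 + m * 5) + (3 + m * 5))) ≡ 1 + (5 + 11 * m + 5 * (m * m) + s) * 5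
    hi₃ = solve-∀
    lo₄ : ∀ m s → 4 + ((4 + m * 5) * (4 + m * 5) + (s * 5 + suc (m * 5) + (2 + m * 5) + (3 + m * 5) + (4 + m * 5))) ≡ (1 + (5 * (suc m * suc m) + (s + 2 * m))) * 5
    lo₄ = solve-∀
    lo₄′ : ∀ m t → (1 + (5 * (suc m * suc m) + 5 * t)) * 5 ≡ (1 + (suc m * suc m + t) * 5) * 5
    lo₄′ = solve-∀
    hi₄ : ∀ m s → 4 + ((5 + m * 5) * (5 + m * 5) + (s * 5 + suc (m * 5) + (2 + m * 5) + (3 + m * 5) + (4 + m * 5))) ≡ 4 + (7 + 14 * m + 5 * (m * m) + s) * 5
    hi₄ = solve-∀
  body : Series
  body = 𝕢 ⊗ 𝕍 4 (partial m)
  collapse : body ⊕ pow 𝕢 (1 + lo m * 5) ⊕ 𝟘 ⊕ 𝟘 ⊕ 𝟘 ⊕ pow 𝕢 (1 + hi m * 5)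
    ≈ body ⊕ (pow 𝕢 (1 + lo m * 5) ⊕ pow 𝕢 (1 + hi m * 5))
  collapse = solve (v0 :+ v1 :+ `0 :+ `0 :+ `0 :+ v2) (v0 :+ (v1 :+ v2)) (body ∷ pow 𝕢 (1 + lo m * 5) ∷ pow 𝕢 (1 + hi m * 5) ∷ []) refl
  target : 𝕢 ⊗ 𝕍 4 (partial (suc m)) ≈ body ⊕ (pow 𝕢 (1 + lo m * 5) ⊕ pow 𝕢 (1 + hi m * 5))
  target = ≈-trans (⊗-congˡ (≈-trans (𝕍-⊕ 4 (partial m) (pow 𝕢 (lo m) ⊕ pow 𝕢 (hi m)))
      (⊕-congʳ (𝕍 4 (partial m)) (≈-trans (𝕍-⊕ 4 (pow 𝕢 (lo m)) (pow 𝕢 (hi m))) (⊕-cong (𝕍-pow𝕢 4 (lo m)) (𝕍-pow𝕢 4 (hi m)))))))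
    (solve (v0 :* (v1 :+ (v2 :+ v3))) (v0 :* v1 :+ (v0 :* v2 :+ v0 :* v3)) (𝕢 ∷ 𝕍 4 (partial m) ∷ pow 𝕢 (lo m * 5) ∷ pow 𝕢 (hi m * 5) ∷ []) refl)

𝕌-cong[] : ∀ k {n x y} → x ≡[ n * suc k ] y → 𝕌 k x ≡[ n ] 𝕌 k y
𝕌-cong[] k p i l = p (i * suc k) (*-monoˡ-< (suc k) l)

-- T₅ η = 0
𝕌₅-η : 𝕌 4 (pow 𝕢 4 ⊗ η) ≈ 𝕢 ⊗ η[ 4 ]
𝕌₅-η = ≡[]⇒≈ λ n →
  ≡[]-trans (𝕌-cong[] 4 {n} (⊗-cong[] {f = pow 𝕢 4} (λ _ _ → refl) (η≡partial (n * 5))))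
    (≡[]-trans (≈⇒≡[] n (𝕌₅-partial n))
      (⊗-cong[] {f = 𝕢} (λ _ _ → refl) (𝕍-cong[] 4 (≡[]-sym (η≡partial n)))))

-- As 8 tri j + 1 = (2j + 1)², the number 1 + tri j is divisible by 7 exactly when 2j + 1 is, that
-- is for j = 3 modulo 7.
𝕌₇-triangles : ∀ m → 𝕌 6 (𝕢 ⊗ triangles (m * 7)) ≈ 𝕢 ⊗ 𝕍 6 (triangles m)
𝕌₇-triangles zero = ≈-trans (𝕌-cong 6 (⊗-zeroʳ 𝕢)) (≈-sym (≈-trans (⊗-congˡ (stretch-𝟘 6 0)) (⊗-zeroʳ 𝕢)))
𝕌₇-triangles (suc m) with tri-7 m
... | s , tri≡ , s≡ = ≈-trans expand (≈-sym target)
  where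
  L : Series → Series
  L x = 𝕌 6 (𝕢 ⊗ x)
  k = m * 7
  body : Series
  body = 𝕢 ⊗ 𝕍 6 (triangles m)
  skip : ∀ j c M {x} → suc c < 7 → L (triangles j) ≈ x → suc (tri j) ≡ suc c + M * 7 → L (triangles (suc j)) ≈ x
  skip j c M {x} l p e = ≈-trans (𝕌-cong 6 (⊗-distribˡ 𝕢 (triangles j) (pow 𝕢 (tri j))))
    (≈-trans (⊕-cong p (𝕌-miss 6 c M l e)) (⊕-identityʳ x))
  expand : L (triangles (suc m * 7)) ≈ body ⊕ pow 𝕢 (1 + tri m * 7)
  expand =
    skip (6 + k) 0 (3 + 6 * m + s) (s≤s (s≤s z≤n))
      (skip (5 + k) 1 (2 + 5 * m + s) (s≤s (s≤s (s≤s z≤n)))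
        (skip (4 + k) 3 (1 + 4 * m + s) (s≤s (s≤s (s≤s (s≤s (s≤s z≤n)))))
          (≈-trans (𝕌-cong 6 (⊗-distribˡ 𝕢 (triangles (3 + k)) (pow 𝕢 (tri (3 + k)))))
            (⊕-cong
              (skip (2 + k) 3 (2 * m + s) (s≤s (s≤s (s≤s (s≤s (s≤s z≤n)))))
                (skip (1 + k) 1 (m + s) (s≤s (s≤s (s≤s z≤n)))
                  (skip k 0 s (s≤s (s≤s z≤n)) (𝕌₇-triangles m) (cong suc tri≡))
                  (trans (cong (λ x → suc (x + suc k)) tri≡) (e₁ m s)))
                (trans (cong (λ x → suc (x + suc k + (2 + k))) tri≡) (e₂ m s)))
              (𝕌-hit 6 (1 + tri m * 7)
                (trans (cong (λ x → suc (x + suc k + (2 + k) + (3 + k))) tri≡)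
                  (trans (e₃ m s) (trans (cong (λ x → (1 + x) * 7) s≡) (cong (λ x → (1 + x) * 7) (*-comm 7 (tri m)))))))))
          (trans (cong (λ x → suc (x + suc k + (2 + k) + (3 + k) + (4 + k))) tri≡) (e₄ m s)))
        (trans (cong (λ x → suc (x + suc k + (2 + k) + (3 + k) + (4 + k) + (5 + k))) tri≡) (e₅ m s)))
      (trans (cong (λ x → suc (x + suc k + (2 + k) + (3 + k) + (4 + k) + (5 + k) + (6 + k))) tri≡) (e₆ m s))
    where
    e₁ : ∀ m s → suc (s * 7 + suc (m * 7)) ≡ 2 + (m + s) * 7
    e₁ = solve-∀
    e₂ : ∀ m s → suc (s * 7 + suc (m * 7) + (2 + m * 7)) ≡ 4 + (2 * m + s) * 7
    e₂ = solve-∀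
    e₃ : ∀ m s → suc (s * 7 + suc (m * 7) + (2 + m * 7) + (3 + m * 7)) ≡ (1 + (s + 3 * m)) * 7
    e₃ = solve-∀
    e₄ : ∀ m s → suc (s * 7 + suc (m * 7) + (2 + m * 7) + (3 + m * 7) + (4 + m * 7)) ≡ 4 + (1 + 4 * m + s) * 7
    e₄ = solve-∀
    e₅ : ∀ m s → suc (s * 7 + suc (m * 7) + (2 + m * 7) + (3 + m * 7) + (4 + m * 7) + (5 + m * 7)) ≡ 2 + (2 + 5 * m + s) * 7
    e₅ = solve-∀
    e₆ : ∀ m s → suc (s * 7 + suc (m * 7) + (2 + m * 7) + (3 + m * 7) + (4 + m * 7) + (5 + m * 7) + (6 + m * 7)) ≡ 1 + (3 + 6 * m + s) * 7
    e₆ = solve-∀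
  target : 𝕢 ⊗ 𝕍 6 (triangles (suc m)) ≈ body ⊕ pow 𝕢 (1 + tri m * 7)
  target = ≈-trans (⊗-congˡ (≈-trans (𝕍-⊕ 6 (triangles m) (pow 𝕢 (tri m))) (⊕-congʳ (𝕍 6 (triangles m)) (𝕍-pow𝕢 6 (tri m)))))
    (⊗-distribˡ 𝕢 (𝕍 6 (triangles m)) (pow 𝕢 (tri m * 7)))

η³≡triangles′ : ∀ m → pow η 3 ≡[ m ] triangles m
η³≡triangles′ m = ≡[]-trans (η³≡triangles m) (drop m)
  where
  drop : ∀ d → triangles (d + m) ≡[ m ] triangles m
  drop zero i l = refl
  drop (suc d) = ≡[]-trans (⊕-congʳ[] (triangles (d + m))
      (≡[]-trans (≈⇒≡[] m (≈-sym (⊗-identityʳ (pow 𝕢 (tri (d + m))))))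
        (⊗-drop[] (≤-trans (m≤n+m m d) (Pentagonal.tri-≥ (d + m))))))
    (≡[]-trans (≈⇒≡[] m (⊕-identityʳ _)) (drop d))

-- T₇ η³ = 0
𝕌₇-η³ : 𝕌 6 (𝕢 ⊗ pow η 3) ≈ 𝕢 ⊗ 𝕍 6 (pow η 3)
𝕌₇-η³ = ≡[]⇒≈ λ n →
  ≡[]-trans (𝕌-cong[] 6 {n} (⊗-cong[] {f = 𝕢} (λ _ _ → refl) (η³≡triangles′ (n * 7))))
    (≡[]-trans (≈⇒≡[] n (𝕌₇-triangles n))
      (⊗-cong[] {f = 𝕢} (λ _ _ → refl) (𝕍-cong[] 6 (≡[]-sym (η³≡triangles′ n)))))

-- ∑ p(25m − 26) q^m
dissection₂₅ : 𝕌 24 (pow 𝕢 26 ⊗ P) ≈ pow P 25 ⊕ 𝕢 ⊗ P ⊕ 𝕍 4 (pow P 5)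
dissection₂₅ =
  ≈-trans split (≈-trans (𝕌-cong 4 first) (≈-trans second
    (solveBy v0 (v1 :^ 25 :+ v2 :* v1 :+ v3) (𝕢 ⊗ (X ⊕ P) ∷ P ∷ 𝕢 ∷ 𝕍 4 (pow P 5) ∷ X ∷ η ∷ η[ 4 ] ∷ P[ 4 ] ∷ F ∷ [])
      (([ `1 ]* v0 ≋ v2 :* (v4 :+ v1) by ≈-refl)
      ∷ ([ v1 :^ 6 ]* v2 :* (v5 :^ 6 :* v4) ≋ v2 :* v6 :+ v5 :* v8 :^ 4 by fifth)
      ∷ ([ v1 :^ 6 :* v5 :* (v8 :+ v1 :^ 5 :* `1 :+ v7) :^ 3 ]* v8 ≋ v1 :^ 5 :* `1 :+ v7 by Level5.dissection₅)
      ∷ ([ `1 ]* v3 ≋ v7 :^ 5 by 𝕍-pow 4 P 5)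
      ∷ ([ v1 :^ 6 :* v7 :^ 5 ]* v5 :^ 6 :+ v2 :* v6 :^ 6 ≋ v5 :* v6 by Level5.modular₅)
      ∷ ([ v2 :* v4 :* geo 6 (v1 :* v5) :+ v7 :^ 5 :* geo 6 (v1 :* v5) :+ v1 :^ 25 :+ v1 :^ 5 :* v7 :^ 4
           :+ v1 :^ 5 :* v7 :^ 5 :* v6 ]* v1 :* v5 ≋ `1 by P-inverse)
      ∷ ([ v2 :* v6 :* v1 :^ 6 :* geo 5 (v7 :* v6) :+ v1 :^ 5 :* v7 :^ 4 ]* v7 :* v6 ≋ `1 by P-inverse[ 4 ]) ∷ []) refl)))
  where
  F X : Series
  F = 𝕌 4 (pow 𝕢 1 ⊗ P)
  X = 𝕌 4 (pow P 5)
  split : 𝕌 24 (pow 𝕢 26 ⊗ P) ≈ 𝕌 4 (𝕌 4 (pow 𝕢 26 ⊗ P))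
  split m = cong (pow 𝕢 26 ⊗ P) (sym (*-assoc m 5 5))
  -- Since 26 = 25 + 1, the level 5 dissection applies to q P, while q²⁵ leaves the first 𝕌 as q⁵
  -- and the second as q.
  first : 𝕌 4 (pow 𝕢 26 ⊗ P) ≈ pow 𝕢 5 ⊗ (pow P 5 ⊕ P[ 4 ])
  first = ≈-trans (𝕌-cong 4 (≈-trans (solve (v0 :^ 26 :* v1) (v0 :^ 25 :* (v0 :^ 1 :* v1)) (𝕢 ∷ P ∷ []) refl)
                              (⊗-congʳ (≈-sym (𝕍-pow𝕢 4 5)))))
    (≈-trans (𝕌-⊗ 4 (pow 𝕢 5) (pow 𝕢 1 ⊗ P))
      (⊗-congˡ (≈-trans Level5.dissection₅ (⊕-cong (⊗-identityʳ (pow P 5)) (≈-refl {P[ 4 ]})))))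
  second : 𝕌 4 (pow 𝕢 5 ⊗ (pow P 5 ⊕ P[ 4 ])) ≈ 𝕢 ⊗ (X ⊕ P)
  second = ≈-trans (𝕌-shift 4 (pow P 5 ⊕ P[ 4 ])) (⊗-congˡ (⊕-congʳ X (𝕍-at 4 P)))
  -- T₅ applied to Y⁶/X⁵ = X + Y/X⁴.
  fifth : 𝕢 ⊗ (pow η 6 ⊗ X) ≈ 𝕢 ⊗ η[ 4 ] ⊕ η ⊗ pow F 4
  fifth =
    ≈-trans (≈-sym (≈-trans (𝕌-shift 4 (𝕍 4 (pow η 6) ⊗ pow P 5)) (⊗-congˡ (𝕌-⊗ 4 (pow η 6) (pow P 5)))))
      (≈-trans (𝕌-cong 4 (solveBy (v0 :^ 5 :* (v4 :* v1 :^ 5)) (v0 :^ 4 :* v2 :+ v3 :* (v0 :^ 1 :* v1) :^ 4)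
            (𝕢 ∷ P ∷ η ∷ η[ 4 ] ∷ 𝕍 4 (pow η 6) ∷ [])
            (([ v0 :^ 4 :* v1 :^ 5 ]* v2 :^ 6 :+ v0 :* v3 :^ 6 ≋ v2 :* v3 by Level5.modular₅)
            ∷ ([ v0 :^ 5 :* v1 :^ 5 ]* v4 ≋ v3 :^ 6 by 𝕍-pow 4 η 6)
            ∷ ([ v0 :^ 4 :* v2 :* geo 5 (v1 :* v2) :+ v0 :^ 4 :* v1 :^ 4 :* v3 ]* v1 :* v2 ≋ `1 by P-inverse) ∷ []) refl))
        (⊕-cong 𝕌₅-η
          (≈-trans (𝕌-⊗ 4 η (pow (pow 𝕢 1 ⊗ P) 4)) (⊗-congˡ (𝕌-fourth 4 (pow 𝕢 1 ⊗ P) refl)))))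

-- T₇ η⁷ = η
𝕌₇-η⁷ : 𝕌 6 (pow η 7) ≈ η ⊕ pow 𝕢 2 ⊗ 𝕍 6 (pow η 7)
𝕌₇-η⁷ = ≈-trans (𝕌-cong 6 expand)
  (≈-trans (⊕-cong (⊕-cong (𝕍-at 6 η) (𝕌-⊗ 6 (pow η 4) (𝕢 ⊗ pow η 3))) (𝕌-⊗ 6 (pow η 8) (pow 𝕢 2 ⊗ P)))
    (solveBy (v0 :+ v0 :^ 4 :* v3 :+ v0 :^ 8 :* v4) (v0 :+ v2 :^ 2 :* v5)
      (η ∷ P ∷ 𝕢 ∷ 𝕌 6 (𝕢 ⊗ pow η 3) ∷ 𝕌 6 (pow 𝕢 2 ⊗ P) ∷ 𝕍 6 (pow η 7) ∷ y ∷ P[ 6 ] ∷ 𝕍 6 (pow η 3) ∷ [])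
      (([ v0 :^ 4 ]* v3 ≋ v2 :* v8 by 𝕌₇-η³)
      ∷ ([ v0 :^ 4 :* v2 ]* v8 ≋ v6 :^ 3 by 𝕍-pow 6 η 3)
      ∷ ([ v0 :^ 8 ]* v4 ≋ v1 :^ 7 :* `1 :+ v7 by Level7.dissection₇)
      ∷ ([ v2 :^ 2 ]* v5 ≋ v6 :^ 7 by 𝕍-pow 6 η 7)
      ∷ ([ v7 ]* v0 :^ 8 :+ v2 :^ 2 :* v6 :^ 8 ≋ v0 :* v6 :+ v2 :* (v0 :* v6) :^ 4 by Level7.modular₇)
      ∷ ([ v0 :* geo 7 (v1 :* v0) ]* v1 :* v0 ≋ `1 by P-inverse)
      ∷ ([ v0 :+ v2 :* v0 :^ 4 :* v6 :^ 3 :+ v2 :^ 2 :* v6 :^ 7 ]* v7 :* v6 ≋ `1 by P-inverse[ 6 ]) ∷ []) refl))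
  where
  y : Series
  y = η[ 6 ]
  -- This is `modular₇` divided by η. Each summand is a power of η(q⁷) times a series whose image
  -- under 𝕌 is known.
  expand : pow η 7 ≈ y ⊕ 𝕍 6 (pow η 4) ⊗ (𝕢 ⊗ pow η 3) ⊕ 𝕍 6 (pow η 8) ⊗ (pow 𝕢 2 ⊗ P)
  expand = solveBy (v0 :^ 7) (v2 :+ v3 :* (v4 :* v0 :^ 3) :+ v5 :* (v4 :^ 2 :* v1))
    (η ∷ P ∷ y ∷ 𝕍 6 (pow η 4) ∷ 𝕢 ∷ 𝕍 6 (pow η 8) ∷ [])
    (([ v1 ]* v0 :^ 8 :+ v4 :^ 2 :* v2 :^ 8 ≋ v0 :* v2 :+ v4 :* (v0 :* v2) :^ 4 by Level7.modular₇)
    ∷ ([ v4 :* v0 :^ 3 ]* v3 ≋ v2 :^ 4 by 𝕍-pow 6 η 4)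
    ∷ ([ v4 :^ 2 :* v1 ]* v5 ≋ v2 :^ 8 by 𝕍-pow 6 η 8)
    ∷ ([ v0 :^ 7 :+ v2 :+ v4 :* v0 :^ 3 :* v2 :^ 4 ]* v1 :* v0 ≋ `1 by P-inverse) ∷ []) refl

-- Exponents of theta series

∑-supp : ∀ n (F : ℕ → Series) e → ∑ n F e ≡ true → ∃ λ k → F k e ≡ true
∑-supp (suc n) F e p with ∑ n F e in eq | F n e in eq′
... | true | _ = ∑-supp n F e eq
... | false | true = n , eq′
∑-supp (suc n) F e () | false | false

⊕-supp : ∀ f g e → (f ⊕ g) e ≡ true → f e ≡ true ⊎ g e ≡ true
⊕-supp f g e p with f e
... | true = inj₁ refl
... | false = inj₂ p

⊗-supp : ∀ f g e → (f ⊗ g) e ≡ true → ∃ λ i → ∃ λ j → e ≡ i + j × f i ≡ true × g j ≡ true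
⊗-supp f g zero p with f 0 in a | g 0 in b
... | true | true = 0 , 0 , refl , a , b
⊗-supp f g (suc e) p with f 0 ∧ g (suc e) in eq
⊗-supp f g (suc e) p | true with f 0 in a | g (suc e) in b
... | true | true = 0 , suc e , refl , a , b
⊗-supp f g (suc e) p | false with ⊗-supp (tl f) g e p
... | i , j , e≡ , fi , gj = suc i , j , cong suc e≡ , fi , gj

double-tri′ : ∀ k → 2 * tri k ≡ k * suc k
double-tri′ k = trans (cong (tri k +_) (+-identityʳ (tri k))) (double-tri k)

η-supp : ∀ n → η n ≡ true → ∃ λ x → 24 * n + 1 ≡ x * x
η-supp n p = go (∑-supp (suc n) (λ k → pow 𝕢 (lo k) ⊕ pow 𝕢 (hi k)) n (trans (sym (η≡partial (suc n) n ≤-refl)) p))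
  where
  lo-square : ∀ k → n ≡ lo k → ∃ λ x → 24 * n + 1 ≡ x * x
  lo-square k refl = 6 * k + 1 , trans (regroup k (tri k)) (trans (cong (λ t → 24 * (k * k) + 12 * t + 1) (double-tri′ k)) (complete k))
    where
    regroup : ∀ k t → 24 * (k * k + t) + 1 ≡ 24 * (k * k) + 12 * (2 * t) + 1
    regroup = solve-∀
    complete : ∀ k → 24 * (k * k) + 12 * (k * suc k) + 1 ≡ (6 * k + 1) * (6 * k + 1)
    complete = solve-∀
  hi-square : ∀ k → n ≡ hi k → ∃ λ x → 24 * n + 1 ≡ x * x
  hi-square k refl = 6 * k + 5 , trans (regroup k (tri k)) (trans (cong (λ t → 24 * (suc k * suc k) + 12 * t + 1) (double-tri′ k)) (complete k))
    where
    regroup : ∀ k t → 24 * (suc k * suc k + t) + 1 ≡ 24 * (suc k * suc k) + 12 * (2 * t) + 1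
    regroup = solve-∀
    complete : ∀ k → 24 * (suc k * suc k) + 12 * (k * suc k) + 1 ≡ (6 * k + 5) * (6 * k + 5)
    complete = solve-∀
  split : ∀ k → pow 𝕢 (lo k) n ≡ true ⊎ pow 𝕢 (hi k) n ≡ true → ∃ λ x → 24 * n + 1 ≡ x * x
  split k (inj₁ r) = lo-square k (pow𝕢-supp (lo k) n r)
  split k (inj₂ r) = hi-square k (pow𝕢-supp (hi k) n r)
  go : (∃ λ k → (pow 𝕢 (lo k) ⊕ pow 𝕢 (hi k)) n ≡ true) → ∃ λ x → 24 * n + 1 ≡ x * x
  go (k , r) = split k (⊕-supp (pow 𝕢 (lo k)) (pow 𝕢 (hi k)) n r)

η³-supp : ∀ n → pow η 3 n ≡ true → ∃ λ x → 8 * n + 1 ≡ x * x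
η³-supp n p = go (∑-supp (suc n) (λ k → pow 𝕢 (tri k)) n (trans (sym (η³≡triangles′ (suc n) n ≤-refl)) p))
  where
  square : ∀ k → n ≡ tri k → ∃ λ x → 8 * n + 1 ≡ x * x
  square k refl = 2 * k + 1 , trans (regroup (tri k)) (trans (cong (λ t → 4 * t + 1) (double-tri′ k)) (complete k))
    where
    regroup : ∀ t → 8 * t + 1 ≡ 4 * (2 * t) + 1
    regroup = solve-∀
    complete : ∀ k → 4 * (k * suc k) + 1 ≡ (2 * k + 1) * (2 * k + 1)
    complete = solve-∀
  go : (∃ λ k → pow 𝕢 (tri k) n ≡ true) → ∃ λ x → 8 * n + 1 ≡ x * x
  go (k , r) = square k (pow𝕢-supp (tri k) n r)

⊥⇒false : ∀ {b} → (b ≡ true → ⊥) → b ≡ false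
⊥⇒false {false} _ = refl
⊥⇒false {true} f = ⊥-elim (f refl)

-- Quadratic residues

reduce-square : ∀ M .{{_ : NonZero M}} c d x k → ∃ λ l → c * (x * x) + d + k * M ≡ c * (x % M * (x % M)) + d + l * M
reduce-square M c d x k =
  c * (r * t + t * r + t * t * M) + k , trans (cong (λ z → c * (z * z) + d + k * M) (m≡m%n+[m/n]*n x M)) (go M c d r t k)
  where
  r = x % M
  t = x / M
  go : ∀ M c d r t k → c * ((r + t * M) * (r + t * M)) + d + k * M ≡ c * (r * r) + d + (c * (r * t + t * r + t * t * M) + k) * M
  go = solve-∀

Avoids : (M c d e : ℕ) .{{_ : NonZero M}} → Set
Avoids M c d e = ∀ r → r < M → (c * (r * r) + d) % M ≢ e % M

avoids? : ∀ M c d e .{{_ : NonZero M}} → Dec (Avoids M c d e)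
avoids? M c d e =
  map′ (λ av r → av {r}) (λ av {r} → av r) (allUpTo? (λ r → ¬? ((c * (r * r) + d) % M ≟ e % M)) M)

avoids-holds : ∀ M c d e .{{_ : NonZero M}} → Avoids M c d e → ∀ x k l → c * (x * x) + d + k * M ≡ e + l * M → ⊥
avoids-holds M c d e av x k l eq with reduce-square M c d x k
... | j , eq′ = av (x % M) (m%n<n x M)
  (trans (sym ([m+kn]%n≡m%n (c * (x % M * (x % M)) + d) j M))
    (trans (cong (_% M) (trans (sym eq′) eq)) ([m+kn]%n≡m%n e l M)))

Avoids₂ : (M c d e : ℕ) .{{_ : NonZero M}} → Set
Avoids₂ M c d e = ∀ r → r < M → Avoids M c (r * r + d) e

avoids₂? : ∀ M c d e .{{_ : NonZero M}} → Dec (Avoids₂ M c d e)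
avoids₂? M c d e =
  map′ (λ av r → av {r}) (λ av {r} → av r) (allUpTo? (λ r → avoids? M c (r * r + d) e) M)

avoids₂-holds : ∀ M c d e .{{_ : NonZero M}} → Avoids₂ M c d e →
  ∀ x y l → c * (x * x) + (y * y + d) ≡ e + l * M → ⊥
avoids₂-holds M c d e av x y l eq with reduce-square M 1 d y 0
... | j , eq′ = avoids-holds M c (y % M * (y % M) + d) e (av (y % M) (m%n<n y M)) x j l
  (trans (go (c * (x * x)) (y % M * (y % M)) d (j * M))
    (trans (cong (c * (x * x) +_) (trans (sym eq′) (go′ (y * y) d))) eq))
  where
  go : ∀ a b d z → a + (b + d) + z ≡ a + (1 * b + d + z)
  go = solve-∀
  go′ : ∀ b d → 1 * b + d + 0 ≡ b + d
  go′ = solve-∀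

-- Vanishing coefficients and the comparison of b_m with p_t

extract : ∀ k s g N → s ≤ N * suc k → (𝕍 k g ⊗ P) (N * suc k ∸ s) ≡ (g ⊗ 𝕌 k (pow 𝕢 s ⊗ P)) N
extract k s g N s≤ = begin
  X (N * suc k ∸ s)                            ≡⟨ pow𝕢-shift s X (N * suc k ∸ s) ⟨
  (pow 𝕢 s ⊗ X) (s + (N * suc k ∸ s))          ≡⟨ cong (pow 𝕢 s ⊗ X) (m+[n∸m]≡n s≤) ⟩
  (pow 𝕢 s ⊗ X) (N * suc k)
    ≡⟨ solve (v0 :* (v1 :* v2)) (v1 :* (v0 :* v2)) (pow 𝕢 s ∷ 𝕍 k g ∷ P ∷ []) refl (N * suc k) ⟩
  (𝕍 k g ⊗ (pow 𝕢 s ⊗ P)) (N * suc k)          ≡⟨ 𝕌-⊗ k g (pow 𝕢 s ⊗ P) N ⟩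
  (g ⊗ 𝕌 k (pow 𝕢 s ⊗ P)) N                    ∎
  where
  open ≡-Reasoning
  X = 𝕍 k g ⊗ P

%2-cong : ∀ {m n} → parity m ≡ parity n → m % 2 ≡ n % 2
%2-cong {m} {n} p = trans (%2-parity m) (trans (cong (if_then 1 else 0) p) (sym (%2-parity n)))


-- Writing N = u(j + 1) + v(k + 1) with 24 u + 1 = x² gives (j + 1) x² = 24 N + j + 1 modulo k + 1.
split-residue : ∀ j k g N c l → Avoids (suc k) (suc j) 0 c → 24 * N + suc j ≡ c + l * suc k →
  (𝕍 j η ⊗ 𝕍 k g) N ≡ false
split-residue j k g N c l av eq = ⊥⇒false λ p → go (⊗-supp (𝕍 j η) (𝕍 k g) N p)
  where
  shuffle : ∀ j k u v → suc j * (24 * u + 1) + 0 + 24 * v * suc k ≡ 24 * (u * suc j + v * suc k) + suc j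
  shuffle = solve-∀
  finish : ∀ u v → N ≡ u * suc j + v * suc k → (∃ λ x → 24 * u + 1 ≡ x * x) → ⊥
  finish u v N≡ (x , x≡) = avoids-holds (suc k) (suc j) 0 c av x (24 * v) l
    (trans (cong (λ z → suc j * z + 0 + 24 * v * suc k) (sym x≡))
      (trans (shuffle j k u v) (trans (cong (λ z → 24 * z + suc j) (sym N≡)) eq)))
  roots : ∀ a a′ → N ≡ a + a′ → (∃ λ u → a ≡ u * suc j × η u ≡ true) → (∃ λ v → a′ ≡ v * suc k × g v ≡ true) → ⊥
  roots a a′ N≡ (u , a≡ , pu) (v , a′≡ , _) = finish u v (trans N≡ (cong₂ _+_ a≡ a′≡)) (η-supp u pu)
  go : (∃ λ a → ∃ λ a′ → N ≡ a + a′ × 𝕍 j η a ≡ true × 𝕍 k g a′ ≡ true) → ⊥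
  go (a , a′ , N≡ , pa , pa′) = roots a a′ N≡ (𝕍-supp j η a pa) (𝕍-supp k g a′ pa′)

shifted-false : ∀ f N → (∀ n → N ≡ suc n → f n ≡ true → ⊥) → (𝕢 ⊗ f) N ≡ false
shifted-false f zero _ = refl
shifted-false f (suc n) h = trans (𝕢⊗-suc f n) (⊥⇒false (h n refl))

-- The constant 23 is 24 - 1: for N = n + 1 and 24 n + 1 = x² one has x² + 23 = 24 N. For η³, with 8
-- in place of 24, it becomes 7.
η-residue : ∀ M .{{_ : NonZero M}} N c l → Avoids M 1 23 c → 24 * N ≡ c + l * M → (𝕢 ⊗ η) N ≡ false
η-residue M N c l av eq = shifted-false η N (λ n N≡ p → finish n N≡ (η-supp n p))
  where
  shuffle : ∀ n → 1 * (24 * n + 1) + 23 + 0 ≡ 24 * suc n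
  shuffle = solve-∀
  finish : ∀ n → N ≡ suc n → (∃ λ x → 24 * n + 1 ≡ x * x) → ⊥
  finish n refl (x , x≡) = avoids-holds M 1 23 c av x 0 l
    (trans (cong (λ z → 1 * z + 23 + 0) (sym x≡)) (trans (shuffle n) eq))

η³-residue : ∀ M .{{_ : NonZero M}} N c l → Avoids M 1 7 c → 8 * N ≡ c + l * M → (𝕢 ⊗ pow η 3) N ≡ false
η³-residue M N c l av eq = shifted-false (pow η 3) N (λ n N≡ p → finish n N≡ (η³-supp n p))
  where
  shuffle : ∀ n → 1 * (8 * n + 1) + 7 + 0 ≡ 8 * suc n
  shuffle = solve-∀
  finish : ∀ n → N ≡ suc n → (∃ λ x → 8 * n + 1 ≡ x * x) → ⊥
  finish n refl (x , x≡) = avoids-holds M 1 7 c av x 0 l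
    (trans (cong (λ z → 1 * z + 7 + 0) (sym x≡)) (trans (shuffle n) eq))

frobenius₄ : ∀ f → pow f 4 ≈ 𝕍 3 f
frobenius₄ f = ≈-trans (pow-* f 2 2)
  (≈-trans (frobenius (pow f 2)) (≈-trans (𝕍-cong 1 (frobenius f)) (𝕍-∘ 1 1 f)))

frobenius₈ : ∀ f → pow f 8 ≈ 𝕍 7 f
frobenius₈ f = ≈-trans (pow-* f 2 4)
  (≈-trans (frobenius (pow f 4)) (≈-trans (𝕍-cong 1 (frobenius₄ f)) (𝕍-∘ 1 3 f)))

frobenius₁₆ : ∀ f → pow f 16 ≈ 𝕍 15 f
frobenius₁₆ f = ≈-trans (pow-* f 2 8)
  (≈-trans (frobenius (pow f 8)) (≈-trans (𝕍-cong 1 (frobenius₈ f)) (𝕍-∘ 1 7 f)))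

-- η¹⁵ = η³(q) η³(q⁴) leads to sums x² + 4y², which are never exactly divisible by 3.
η¹⁵-residue : ∀ M .{{_ : NonZero M}} N c l → Avoids₂ M 4 3 c → 8 * N ≡ c + l * M → (𝕢 ⊗ pow η 15) N ≡ false
η¹⁵-residue M N c l av eq =
  shifted-false (pow η 15) N (λ n N≡ p → go n N≡ (⊗-supp (pow η 3) (𝕍 3 (pow η 3)) n (trans (sym (factor n)) p)))
  where
  factor : pow η 15 ≈ pow η 3 ⊗ 𝕍 3 (pow η 3)
  factor = ≈-trans (pow-+ η 3 12) (⊗-congˡ (≈-trans (pow-* η 4 3) (frobenius₄ (pow η 3))))
  shuffle : ∀ a v → 4 * (8 * v + 1) + (8 * a + 1 + 3) ≡ 8 * suc (a + v * 4)
  shuffle = solve-∀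
  finish : ∀ a v → N ≡ suc (a + v * 4) → (∃ λ y → 8 * a + 1 ≡ y * y) → (∃ λ x → 8 * v + 1 ≡ x * x) → ⊥
  finish a v N≡ (y , y≡) (x , x≡) = avoids₂-holds M 4 3 c av x y l
    (trans (cong₂ (λ s t → 4 * s + (t + 3)) (sym x≡) (sym y≡))
      (trans (shuffle a v) (trans (cong (8 *_) (sym N≡)) eq)))
  roots : ∀ a a′ → N ≡ suc (a + a′) → pow η 3 a ≡ true → (∃ λ v → a′ ≡ v * 4 × pow η 3 v ≡ true) → ⊥
  roots a a′ N≡ pa (v , a′≡ , pv) = finish a v (trans N≡ (cong (λ z → suc (a + z)) a′≡)) (η³-supp a pa) (η³-supp v pv)
  go : ∀ n → N ≡ suc n → (∃ λ a → ∃ λ a′ → n ≡ a + a′ × pow η 3 a ≡ true × 𝕍 3 (pow η 3) a′ ≡ true) → ⊥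
  go n N≡ (a , a′ , n≡ , pa , pa′) = roots a a′ (trans N≡ (cong suc n≡)) pa (𝕍-supp 3 (pow η 3) a′ pa′)

-- The coefficient is that of q^n′ in T₇ η⁷ = η + q² η(q⁷)⁷. The first summand is excluded when 24
-- n′ + 1 is no square modulo 7, the second when n′ is not 2 modulo 7.
η⁷-residue : ∀ n′ c l d l′ → Avoids 7 1 0 c → 24 * n′ + 1 ≡ c + l * 7 → Avoids 7 0 2 d → n′ ≡ d + l′ * 7 →
  (𝕢 ⊗ pow η 7) (suc (n′ * 7)) ≡ false
η⁷-residue n′ c l d l′ av eq av′ eq′ =
  trans (𝕢⊗-suc (pow η 7) (n′ * 7))
    (trans (𝕌₇-η⁷ n′) (cong₂ _xor_ (⊥⇒false (λ p → pentagonal (η-supp n′ p)))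
                                     (⊥⇒false (λ p → go (⊗-supp (pow 𝕢 2) (𝕍 6 (pow η 7)) n′ p)))))
  where
  shuffle : ∀ z → 1 * z + 0 + 0 ≡ z
  shuffle = solve-∀
  pentagonal : (∃ λ x → 24 * n′ + 1 ≡ x * x) → ⊥
  pentagonal (x , x≡) = avoids-holds 7 1 0 c av x 0 l (trans (trans (shuffle (x * x)) (sym x≡)) eq)
  roots : ∀ a a′ → n′ ≡ a + a′ → a ≡ 2 → (∃ λ v → a′ ≡ v * 7 × pow η 7 v ≡ true) → ⊥
  roots a a′ n≡ a≡ (v , a′≡ , _) = avoids-holds 7 0 2 d av′ 0 v l′ (trans (sym (trans n≡ (cong₂ _+_ a≡ a′≡))) eq′)
  go : (∃ λ a → ∃ λ a′ → n′ ≡ a + a′ × pow 𝕢 2 a ≡ true × 𝕍 6 (pow η 7) a′ ≡ true) → ⊥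
  go (a , a′ , n≡ , pa , pa′) = roots a a′ n≡ (pow𝕢-supp 2 a pa) (𝕍-supp 6 (pow η 7) a′ pa′)

-- Multiplying the dissection of P by η^(e+s) = η(q^(j+1)) leaves P^r as the main term.
module Comparison (k shift m e k′ : ℕ) (g : Series)
  (dissection : 𝕌 k (pow 𝕢 shift ⊗ P) ≈ pow P m ⊕ 𝕢 ⊗ pow P e ⊕ 𝕍 k′ g)
  (j s r : ℕ) (frob : pow η (e + s) ≈ 𝕍 j η) (sum : r + (e + s) ≡ m) where

  index : ℕ
  index = j + k * suc j

  main : 𝕍 j η ⊗ 𝕌 k (pow 𝕢 shift ⊗ P) ≈ pow P r ⊕ 𝕢 ⊗ pow η s ⊕ 𝕍 j η ⊗ 𝕍 k′ g
  main = solveBy (v0 :* v1) (v2 :+ v3 :* v4 :+ v0 :* v5)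
    (𝕍 j η ∷ 𝕌 k (pow 𝕢 shift ⊗ P) ∷ pow P r ∷ 𝕢 ∷ pow η s ∷ 𝕍 k′ g ∷ pow P e ∷ pow η e ∷ pow P m
      ∷ pow P (e + s) ∷ pow η (e + s) ∷ [])
    (([ v0 ]* v1 ≋ v8 :+ v3 :* v6 :+ v5 by dissection)
    ∷ ([ v8 :+ v3 :* v6 ]* v10 ≋ v0 by frob)
    ∷ ([ v10 ]* v8 ≋ v2 :* v9 by ≈-trans (λ n → cong (λ k → pow P k n) (sym sum)) (pow-+ P r (e + s)))
    ∷ ([ v2 ]* v9 :* v10 ≋ `1 by inverse (e + s))
    ∷ ([ v3 :* v6 ]* v10 ≋ v7 :* v4 by pow-+ η e s)
    ∷ ([ v3 :* v4 ]* v6 :* v7 ≋ `1 by inverse e) ∷ []) refl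
    where
    inverse : ∀ n → pow P n ⊗ pow η n ≈ 𝟙
    inverse n = ≈-trans (≈-sym (pow-⊗ P η n)) (≈-trans (pow-cong P-inverse n) (pow-𝟙 n))

  congruence : ∀ m i N → m ≡ suc index → i ≡ N * suc k ∸ shift → shift ≤ N * suc k →
    (𝕢 ⊗ pow η s) N ≡ false → (𝕍 j η ⊗ 𝕍 k′ g) N ≡ false → b m i % 2 ≡ pm r N % 2
  congruence _ _ N refl refl shift≤ z₁ z₂ = %2-cong {b (suc index) (N * suc k ∸ shift)} {pm r N} (begin
    parity (b (suc index) (N * suc k ∸ shift))        ≡⟨ parity-b index (N * suc k ∸ shift) ⟩
    (𝕍 index η ⊗ P) (N * suc k ∸ shift)               ≡⟨ ⊗-congʳ {g = P} (≈-sym (𝕍-∘ k j η)) (N * suc k ∸ shift) ⟩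
    (𝕍 k (𝕍 j η) ⊗ P) (N * suc k ∸ shift)             ≡⟨ extract k shift (𝕍 j η) N shift≤ ⟩
    (𝕍 j η ⊗ 𝕌 k (pow 𝕢 shift ⊗ P)) N                 ≡⟨ main N ⟩
    (pow P r N xor (𝕢 ⊗ pow η s) N) xor (𝕍 j η ⊗ 𝕍 k′ g) N
      ≡⟨ cong₂ (λ a c → (pow P r N xor a) xor c) z₁ z₂ ⟩
    (pow P r N xor false) xor false                   ≡⟨ trans (xor-identityʳ _) (xor-identityʳ _) ⟩
    pow P r N                                         ≡⟨ parity-pm r N ⟨
    parity (pm r N)                                   ∎)
    where open ≡-Reasoning

-- The five families of congruences

module Mod25 = Comparison 24 26 25 1 4 (pow P 5)
  (≈-trans dissection₂₅ (⊕-cong (⊕-congʳ (pow P 25) (⊗-congˡ (≈-sym (⊗-identityʳ P)))) ≈-refl))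

module Mod29 = Comparison 28 35 29 5 28 P
  -- As D = q η²⁴, the product P²⁹ D is q P⁵.
  (solveBy v0 (v1 :^ 29 :+ v2 :* v1 :^ 5 :+ v4) (𝕌 28 (pow 𝕢 35 ⊗ P) ∷ P ∷ 𝕢 ∷ η ∷ P[ 28 ] ∷ D ∷ [])
    (([ `1 ]* v0 ≋ v1 :^ 29 :* (`1 :+ v2 :* v3 :^ 24) :+ v4 by Level29.dissection₂₉)
    ∷ ([ v2 :* v1 :^ 5 :* geo 24 (v1 :* v3) ]* v1 :* v3 ≋ `1 by P-inverse) ∷ []) refl)


-- Every B is at least 2, so 25 B ≥ 26 and 29 B ≥ 35: the subtractions in the congruences never
-- truncate.
shift≤ : ∀ {shift} k N → 2 ≤ N → shift ≤ 2 * suc k → shift ≤ N * suc k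
shift≤ k N 2≤N l = ≤-trans l (*-monoˡ-≤ (suc k) 2≤N)

-- The period is 35 = 5 · 7: modulo 7 the index avoids the exponents of q η, modulo 5 those of η(q²)
-- P(q⁵)⁵.
module Part₅₀ (n B : ℕ) (B∈ : B ∈ (11 ∷ 18 ∷ 21 ∷ 26 ∷ 28 ∷ 33 ∷ [])) where
  Bs : List ℕ
  Bs = 11 ∷ 18 ∷ 21 ∷ 26 ∷ 28 ∷ 33 ∷ []
  large : All (2 ≤_) Bs
  large = from-yes (all? (2 ≤?_) Bs)
  nonsquare : All (λ B → Avoids 7 1 23 (24 * B)) Bs
  nonsquare = from-yes (all? (λ B → avoids? 7 1 23 (24 * B)) Bs)
  residue : All (λ B → Avoids 5 2 0 (24 * B + 2)) Bs
  residue = from-yes (all? (λ B → avoids? 5 2 0 (24 * B + 2)) Bs)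
  expand : ∀ n B → 875 * n + 25 * B ≡ (35 * n + B) * 25
  expand = solve-∀
  regroup : ∀ n B → 24 * (35 * n + B) + 2 ≡ 24 * B + 2 + 168 * n * 5
  regroup = solve-∀
  regroup₇ : ∀ n B → 24 * (35 * n + B) ≡ 24 * B + 120 * n * 7
  regroup₇ = solve-∀
  theta : (𝕢 ⊗ pow η 1) (35 * n + B) ≡ false
  theta = trans (⊗-congˡ {𝕢} (⊗-identityʳ η) (35 * n + B))
    (η-residue 7 (35 * n + B) (24 * B) (120 * n) (All.lookup nonsquare B∈) (regroup₇ n B))
  excluded : (𝕍 1 η ⊗ 𝕍 4 (pow P 5)) (35 * n + B) ≡ false
  excluded = split-residue 1 4 (pow P 5) (35 * n + B) (24 * B + 2) (168 * n) (All.lookup residue B∈) (regroup n B)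
  congruence : b 50 (875 * n + 25 * B ∸ 26) % 2 ≡ pm 23 (35 * n + B) % 2
  congruence = Mod25.congruence 1 1 23 (frobenius η) refl
    50 (875 * n + 25 * B ∸ 26) (35 * n + B) refl (cong (_∸ 26) (expand n B))
    (shift≤ 24 (35 * n + B) (≤-trans (All.lookup large B∈) (m≤n+m B (35 * n))) (from-yes (26 ≤? 50))) theta excluded

-- For ℓ = 4 the middle term is q η³, so triangular numbers take the place of pentagonal ones modulo
-- 7.
module Part₁₀₀ (n B : ℕ) (B∈ : B ∈ (6 ∷ 12 ∷ 17 ∷ 26 ∷ 27 ∷ 31 ∷ [])) where
  Bs : List ℕ
  Bs = 6 ∷ 12 ∷ 17 ∷ 26 ∷ 27 ∷ 31 ∷ []
  large : All (2 ≤_) Bs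
  large = from-yes (all? (2 ≤?_) Bs)
  nonsquare : All (λ B → Avoids 7 1 7 (8 * B)) Bs
  nonsquare = from-yes (all? (λ B → avoids? 7 1 7 (8 * B)) Bs)
  residue : All (λ B → Avoids 5 4 0 (24 * B + 4)) Bs
  residue = from-yes (all? (λ B → avoids? 5 4 0 (24 * B + 4)) Bs)
  expand : ∀ n B → 875 * n + 25 * B ≡ (35 * n + B) * 25
  expand = solve-∀
  regroup : ∀ n B → 24 * (35 * n + B) + 4 ≡ 24 * B + 4 + 168 * n * 5
  regroup = solve-∀
  regroup₇ : ∀ n B → 8 * (35 * n + B) ≡ 8 * B + 40 * n * 7
  regroup₇ = solve-∀
  theta : (𝕢 ⊗ pow η 3) (35 * n + B) ≡ false
  theta = η³-residue 7 (35 * n + B) (8 * B) (40 * n) (All.lookup nonsquare B∈) (regroup₇ n B)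
  excluded : (𝕍 3 η ⊗ 𝕍 4 (pow P 5)) (35 * n + B) ≡ false
  excluded = split-residue 3 4 (pow P 5) (35 * n + B) (24 * B + 4) (168 * n) (All.lookup residue B∈) (regroup n B)
  congruence : b 100 (875 * n + 25 * B ∸ 26) % 2 ≡ pm 21 (35 * n + B) % 2
  congruence = Mod25.congruence 3 3 21 (frobenius₄ η) refl
    100 (875 * n + 25 * B ∸ 26) (35 * n + B) refl (cong (_∸ 26) (expand n B))
    (shift≤ 24 (35 * n + B) (≤-trans (All.lookup large B∈) (m≤n+m B (35 * n))) (from-yes (26 ≤? 50))) theta excluded

-- Every B is 1 modulo 7, so q η⁷ is read at exponents 7 n′ + 1, where T₇ applies. The condition on
-- n′ is again modulo 7, hence the period 245 = 5 · 7².
module Part₂₀₀ (n B : ℕ) (B∈ : B ∈ (22 ∷ 29 ∷ 92 ∷ 127 ∷ 169 ∷ 239 ∷ [])) where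
  Bs : List ℕ
  Bs = 22 ∷ 29 ∷ 92 ∷ 127 ∷ 169 ∷ 239 ∷ []
  large : All (2 ≤_) Bs
  large = from-yes (all? (2 ≤?_) Bs)
  nonsquare : All (λ B → Avoids 7 1 0 (24 * (B / 7) + 1)) Bs
  nonsquare = from-yes (all? (λ B → avoids? 7 1 0 (24 * (B / 7) + 1)) Bs)
  not-2 : All (λ B → Avoids 7 0 2 (B / 7)) Bs
  not-2 = from-yes (all? (λ B → avoids? 7 0 2 (B / 7)) Bs)
  one-mod-7 : All (λ B → B ≡ suc (B / 7 * 7)) Bs
  one-mod-7 = from-yes (all? (λ B → B ≟ suc (B / 7 * 7)) Bs)
  residue : All (λ B → Avoids 5 8 0 (24 * B + 8)) Bs
  residue = from-yes (all? (λ B → avoids? 5 8 0 (24 * B + 8)) Bs)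
  expand : ∀ n B → 6125 * n + 25 * B ≡ (245 * n + B) * 25
  expand = solve-∀
  regroup : ∀ n B → 24 * (245 * n + B) + 8 ≡ 24 * B + 8 + 1176 * n * 5
  regroup = solve-∀
  regroup₇ : ∀ n c → 24 * (35 * n + c) + 1 ≡ 24 * c + 1 + 120 * n * 7
  regroup₇ = solve-∀
  regroup₇′ : ∀ n c → 35 * n + c ≡ c + 5 * n * 7
  regroup₇′ = solve-∀
  split₇ : ∀ n c → 245 * n + suc (c * 7) ≡ suc ((35 * n + c) * 7)
  split₇ = solve-∀
  theta : (𝕢 ⊗ pow η 7) (245 * n + B) ≡ false
  theta = trans (cong (𝕢 ⊗ pow η 7) (trans (cong (245 * n +_) (All.lookup one-mod-7 B∈)) (split₇ n (B / 7))))
    (η⁷-residue (35 * n + B / 7) (24 * (B / 7) + 1) (120 * n) (B / 7) (5 * n)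
      (All.lookup nonsquare B∈) (regroup₇ n (B / 7)) (All.lookup not-2 B∈) (regroup₇′ n (B / 7)))
  excluded : (𝕍 7 η ⊗ 𝕍 4 (pow P 5)) (245 * n + B) ≡ false
  excluded = split-residue 7 4 (pow P 5) (245 * n + B) (24 * B + 8) (1176 * n) (All.lookup residue B∈) (regroup n B)
  congruence : b 200 (6125 * n + 25 * B ∸ 26) % 2 ≡ pm 17 (245 * n + B) % 2
  congruence = Mod25.congruence 7 7 17 (frobenius₈ η) refl
    200 (6125 * n + 25 * B ∸ 26) (245 * n + B) refl (cong (_∸ 26) (expand n B))
    (shift≤ 24 (245 * n + B) (≤-trans (All.lookup large B∈) (m≤n+m B (245 * n))) (from-yes (26 ≤? 50))) theta excluded

-- Exact divisibility by 3 is visible modulo 9, hence the period 45 = 5 · 9.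
module Part₄₀₀ (n B : ℕ) (B∈ : B ∈ (3 ∷ 9 ∷ 18 ∷ 39 ∷ [])) where
  Bs : List ℕ
  Bs = 3 ∷ 9 ∷ 18 ∷ 39 ∷ []
  large : All (2 ≤_) Bs
  large = from-yes (all? (2 ≤?_) Bs)
  nonnorm : All (λ B → Avoids₂ 9 4 3 (8 * B)) Bs
  nonnorm = from-yes (all? (λ B → avoids₂? 9 4 3 (8 * B)) Bs)
  residue : All (λ B → Avoids 5 16 0 (24 * B + 16)) Bs
  residue = from-yes (all? (λ B → avoids? 5 16 0 (24 * B + 16)) Bs)
  expand : ∀ n B → 1125 * n + 25 * B ≡ (45 * n + B) * 25
  expand = solve-∀
  regroup : ∀ n B → 24 * (45 * n + B) + 16 ≡ 24 * B + 16 + 216 * n * 5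
  regroup = solve-∀
  regroup₉ : ∀ n B → 8 * (45 * n + B) ≡ 8 * B + 40 * n * 9
  regroup₉ = solve-∀
  theta : (𝕢 ⊗ pow η 15) (45 * n + B) ≡ false
  theta = η¹⁵-residue 9 (45 * n + B) (8 * B) (40 * n) (All.lookup nonnorm B∈) (regroup₉ n B)
  excluded : (𝕍 15 η ⊗ 𝕍 4 (pow P 5)) (45 * n + B) ≡ false
  excluded = split-residue 15 4 (pow P 5) (45 * n + B) (24 * B + 16) (216 * n) (All.lookup residue B∈) (regroup n B)
  congruence : b 400 (1125 * n + 25 * B ∸ 26) % 2 ≡ pm 9 (45 * n + B) % 2
  congruence = Mod25.congruence 15 15 9 (frobenius₁₆ η) refl
    400 (1125 * n + 25 * B ∸ 26) (45 * n + B) refl (cong (_∸ 26) (expand n B))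
    (shift≤ 24 (45 * n + B) (≤-trans (All.lookup large B∈) (m≤n+m B (45 * n))) (from-yes (26 ≤? 50))) theta excluded

-- Here ℓ = 8 and the middle term is q P⁵ η⁸ = q η³; both conditions are modulo 29.
module Part₂₃₂ (n B : ℕ) (B∈ : B ∈ (3 ∷ 6 ∷ 10 ∷ 12 ∷ 13 ∷ 14 ∷ 15 ∷ 18 ∷ 20 ∷ 23 ∷ 24 ∷ 25 ∷ 26 ∷ 28 ∷ [])) where
  Bs : List ℕ
  Bs = 3 ∷ 6 ∷ 10 ∷ 12 ∷ 13 ∷ 14 ∷ 15 ∷ 18 ∷ 20 ∷ 23 ∷ 24 ∷ 25 ∷ 26 ∷ 28 ∷ []
  large : All (2 ≤_) Bs
  large = from-yes (all? (2 ≤?_) Bs)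
  nonsquare : All (λ B → Avoids 29 1 7 (8 * B)) Bs
  nonsquare = from-yes (all? (λ B → avoids? 29 1 7 (8 * B)) Bs)
  residue : All (λ B → Avoids 29 8 0 (24 * B + 8)) Bs
  residue = from-yes (all? (λ B → avoids? 29 8 0 (24 * B + 8)) Bs)
  expand : ∀ n B → 841 * n + 29 * B ≡ (29 * n + B) * 29
  expand = solve-∀
  regroup : ∀ n B → 24 * (29 * n + B) + 8 ≡ 24 * B + 8 + 24 * n * 29
  regroup = solve-∀
  regroup₂₉ : ∀ n B → 8 * (29 * n + B) ≡ 8 * B + 8 * n * 29
  regroup₂₉ = solve-∀
  theta : (𝕢 ⊗ pow η 3) (29 * n + B) ≡ false
  theta = η³-residue 29 (29 * n + B) (8 * B) (8 * n) (All.lookup nonsquare B∈) (regroup₂₉ n B)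
  excluded : (𝕍 7 η ⊗ 𝕍 28 (P)) (29 * n + B) ≡ false
  excluded = split-residue 7 28 (P) (29 * n + B) (24 * B + 8) (24 * n) (All.lookup residue B∈) (regroup n B)
  congruence : b 232 (841 * n + 29 * B ∸ 35) % 2 ≡ pm 21 (29 * n + B) % 2
  congruence = Mod29.congruence 7 3 21 (frobenius₈ η) refl
    232 (841 * n + 29 * B ∸ 35) (29 * n + B) refl (cong (_∸ 35) (expand n B))
    (shift≤ 28 (29 * n + B) (≤-trans (All.lookup large B∈) (m≤n+m B (29 * n))) (from-yes (35 ≤? 58))) theta excluded

theorem2 : (∀ (n B : ℕ) → B ∈ (11 ∷ 18 ∷ 21 ∷ 26 ∷ 28 ∷ 33 ∷ []) →
    b 50 (875 * n + 25 * B ∸ 26) % 2 ≡ pm 23 (35 * n + B) % 2)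
    × (∀ (n B : ℕ) → B ∈ (6 ∷ 12 ∷ 17 ∷ 26 ∷ 27 ∷ 31 ∷ []) →
    b 100 (875 * n + 25 * B ∸ 26) % 2 ≡ pm 21 (35 * n + B) % 2)
    × (∀ (n B : ℕ) → B ∈ (22 ∷ 29 ∷ 92 ∷ 127 ∷ 169 ∷ 239 ∷ []) →
    b 200 (6125 * n + 25 * B ∸ 26) % 2 ≡ pm 17 (245 * n + B) % 2)
    × (∀ (n B : ℕ) → B ∈ (3 ∷ 9 ∷ 18 ∷ 39 ∷ []) →
    b 400 (1125 * n + 25 * B ∸ 26) % 2 ≡ pm 9 (45 * n + B) % 2)
    × (∀ (n B : ℕ) → B ∈ (3 ∷ 6 ∷ 10 ∷ 12 ∷ 13 ∷ 14 ∷ 15 ∷ 18 ∷ 20 ∷ 23 ∷ 24 ∷ 25 ∷ 26 ∷ 28 ∷ []) →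
    b 232 (841 * n + 29 * B ∸ 35) % 2 ≡ pm 21 (29 * n + B) % 2)
theorem2 =
  (λ n B B∈ → Part₅₀.congruence n B B∈) ,
  (λ n B B∈ → Part₁₀₀.congruence n B B∈) ,
  (λ n B B∈ → Part₂₀₀.congruence n B B∈) ,
  (λ n B B∈ → Part₄₀₀.congruence n B B∈) ,
  (λ n B B∈ → Part₂₃₂.congruence n B B∈)
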